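{- Let $m,n$ be positive integers and let $C$ be an $n\times n$ integer matrix. Let \[ \mathcal{T}_m(\mathcal{M}_n(\mathbb{Z};H),C)=\{(A_1,\ldots,A_m)\in \mathcal{M}_n(\mathbb{Z};H)^m : A_1\cdots A_m=C\}. \] Then, uniformly in $C$, as $H\to\infty$, \[ \#\mathcal{T}_m(\mathcal{M}_n(\mathbb{Z};H),C)\le \begin{cases} H^{(m-1)(n^2-n)+o(1)}, & \text{if } C \text{ is nonsingular (for all } m),\\ H^{n^2+o(1)}, & \text{if } C\neq O_n \text{ is singular and } m=2,\\ H^{mn^2-n}, & \text{if } C\neq O_n \text{ is singular and } m\ge 3. \end{cases} \] Furthermore, when $C=O_n$ is the $n\times n$ zero matrix, \[ H^{(m-1)n^2}\ll \#\mathcal{T}_m(\mathcal{M}_n(\mathbb{Z};H),O_n)\le H^{(m-1)n^2+o(1)}. \]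
   Context: For positive integers $n,H$, $\mathcal{M}_n(\mathbb{Z};H)$ denotes the set of $n\times n$ integer matrices all of whose entries have absolute value at most $H$. $O_n$ is the $n\times n$ zero matrix. A bound $X\le H^{a+o(1)}$ means: for every $\varepsilon>0$, $X\le H^{a+\varepsilon}$ for all sufficiently large $H$. $U\ll V$ means $|U|\le cV$ for a constant $c>0$ depending only on $m$ and $n$. -}

module Defs where

open import Data.Nat as ℕ using (ℕ; zero; suc)
open import Data.Integer as ℤ using (ℤ; +_; -_)
open import Data.Fin using (Fin; zero; suc; punchIn)
open import Data.List using (List; []; _∷_; map; concatMap; length; filter; upTo)
open import Data.Vec using (Vec; []; _∷_; lookup; tabulate)
open import Data.Vec.Properties using (≡-dec)
open import Relation.Binary.PropositionalEquality using (_≡_)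
open import Relation.Nullary using (Dec)

Matrix : ℕ → Set
Matrix n = Vec (Vec ℤ n) n

entry : ∀ {n} → Matrix n → Fin n → Fin n → ℤ
entry A i j = lookup (lookup A i) j

sumFin : ∀ n → (Fin n → ℤ) → ℤ
sumFin zero    f = + 0
sumFin (suc n) f = f zero ℤ.+ sumFin n (λ k → f (suc k))

_⊗_ : ∀ {n} → Matrix n → Matrix n → Matrix n
_⊗_ {n} A B = tabulate λ i → tabulate λ j → sumFin n (λ k → entry A i k ℤ.* entry B k j)

identity : ∀ n → Matrix n
identity n = tabulate λ i → tabulate λ j → Data.Fin._≟_ i j |> λ where
    (Relation.Nullary.yes _) → + 1
    (Relation.Nullary.no _)  → + 0
  where open import Function using (_|>_)

prodMats : ∀ {n m} → Vec (Matrix n) m → Matrix n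
prodMats {n} []       = identity n
prodMats     (A ∷ As) = A ⊗ prodMats As

zeroMat : ∀ n → Matrix n
zeroMat n = tabulate λ _ → tabulate λ _ → + 0

detF : ∀ n → (Fin n → Fin n → ℤ) → ℤ
detF zero    A = + 1
detF (suc n) A = sumFin (suc n) λ j →
  sign j ℤ.* (A zero j ℤ.* detF n (λ i k → A (suc i) (punchIn j k)))
  where
  sign : ∀ {k} → Fin k → ℤ
  sign zero    = + 1
  sign (suc j) = - sign j

det : ∀ {n} → Matrix n → ℤ
det {n} A = detF n (entry A)

range : ℕ → List ℤ
range H = map (λ k → (+ k) ℤ.- (+ H)) (upTo (suc (2 ℕ.* H)))

vecsOf : ∀ {A : Set} k → List A → List (Vec A k)
vecsOf zero    xs = [] ∷ []
vecsOf (suc k) xs = concatMap (λ x → map (x ∷_) (vecsOf k xs)) xs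

-- M_n(Z;H), as a (duplicate-free) list
boundedMats : ∀ n → ℕ → List (Matrix n)
boundedMats n H = vecsOf n (vecsOf n (range H))

_≟M_ : ∀ {n} (A B : Matrix n) → Dec (A ≡ B)
_≟M_ = ≡-dec (≡-dec ℤ._≟_)

countT : ∀ m n → ℕ → Matrix n → ℕ
countT m n H C = length (filter (λ As → prodMats As ≟M C) (vecsOf m (boundedMats n H)))

{-# OPTIONS --safe #-}
module Submission where

-- Everything rests on counting integer matrices of given rank, or of given determinant d ≠ 0,
-- with entries at most H.  The rows of a matrix of rank r lie in a primitive lattice L of rank r.  Give L a
-- basis b₁, …, b_k (k ≤ r) reduced in the sense of Minkowski: bᵢ has size about 2^eᵢ, and a vector of L with
-- entries below 2^eᵢ lies in the span of b₁, …, bᵢ₋₁.  Then a vector of L in the box is determined by its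
-- coordinates modulo the numbers 2^(h - eᵢ), where 2^h is about H, so L has O(∏ H / 2^eᵢ) vectors in the box,
-- whereas there are O(∏ 2^(n eᵢ)) such bases.  The eᵢ cancel, so there are O(H^(nr) log^r H) matrices of rank
-- at most r.  If instead det A = d ≠ 0, apply this to all rows of A but one; modulo the resulting hyperplane
-- lattice the remaining row is a divisor of d, and d has H^o(1) divisors.
-- Nonsingular C: every factor Aᵢ satisfies Aᵢ Gᵢ = det C for some integral Gᵢ.  C = 0: by Sylvester the ranks
-- of the factors add up to at most (m - 1) n.  m = 2: a factor A₁ of rank r leaves O(H^(n (n - r))) choices of
-- A₂.  m ≥ 3: either A₁ is injective and cancels, or A₁ is singular and A₁ ⋯ Aₘ₋₁ ≠ 0 restricts each column of
-- Aₘ to a proper affine subspace.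

open import Defs
open import Algebra.Bundles using (AbelianGroup)
import Algebra.Properties.AbelianGroup as AbelianGroupₚ
import Algebra.Properties.CommutativeSemigroup as CommutativeSemigroupₚ
import Algebra.Properties.Semiring.Sum as Sumₚ
open import Algebra.Structures using (IsAbelianGroup)
open import Data.Fin as Fin using (Fin; zero; suc; punchIn; punchOut)
import Data.Fin.Properties as Finₚ
open import Data.Integer as ℤ using (ℤ; +_; -_; ∣_∣; 0ℤ; 1ℤ)
open import Data.Integer.Divisibility using () renaming (_∣_ to _∣ℤ_)
import Data.Integer.DivMod as ℤ/
import Data.Integer.Properties as ℤₚ
open import Data.Integer.Tactic.RingSolver using (solve-∀)
open import Data.List as List using (List; []; _∷_; length)
open import Data.List.Membership.Propositional using (_∈_; find; lose)
import Data.List.Membership.Propositional.Properties as ∈ₚ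
import Data.List.Properties as Listₚ
open import Data.List.Relation.Binary.Pointwise using (Pointwise; []; _∷_; Pointwise-length)
import Data.List.Relation.Ternary.Interleaving as Interleaving
open import Data.List.Relation.Ternary.Interleaving.Properties using (interleave-length)
open import Data.List.Relation.Ternary.Interleaving.Propositional using (Interleaving; []; consˡ; consʳ)
open import Data.List.Relation.Unary.All as All using (All; []; _∷_)
import Data.List.Relation.Unary.All.Properties as Allₚ
open import Data.List.Relation.Unary.AllPairs using ([]; _∷_)
open import Data.List.Relation.Unary.Any as Any using (Any; here; there)
open import Data.List.Relation.Unary.Unique.Propositional using (Unique)
import Data.List.Relation.Unary.Unique.DecPropositional.Properties as DecUniqueₚ
import Data.List.Relation.Unary.Unique.Propositional.Properties as Uniqueₚ
open import Data.Nat as ℕ using (ℕ; zero; suc; _+_; _*_; _∸_; _^_; _⊔_; _!; _≤_; _<_; _≥_; z≤n; s≤s; s≤s⁻¹; >-nonZero)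
open import Data.Nat.Divisibility using (divides; ∣⇒≤; ∣1⇒≡1; n∣m*n) renaming (_∣_ to _∣ℕ_; _∣?_ to _∣ℕ?_)
open import Data.Nat.DivMod using (_/_; _%_; m≡m%n+[m/n]*n; m%n<n; m/n*n≤m)
open import Data.Nat.Induction using (<-wellFounded)
open import Data.Nat.ListAction using (product)
open import Data.Nat.ListAction.Properties using (∈⇒∣product)
open import Data.Nat.Primality using (Prime; _Rough_; 2-rough; ∤⇒rough-suc; rough∧∣⇒rough; rough∧∣⇒prime; rough⇒≤; euclidsLemma; prime⇒nonZero; prime⇒nonTrivial)
open import Data.Nat.Primality.Factorisation using (factorise; PrimeFactorisation)
import Data.Nat.Properties as ℕₚ
open import Data.Nat.Tactic.RingSolver using () renaming (solve-∀ to solve-∀ℕ)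
open import Data.Product using (_×_; ∃; ∃-syntax; ∃₂; Σ-syntax; _,_; proj₁; proj₂)
import Data.Sign as Sign
open import Data.Sum using (_⊎_; inj₁; inj₂)
open import Data.Unit using (⊤; tt)
open import Data.Vec as Vec using (Vec; []; _∷_; _[_]≔_; head; tail; lookup; replicate; tabulate; transpose; zipWith)
open import Data.Vec.Functional using (Vector) renaming (_∷_ to _▹_)
import Data.Vec.Properties as Vecₚ
open import Data.Vec.Relation.Unary.All as VAll using ([]; _∷_)
import Data.Vec.Relation.Unary.All.Properties as VAllₚ
open import Function using (_∘_; id; _∋_)
open import Function.Bundles using (_⇔_; mk⇔; Equivalence)
open import Induction.WellFounded using (Acc; acc)
open import Level using (0ℓ)
open import Relation.Binary.Definitions using (DecidableEquality)
open import Relation.Binary.PropositionalEquality using (_≡_; _≢_; _≗_; refl; sym; trans; cong; cong₂; subst; isEquivalence; module ≡-Reasoning)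
open import Relation.Nullary using (¬_; yes; no; contradiction)
open import Relation.Nullary.Decidable using (_×-dec_; ¬?; decidable-stable)
open Sumₚ ℤₚ.+-*-semiring using (sum; sum-cong-≗; ∑-distrib-+; *-distribˡ-sum; sum-replicate-zero)

-- Integer vectors and linear maps

infixl 6 _⊕_ _⊖_
infixr 7 _⊙_

_⊕_ : ∀ {n} → Vec ℤ n → Vec ℤ n → Vec ℤ n
_⊕_ = zipWith ℤ._+_

_⊙_ : ∀ {n} → ℤ → Vec ℤ n → Vec ℤ n
c ⊙ x = Vec.map (c ℤ.*_) x

_⊖_ : ∀ {n} → Vec ℤ n → Vec ℤ n → Vec ℤ n
x ⊖ y = x ⊕ - 1ℤ ⊙ y

𝟘 : ∀ {n} → Vec ℤ n
𝟘 = replicate _ 0ℤ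

⊕-inverseʳ : ∀ {n} (x : Vec ℤ n) → x ⊖ x ≡ 𝟘
⊕-inverseʳ []      = refl
⊕-inverseʳ (a ∷ x) = cong₂ _∷_ (a-a≡0 a) (⊕-inverseʳ x)
  where
  a-a≡0 : ∀ a → a ℤ.+ - 1ℤ ℤ.* a ≡ 0ℤ
  a-a≡0 = solve-∀

⊕-comm : ∀ {n} (x y : Vec ℤ n) → x ⊕ y ≡ y ⊕ x
⊕-comm = Vecₚ.zipWith-comm ℤₚ.+-comm

⊕-isAbelianGroup : ∀ n → IsAbelianGroup _≡_ (_⊕_ {n}) 𝟘 (- 1ℤ ⊙_)
⊕-isAbelianGroup n = record
  { isGroup = record
    { isMonoid = record
      { isSemigroup = record
        { isMagma = record { isEquivalence = isEquivalence ; ∙-cong = cong₂ _⊕_ }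
        ; assoc = Vecₚ.zipWith-assoc ℤₚ.+-assoc }
      ; identity = Vecₚ.zipWith-identityˡ ℤₚ.+-identityˡ , Vecₚ.zipWith-identityʳ ℤₚ.+-identityʳ }
    ; inverse = (λ x → trans (⊕-comm _ x) (⊕-inverseʳ x)) , ⊕-inverseʳ
    ; ⁻¹-cong = cong (- 1ℤ ⊙_) }
  ; comm = ⊕-comm }

⊕-abelianGroup : ℕ → AbelianGroup 0ℓ 0ℓ
⊕-abelianGroup n = record { isAbelianGroup = ⊕-isAbelianGroup n }

module ⊕ₚ {n : ℕ} where
  open AbelianGroup (⊕-abelianGroup n) public using (assoc; identityˡ; identityʳ)
  open AbelianGroupₚ (⊕-abelianGroup n) public
    using (//-rightDividesˡ; xyx⁻¹≈y; x∙y⁻¹≈ε⇒x≈y)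
  open CommutativeSemigroupₚ (AbelianGroup.commutativeSemigroup (⊕-abelianGroup n)) public
    using (interchange)

⊙-distribˡ-⊕ : ∀ {n} c (x y : Vec ℤ n) → c ⊙ (x ⊕ y) ≡ c ⊙ x ⊕ c ⊙ y
⊙-distribˡ-⊕ c []      []      = refl
⊙-distribˡ-⊕ c (a ∷ x) (b ∷ y) = cong₂ _∷_ (ℤₚ.*-distribˡ-+ c a b) (⊙-distribˡ-⊕ c x y)

⊙-distribʳ-+ : ∀ {n} (x : Vec ℤ n) c d → (c ℤ.+ d) ⊙ x ≡ c ⊙ x ⊕ d ⊙ x
⊙-distribʳ-+ []      c d = refl
⊙-distribʳ-+ (a ∷ x) c d = cong₂ _∷_ (ℤₚ.*-distribʳ-+ a c d) (⊙-distribʳ-+ x c d)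

⊙-assoc : ∀ {n} c d (x : Vec ℤ n) → (c ℤ.* d) ⊙ x ≡ c ⊙ d ⊙ x
⊙-assoc c d x = trans (Vecₚ.map-cong (ℤₚ.*-assoc c d) x) (Vecₚ.map-∘ (c ℤ.*_) (d ℤ.*_) x)

⊙-comm : ∀ {n} c d (x : Vec ℤ n) → c ⊙ d ⊙ x ≡ d ⊙ c ⊙ x
⊙-comm c d x = trans (sym (⊙-assoc c d x)) (trans (cong (_⊙ x) (ℤₚ.*-comm c d)) (⊙-assoc d c x))

⊙-zeroˡ : ∀ {n} (x : Vec ℤ n) → 0ℤ ⊙ x ≡ 𝟘
⊙-zeroˡ x = Vecₚ.map-const x 0ℤ

⊙-zeroʳ : ∀ {n} c → c ⊙ 𝟘 {n} ≡ 𝟘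
⊙-zeroʳ {n} c = trans (Vecₚ.map-replicate (c ℤ.*_) 0ℤ n) (cong (replicate n) (ℤₚ.*-zeroʳ c))

⊙≡𝟘⇒≡𝟘 : ∀ {n c} → c ≢ 0ℤ → (x : Vec ℤ n) → c ⊙ x ≡ 𝟘 → x ≡ 𝟘
⊙≡𝟘⇒≡𝟘 c≢0 []      _ = refl
⊙≡𝟘⇒≡𝟘 {c = c} c≢0 (a ∷ x) cx≡0 =
  cong₂ _∷_ (ℤₚ.*-cancelˡ-≡ c a 0ℤ (trans (cong head cx≡0) (sym (ℤₚ.*-zeroʳ c)))) (⊙≡𝟘⇒≡𝟘 c≢0 x (cong tail cx≡0))
  where instance _ = ℤ.≢-nonZero c≢0

⊙-cancelˡ : ∀ {n c} → c ≢ 0ℤ → (x y : Vec ℤ n) → c ⊙ x ≡ c ⊙ y → x ≡ y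
⊙-cancelˡ {c = c} c≢0 x y cx≡cy = ⊕ₚ.x∙y⁻¹≈ε⇒x≈y x y (⊙≡𝟘⇒≡𝟘 c≢0 _ (begin
  c ⊙ (x ⊖ y)              ≡⟨ ⊙-distribˡ-⊕ c x _ ⟩
  c ⊙ x ⊕ c ⊙ - 1ℤ ⊙ y     ≡⟨ cong₂ _⊕_ cx≡cy (⊙-comm c (- 1ℤ) y) ⟩
  c ⊙ y ⊖ c ⊙ y            ≡⟨ ⊕-inverseʳ _ ⟩
  𝟘                        ∎))
  where open ≡-Reasoning

⊖-interchange : ∀ {n} (x y z w : Vec ℤ n) → (x ⊕ y) ⊖ (z ⊕ w) ≡ (x ⊖ z) ⊕ (y ⊖ w)
⊖-interchange x y z w = trans (cong (x ⊕ y ⊕_) (⊙-distribˡ-⊕ (- 1ℤ) z w)) (⊕ₚ.interchange x y _ _)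

x⊖z⊖[y⊖z]≡x⊖y : ∀ {n} (x y z : Vec ℤ n) → (x ⊖ z) ⊖ (y ⊖ z) ≡ x ⊖ y
x⊖z⊖[y⊖z]≡x⊖y x y z = begin
  (x ⊖ z) ⊖ (y ⊖ z)                      ≡⟨ ⊖-interchange x _ y _ ⟩
  (x ⊖ y) ⊕ (- 1ℤ ⊙ z ⊖ - 1ℤ ⊙ z)        ≡⟨ cong (x ⊖ y ⊕_) (⊕-inverseʳ _) ⟩
  (x ⊖ y) ⊕ 𝟘                            ≡⟨ ⊕ₚ.identityʳ _ ⟩
  x ⊖ y                                  ∎
  where open ≡-Reasoning

z⊕x⊖[z⊕y]≡x⊖y : ∀ {n} (x y z : Vec ℤ n) → (z ⊕ x) ⊖ (z ⊕ y) ≡ x ⊖ y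
z⊕x⊖[z⊕y]≡x⊖y x y z =
  trans (⊖-interchange z x z y) (trans (cong (_⊕ (x ⊖ y)) (⊕-inverseʳ z)) (⊕ₚ.identityˡ _))

record Linear {m n} (f : Vec ℤ m → Vec ℤ n) : Set where
  field
    ⊕-homo : ∀ x y → f (x ⊕ y) ≡ f x ⊕ f y
    ⊙-homo : ∀ c x → f (c ⊙ x) ≡ c ⊙ f x

  𝟘-homo : f 𝟘 ≡ 𝟘
  𝟘-homo = trans (cong f (sym (⊙-zeroˡ 𝟘))) (trans (⊙-homo 0ℤ 𝟘) (⊙-zeroˡ _))

  ⊖-homo : ∀ x y → f (x ⊖ y) ≡ f x ⊖ f y
  ⊖-homo x y = trans (⊕-homo x _) (cong (f x ⊕_) (⊙-homo (- 1ℤ) y))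

open Linear public

id-linear : ∀ {n} → Linear {n} id
id-linear = record { ⊕-homo = λ _ _ → refl ; ⊙-homo = λ _ _ → refl }

[]-linear : ∀ {m} → Linear {m} (λ _ → [])
[]-linear = record { ⊕-homo = λ _ _ → refl ; ⊙-homo = λ _ _ → refl }

∘-linear : ∀ {l m n} {f : Vec ℤ m → Vec ℤ n} {g : Vec ℤ l → Vec ℤ m} → Linear f → Linear g → Linear (f ∘ g)
∘-linear {f = f} F G = record
  { ⊕-homo = λ x y → trans (cong f (⊕-homo G x y)) (⊕-homo F _ _)
  ; ⊙-homo = λ c x → trans (cong f (⊙-homo G c x)) (⊙-homo F c _) }

tail-linear : ∀ {n} → Linear {suc n} tail
tail-linear = record { ⊕-homo = λ { (_ ∷ _) (_ ∷ _) → refl } ; ⊙-homo = λ { _ (_ ∷ _) → refl } }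

∷-linear : ∀ {m n} {f : Vec ℤ m → Vec ℤ n} → Linear f → Linear {suc m} (λ x → head x ∷ f (tail x))
∷-linear F = record
  { ⊕-homo = λ { (_ ∷ x) (_ ∷ y) → cong (_ ∷_) (⊕-homo F x y) }
  ; ⊙-homo = λ { c (_ ∷ x) → cong (_ ∷_) (⊙-homo F c x) } }

head∷tail : ∀ {n} (x : Vec ℤ (suc n)) → head x ∷ tail x ≡ x
head∷tail (_ ∷ _) = refl

dot : ∀ {n} → Vec ℤ n → Vec ℤ n → ℤ
dot []      []      = 0ℤ
dot (a ∷ x) (b ∷ y) = a ℤ.* b ℤ.+ dot x y

dot-comm : ∀ {n} (x y : Vec ℤ n) → dot x y ≡ dot y x
dot-comm []      []      = refl
dot-comm (a ∷ x) (b ∷ y) = cong₂ ℤ._+_ (ℤₚ.*-comm a b) (dot-comm x y)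

dot-⊕ʳ : ∀ {n} (x y z : Vec ℤ n) → dot x (y ⊕ z) ≡ dot x y ℤ.+ dot x z
dot-⊕ʳ []      []      []      = refl
dot-⊕ʳ (a ∷ x) (b ∷ y) (c ∷ z) =
  trans (cong (λ t → a ℤ.* (b ℤ.+ c) ℤ.+ t) (dot-⊕ʳ x y z)) (regroup a b c (dot x y) (dot x z))
  where
  regroup : ∀ a b c u v → a ℤ.* (b ℤ.+ c) ℤ.+ (u ℤ.+ v) ≡ (a ℤ.* b ℤ.+ u) ℤ.+ (a ℤ.* c ℤ.+ v)
  regroup = solve-∀

dot-⊙ʳ : ∀ {n} c (x y : Vec ℤ n) → dot x (c ⊙ y) ≡ c ℤ.* dot x y
dot-⊙ʳ c []      []      = sym (ℤₚ.*-zeroʳ c)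
dot-⊙ʳ c (a ∷ x) (b ∷ y) = trans (cong (λ t → a ℤ.* (c ℤ.* b) ℤ.+ t) (dot-⊙ʳ c x y)) (regroup a b c (dot x y))
  where
  regroup : ∀ a b c u → a ℤ.* (c ℤ.* b) ℤ.+ c ℤ.* u ≡ c ℤ.* (a ℤ.* b ℤ.+ u)
  regroup = solve-∀

dot-⊕ˡ : ∀ {n} (x y z : Vec ℤ n) → dot (x ⊕ y) z ≡ dot x z ℤ.+ dot y z
dot-⊕ˡ x y z = trans (dot-comm _ z) (trans (dot-⊕ʳ z x y) (cong₂ ℤ._+_ (dot-comm z x) (dot-comm z y)))

dot-⊙ˡ : ∀ {n} c (x y : Vec ℤ n) → dot (c ⊙ x) y ≡ c ℤ.* dot x y
dot-⊙ˡ c x y = trans (dot-comm _ y) (trans (dot-⊙ʳ c y x) (cong (c ℤ.*_) (dot-comm y x)))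

dot-𝟘ʳ : ∀ {n} (x : Vec ℤ n) → dot x 𝟘 ≡ 0ℤ
dot-𝟘ʳ []      = refl
dot-𝟘ʳ (a ∷ x) = cong₂ ℤ._+_ (ℤₚ.*-zeroʳ a) (dot-𝟘ʳ x)

dot-𝟘ˡ : ∀ {n} (x : Vec ℤ n) → dot 𝟘 x ≡ 0ℤ
dot-𝟘ˡ x = trans (dot-comm 𝟘 x) (dot-𝟘ʳ x)

dot-∷ : ∀ {n} (x y : Vec ℤ (suc n)) → dot x y ≡ head x ℤ.* head y ℤ.+ dot (tail x) (tail y)
dot-∷ (_ ∷ _) (_ ∷ _) = refl

-- Rectangular matrices

Mat : ℕ → ℕ → Set
Mat m n = Vec (Vec ℤ n) m

act : ∀ {m n} → Mat m n → Vec ℤ n → Vec ℤ m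
act A v = Vec.map (λ a → dot a v) A

comb : ∀ {k n} → Vec ℤ k → Mat k n → Vec ℤ n
comb []       []       = 𝟘
comb (z ∷ zs) (b ∷ bs) = z ⊙ b ⊕ comb zs bs

act-linear : ∀ {m n} (A : Mat m n) → Linear (act A)
act-linear []      = []-linear
act-linear (a ∷ A) = record
  { ⊕-homo = λ x y → cong₂ _∷_ (dot-⊕ʳ a x y) (⊕-homo (act-linear A) x y)
  ; ⊙-homo = λ c x → cong₂ _∷_ (dot-⊙ʳ c a x) (⊙-homo (act-linear A) c x) }

comb-linear : ∀ {k n} (bs : Mat k n) → Linear (λ z → comb z bs)
comb-linear []       = record
  { ⊕-homo = λ { [] [] → sym (⊕ₚ.identityʳ 𝟘) } ; ⊙-homo = λ { c [] → sym (⊙-zeroʳ c) } }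
comb-linear (b ∷ bs) = record
  { ⊕-homo = λ { (c ∷ x) (d ∷ y) →
      trans (cong₂ _⊕_ (⊙-distribʳ-+ b c d) (⊕-homo (comb-linear bs) x y)) (⊕ₚ.interchange _ _ _ _) }
  ; ⊙-homo = λ { c (d ∷ x) →
      trans (cong₂ _⊕_ (⊙-assoc c d b) (⊙-homo (comb-linear bs) c x)) (sym (⊙-distribˡ-⊕ c _ _)) } }

linear-comb≡𝟘 : ∀ {k m n} {f : Vec ℤ m → Vec ℤ n} → Linear f → ∀ (z : Vec ℤ k) {bs} →
  VAll.All (λ b → f b ≡ 𝟘) bs → f (comb z bs) ≡ 𝟘
linear-comb≡𝟘 F []      []       = 𝟘-homo F
linear-comb≡𝟘 {f = f} F (z ∷ zs) {b ∷ bs} (fb≡0 ∷ fbs≡0) = begin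
  f (z ⊙ b ⊕ comb zs bs)      ≡⟨ ⊕-homo F _ _ ⟩
  f (z ⊙ b) ⊕ f (comb zs bs)  ≡⟨ cong₂ _⊕_ (⊙-homo F z b) (linear-comb≡𝟘 F zs fbs≡0) ⟩
  z ⊙ f b ⊕ 𝟘                 ≡⟨ ⊕ₚ.identityʳ _ ⟩
  z ⊙ f b                     ≡⟨ cong (z ⊙_) fb≡0 ⟩
  z ⊙ 𝟘                       ≡⟨ ⊙-zeroʳ z ⟩
  𝟘                           ∎
  where open ≡-Reasoning

dot-comb : ∀ {m n} (a : Vec ℤ m) (B : Mat m n) v → dot (comb a B) v ≡ dot a (act B v)
dot-comb []      []      v = dot-𝟘ˡ v
dot-comb (z ∷ a) (b ∷ B) v =
  trans (dot-⊕ˡ (z ⊙ b) (comb a B) v) (cong₂ ℤ._+_ (dot-⊙ˡ z b v) (dot-comb a B v))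

act≡𝟘⇒rows⊥ : ∀ {m n} (A : Mat m n) {v} → act A v ≡ 𝟘 → VAll.All (λ a → dot a v ≡ 0ℤ) A
act≡𝟘⇒rows⊥ []      _    = []
act≡𝟘⇒rows⊥ (a ∷ A) Av≡0 = cong head Av≡0 ∷ act≡𝟘⇒rows⊥ A (cong tail Av≡0)

rows⊥⇒act≡𝟘 : ∀ {m n} {A : Mat m n} {v} → VAll.All (λ a → dot a v ≡ 0ℤ) A → act A v ≡ 𝟘
rows⊥⇒act≡𝟘 []       = refl
rows⊥⇒act≡𝟘 (p ∷ ps) = cong₂ _∷_ p (rows⊥⇒act≡𝟘 ps)

InSpan : ∀ {n k} → Mat k n → Vec ℤ n → Set
InSpan bs x = ∃[ z ] x ≡ comb z bs

InSpan-⊖ : ∀ {n k} {bs : Mat k n} {x y} → InSpan bs x → InSpan bs y → InSpan bs (x ⊖ y)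
InSpan-⊖ {bs = bs} (z , refl) (z′ , refl) = z ⊖ z′ , sym (⊖-homo (comb-linear bs) z z′)

InSpan-⊥ : ∀ {n k} {bs : Mat k n} {x} y → InSpan bs x → act bs y ≡ 𝟘 → dot x y ≡ 0ℤ
InSpan-⊥ {bs = bs} y (z , refl) bs⊥y = trans (dot-comb z bs y) (trans (cong (dot z) bs⊥y) (dot-𝟘ʳ z))

-- Unimodular maps, given as words in elementary operations so that the inverse and the inverse transpose
-- are again given by such words.
data Unimodular : ℕ → Set where
  idᵁ   : ∀ {n} → Unimodular n
  _⨾_   : ∀ {n} → Unimodular n → Unimodular n → Unimodular n
  shear : ∀ {n} → ℤ → Unimodular (suc (suc n))
  swap  : ∀ {n} → Unimodular (suc (suc n))
  lift  : ∀ {n} → Unimodular n → Unimodular (suc n)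

⟦_⟧ : ∀ {n} → Unimodular n → Vec ℤ n → Vec ℤ n
⟦ idᵁ ⟧     x           = x
⟦ e ⨾ f ⟧   x           = ⟦ f ⟧ (⟦ e ⟧ x)
⟦ shear q ⟧ (a ∷ b ∷ x) = a ℤ.+ q ℤ.* b ∷ b ∷ x
⟦ swap ⟧    (a ∷ b ∷ x) = b ∷ a ∷ x
⟦ lift e ⟧  (a ∷ x)     = a ∷ ⟦ e ⟧ x

inverse : ∀ {n} → Unimodular n → Unimodular n
inverse idᵁ       = idᵁ
inverse (e ⨾ f)   = inverse f ⨾ inverse e
inverse (shear q) = shear (- q)
inverse swap      = swap
inverse (lift e)  = lift (inverse e)

contragredient : ∀ {n} → Unimodular n → Unimodular n
contragredient idᵁ       = idᵁ
contragredient (e ⨾ f)   = contragredient e ⨾ contragredient f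
contragredient (shear q) = swap ⨾ (shear (- q) ⨾ swap)
contragredient swap      = swap
contragredient (lift e)  = lift (contragredient e)

⟦⟧-linear : ∀ {n} (e : Unimodular n) → Linear ⟦ e ⟧
⟦⟧-linear idᵁ       = id-linear
⟦⟧-linear (e ⨾ f)   = ∘-linear (⟦⟧-linear f) (⟦⟧-linear e)
⟦⟧-linear (shear q) = record
  { ⊕-homo = λ { (a ∷ b ∷ x) (c ∷ d ∷ y) → cong (_∷ _) (+-homo q a b c d) }
  ; ⊙-homo = λ { c (a ∷ b ∷ x) → cong (_∷ _) (*-homo q c a b) } }
  where
  +-homo : ∀ q a b c d → (a ℤ.+ c) ℤ.+ q ℤ.* (b ℤ.+ d) ≡ (a ℤ.+ q ℤ.* b) ℤ.+ (c ℤ.+ q ℤ.* d)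
  +-homo = solve-∀
  *-homo : ∀ q c a b → c ℤ.* a ℤ.+ q ℤ.* (c ℤ.* b) ≡ c ℤ.* (a ℤ.+ q ℤ.* b)
  *-homo = solve-∀
⟦⟧-linear swap      = record
  { ⊕-homo = λ { (_ ∷ _ ∷ _) (_ ∷ _ ∷ _) → refl } ; ⊙-homo = λ { _ (_ ∷ _ ∷ _) → refl } }
⟦⟧-linear (lift e)  = record
  { ⊕-homo = λ { (_ ∷ x) (_ ∷ y) → cong (_ ∷_) (⊕-homo (⟦⟧-linear e) x y) }
  ; ⊙-homo = λ { c (_ ∷ x) → cong (_ ∷_) (⊙-homo (⟦⟧-linear e) c x) } }

inverse-involutive : ∀ {n} (e : Unimodular n) → inverse (inverse e) ≡ e
inverse-involutive idᵁ       = refl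
inverse-involutive (e ⨾ f)   = cong₂ _⨾_ (inverse-involutive e) (inverse-involutive f)
inverse-involutive (shear q) = cong shear (ℤₚ.neg-involutive q)
inverse-involutive swap      = refl
inverse-involutive (lift e)  = cong lift (inverse-involutive e)

inverseˡ : ∀ {n} (e : Unimodular n) x → ⟦ inverse e ⟧ (⟦ e ⟧ x) ≡ x
inverseˡ idᵁ       x           = refl
inverseˡ (e ⨾ f)   x           = trans (cong ⟦ inverse e ⟧ (inverseˡ f (⟦ e ⟧ x))) (inverseˡ e x)
inverseˡ (shear q) (a ∷ b ∷ x) = cong (_∷ _) (cancel q a b)
  where
  cancel : ∀ q a b → (a ℤ.+ q ℤ.* b) ℤ.+ (- q) ℤ.* b ≡ a
  cancel = solve-∀
inverseˡ swap      (a ∷ b ∷ x) = refl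
inverseˡ (lift e)  (a ∷ x)     = cong (a ∷_) (inverseˡ e x)

inverseʳ : ∀ {n} (e : Unimodular n) x → ⟦ e ⟧ (⟦ inverse e ⟧ x) ≡ x
inverseʳ e x = trans (cong (λ f → ⟦ f ⟧ (⟦ inverse e ⟧ x)) (sym (inverse-involutive e))) (inverseˡ (inverse e) x)

⟦⟧≡𝟘⇒≡𝟘 : ∀ {n} (e : Unimodular n) {x} → ⟦ e ⟧ x ≡ 𝟘 → x ≡ 𝟘
⟦⟧≡𝟘⇒≡𝟘 e {x} ex≡0 = trans (sym (inverseˡ e x)) (trans (cong ⟦ inverse e ⟧ ex≡0) (𝟘-homo (⟦⟧-linear (inverse e))))

dot-contragredient : ∀ {n} (e : Unimodular n) x y → dot (⟦ e ⟧ x) (⟦ contragredient e ⟧ y) ≡ dot x y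
dot-contragredient idᵁ       x           y           = refl
dot-contragredient (e ⨾ f)   x           y           = trans (dot-contragredient f _ _) (dot-contragredient e x y)
dot-contragredient (shear q) (a ∷ b ∷ x) (c ∷ d ∷ y) = cancel q a b c d (dot x y)
  where
  cancel : ∀ q a b c d u →
    (a ℤ.+ q ℤ.* b) ℤ.* c ℤ.+ (b ℤ.* (d ℤ.+ (- q) ℤ.* c) ℤ.+ u) ≡ a ℤ.* c ℤ.+ (b ℤ.* d ℤ.+ u)
  cancel = solve-∀
dot-contragredient swap      (a ∷ b ∷ x) (c ∷ d ∷ y) = exchange (a ℤ.* c) (b ℤ.* d) (dot x y)
  where
  exchange : ∀ a b u → b ℤ.+ (a ℤ.+ u) ≡ a ℤ.+ (b ℤ.+ u)
  exchange = solve-∀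
dot-contragredient (lift e)  (a ∷ x)     (c ∷ y)     = cong (λ t → a ℤ.* c ℤ.+ t) (dot-contragredient e x y)

euclid : ∀ {n} a b → Acc _<_ ∣ b ∣ → ∃[ e ] ∃[ g ] ∀ (x : Vec ℤ n) → ⟦ e ⟧ (a ∷ b ∷ x) ≡ g ∷ 0ℤ ∷ x
euclid a b (acc rs) with b ℤ.≟ 0ℤ
... | yes refl = idᵁ , a , λ _ → refl
... | no b≢0 =
  let e , g , e≡ = euclid b (+ r) (rs (ℤ/.n%d<d a b))
  in (shear (- q) ⨾ swap) ⨾ e , g , λ x → trans (cong (λ t → ⟦ e ⟧ (b ∷ t ∷ x)) a-qb≡r) (e≡ x)
  where
  open ≡-Reasoning
  instance _ = ℤ.≢-nonZero b≢0
  q = a ℤ/./ b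
  r = a ℤ/.% b
  cancel : ∀ r q b → (r ℤ.+ q ℤ.* b) ℤ.+ (- q) ℤ.* b ≡ r
  cancel = solve-∀
  a-qb≡r : a ℤ.+ (- q) ℤ.* b ≡ + r
  a-qb≡r = begin
    a ℤ.+ (- q) ℤ.* b                    ≡⟨ cong (ℤ._+ (- q) ℤ.* b) (ℤ/.a≡a%n+[a/n]*n a b) ⟩
    (+ r ℤ.+ q ℤ.* b) ℤ.+ (- q) ℤ.* b    ≡⟨ cancel (+ r) q b ⟩
    + r                                  ∎

clear-tail : ∀ {n} (x : Vec ℤ (suc n)) → ∃[ e ] ∃[ g ] ⟦ e ⟧ x ≡ g ∷ 𝟘
clear-tail (a ∷ [])    = idᵁ , a , refl
clear-tail (a ∷ b ∷ x) =
  let e , g , e≡ = clear-tail (b ∷ x)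
      f , h , f≡ = euclid a g (<-wellFounded _)
  in lift e ⨾ f , h , trans (cong (λ t → ⟦ f ⟧ (a ∷ t)) e≡) (f≡ 𝟘)

-- Primitive sublattices

-- A sublattice is primitive exactly if it is the kernel of a linear map; τ is a choice of coordinates on it.
record Lattice (n t : ℕ) : Set where
  field
    {codim}      : ℕ
    β            : Vec ℤ n → Vec ℤ codim
    β-linear     : Linear β
    τ            : Vec ℤ n → Vec ℤ t
    τ-linear     : Linear τ
    τ-surjective : ∀ w → ∃[ x ] β x ≡ 𝟘 × τ x ≡ w
    τ-injective  : ∀ {x} → β x ≡ 𝟘 → τ x ≡ 𝟘 → x ≡ 𝟘

  Mem : Vec ℤ n → Set
  Mem x = β x ≡ 𝟘

  Mem-⊕ : ∀ {x y} → Mem x → Mem y → Mem (x ⊕ y)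
  Mem-⊕ p q = trans (⊕-homo β-linear _ _) (trans (cong₂ _⊕_ p q) (⊕ₚ.identityʳ 𝟘))

  Mem-⊙ : ∀ c {x} → Mem x → Mem (c ⊙ x)
  Mem-⊙ c p = trans (⊙-homo β-linear c _) (trans (cong (c ⊙_) p) (⊙-zeroʳ c))

  Mem-⊖ : ∀ {x y} → Mem x → Mem y → Mem (x ⊖ y)
  Mem-⊖ p q = Mem-⊕ p (Mem-⊙ (- 1ℤ) q)

  Mem-comb : ∀ {k} {bs : Mat k n} → VAll.All Mem bs → ∀ z → Mem (comb z bs)
  Mem-comb bs∈ z = linear-comb≡𝟘 β-linear z bs∈

  τ-divisible : ∀ {x} q w → Mem x → τ x ≡ q ⊙ w → ∃[ x′ ] x ≡ q ⊙ x′
  τ-divisible {x} q w x∈ τx≡qw with τ-surjective w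
  ... | x′ , x′∈ , refl = x′ , ⊕ₚ.x∙y⁻¹≈ε⇒x≈y x (q ⊙ x′) (τ-injective (Mem-⊖ x∈ (Mem-⊙ q x′∈)) (begin
    τ (x ⊖ q ⊙ x′)           ≡⟨ ⊖-homo τ-linear x _ ⟩
    τ x ⊖ τ (q ⊙ x′)         ≡⟨ cong₂ _⊖_ τx≡qw (⊙-homo τ-linear q x′) ⟩
    q ⊙ τ x′ ⊖ q ⊙ τ x′      ≡⟨ ⊕-inverseʳ _ ⟩
    𝟘                        ∎))
    where open ≡-Reasoning

open Lattice public using (Mem)

zeroLattice : ∀ {n} → Lattice n 0
zeroLattice = record
  { β = id ; β-linear = id-linear ; τ = λ _ → [] ; τ-linear = []-linear
  ; τ-surjective = λ { [] → 𝟘 , refl , refl } ; τ-injective = λ x≡0 _ → x≡0 }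

fullLattice : ∀ {n} → Lattice n n
fullLattice = record
  { β = λ _ → [] ; β-linear = []-linear ; τ = id ; τ-linear = id-linear
  ; τ-surjective = λ w → w , refl , refl ; τ-injective = λ _ x≡0 → x≡0 }

ℤ×_ : ∀ {n t} → Lattice n t → Lattice (suc n) (suc t)
ℤ× L = record
  { β = β ∘ tail ; β-linear = ∘-linear β-linear tail-linear
  ; τ = λ x → head x ∷ τ (tail x) ; τ-linear = ∷-linear τ-linear
  ; τ-surjective = λ { (a ∷ w) → let x , x∈ , τx≡w = τ-surjective w in a ∷ x , x∈ , cong (a ∷_) τx≡w }
  ; τ-injective = λ { {_ ∷ _} x∈ τx≡0 → cong₂ _∷_ (cong head τx≡0) (τ-injective x∈ (cong tail τx≡0)) } }
  where open Lattice L

0×_ : ∀ {n t} → Lattice n t → Lattice (suc n) t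
0× L = record
  { β = λ x → head x ∷ β (tail x) ; β-linear = ∷-linear β-linear
  ; τ = τ ∘ tail ; τ-linear = ∘-linear τ-linear tail-linear
  ; τ-surjective = λ w → let x , x∈ , τx≡w = τ-surjective w in 0ℤ ∷ x , cong (0ℤ ∷_) x∈ , τx≡w
  ; τ-injective = λ { {_ ∷ _} x∈ τx≡0 → cong₂ _∷_ (cong head x∈) (τ-injective (cong tail x∈) τx≡0) } }
  where open Lattice L

preimage : ∀ {n t} → Unimodular n → Lattice n t → Lattice n t
preimage e L = record
  { β = β ∘ ⟦ e ⟧ ; β-linear = ∘-linear β-linear (⟦⟧-linear e)
  ; τ = τ ∘ ⟦ e ⟧ ; τ-linear = ∘-linear τ-linear (⟦⟧-linear e)
  ; τ-surjective = λ w → let x , x∈ , τx≡w = τ-surjective w in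
      ⟦ inverse e ⟧ x , trans (cong β (inverseʳ e x)) x∈ , trans (cong τ (inverseʳ e x)) τx≡w
  ; τ-injective = λ x∈ τx≡0 → ⟦⟧≡𝟘⇒≡𝟘 e (τ-injective x∈ τx≡0) }
  where open Lattice L

-- Rank and nullity

record RankDecomposition {m n} (A : Mat m n) : Set where
  field
    rank nullity : ℕ
    rank+nullity : rank + nullity ≡ n
    rank≤rows    : rank ≤ m
    rowLattice   : Lattice n rank
    rows∈        : VAll.All (Mem rowLattice) A
    kernel       : Lattice n nullity
    kernel⁺      : ∀ {y} → act A y ≡ 𝟘 → Mem kernel y
    kernel⁻      : ∀ {y} → Mem kernel y → act A y ≡ 𝟘

no-rows : ∀ {n} → RankDecomposition {n = n} []
no-rows {n} = record
  { rank = 0 ; nullity = n ; rank+nullity = refl ; rank≤rows = z≤n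
  ; rowLattice = zeroLattice ; rows∈ = [] ; kernel = fullLattice ; kernel⁺ = λ _ → refl ; kernel⁻ = λ _ → refl }

add-zero-row : ∀ {m n} {A : Mat m n} → RankDecomposition A → RankDecomposition (𝟘 ∷ A)
add-zero-row D = record
  { rank = rank ; nullity = nullity ; rank+nullity = rank+nullity ; rank≤rows = ℕₚ.m≤n⇒m≤1+n rank≤rows
  ; rowLattice = rowLattice ; rows∈ = 𝟘-homo (Lattice.β-linear rowLattice) ∷ rows∈
  ; kernel = kernel ; kernel⁺ = λ Ay≡0 → kernel⁺ (cong tail Ay≡0)
  ; kernel⁻ = λ {y} y∈ → cong₂ _∷_ (dot-𝟘ˡ y) (kernel⁻ y∈) }
  where open RankDecomposition D

eliminate : ∀ {m n} → Unimodular (suc n) → Mat m (suc n) → Mat m n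
eliminate e = Vec.map (tail ∘ ⟦ e ⟧)

module _ {m n : ℕ} {g : ℤ} {a : Vec ℤ (suc n)} {A : Mat m (suc n)} (e : Unimodular (suc n))
  (ea≡g∷𝟘 : ⟦ e ⟧ a ≡ g ∷ 𝟘) (g≢0 : g ≢ 0ℤ) where

  private
    e* : Unimodular (suc n)
    e* = contragredient e

    dot-e : ∀ b y → dot b y ≡ head (⟦ e ⟧ b) ℤ.* head (⟦ e* ⟧ y) ℤ.+ dot (tail (⟦ e ⟧ b)) (tail (⟦ e* ⟧ y))
    dot-e b y = trans (sym (dot-contragredient e b y)) (dot-∷ (⟦ e ⟧ b) (⟦ e* ⟧ y))

    dot-pivot : ∀ y → dot a y ≡ g ℤ.* head (⟦ e* ⟧ y)
    dot-pivot y = begin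
      dot a y                                                            ≡⟨ dot-e a y ⟩
      head (⟦ e ⟧ a) ℤ.* head (⟦ e* ⟧ y) ℤ.+ dot (tail (⟦ e ⟧ a)) (tail (⟦ e* ⟧ y))
        ≡⟨ cong (λ t → head t ℤ.* head (⟦ e* ⟧ y) ℤ.+ dot (tail t) (tail (⟦ e* ⟧ y))) ea≡g∷𝟘 ⟩
      g ℤ.* head (⟦ e* ⟧ y) ℤ.+ dot 𝟘 (tail (⟦ e* ⟧ y))
        ≡⟨ cong (λ t → g ℤ.* head (⟦ e* ⟧ y) ℤ.+ t) (dot-𝟘ˡ (tail (⟦ e* ⟧ y))) ⟩
      g ℤ.* head (⟦ e* ⟧ y) ℤ.+ 0ℤ                                       ≡⟨ ℤₚ.+-identityʳ _ ⟩
      g ℤ.* head (⟦ e* ⟧ y)                                              ∎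
      where open ≡-Reasoning

    dot-eliminated : ∀ y → head (⟦ e* ⟧ y) ≡ 0ℤ → ∀ b → dot b y ≡ dot (tail (⟦ e ⟧ b)) (tail (⟦ e* ⟧ y))
    dot-eliminated y y₀≡0 b = begin
      dot b y                                          ≡⟨ dot-e b y ⟩
      head (⟦ e ⟧ b) ℤ.* head (⟦ e* ⟧ y) ℤ.+ rest      ≡⟨ cong (λ t → head (⟦ e ⟧ b) ℤ.* t ℤ.+ rest) y₀≡0 ⟩
      head (⟦ e ⟧ b) ℤ.* 0ℤ ℤ.+ rest                   ≡⟨ cong (ℤ._+ rest) (ℤₚ.*-zeroʳ (head (⟦ e ⟧ b))) ⟩
      0ℤ ℤ.+ rest                                      ≡⟨ ℤₚ.+-identityˡ rest ⟩
      rest                                             ∎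
      where
      open ≡-Reasoning
      rest = dot (tail (⟦ e ⟧ b)) (tail (⟦ e* ⟧ y))

    act-eliminated : ∀ y → head (⟦ e* ⟧ y) ≡ 0ℤ → act A y ≡ act (eliminate e A) (tail (⟦ e* ⟧ y))
    act-eliminated y y₀≡0 = trans (Vecₚ.map-cong (dot-eliminated y y₀≡0) A) (Vecₚ.map-∘ _ (tail ∘ ⟦ e ⟧) A)

  add-pivot-row : RankDecomposition (eliminate e A) → RankDecomposition (a ∷ A)
  add-pivot-row D = record
    { rank = suc rank ; nullity = nullity ; rank+nullity = cong suc rank+nullity ; rank≤rows = s≤s rank≤rows
    ; rowLattice = preimage e (ℤ× rowLattice)
    ; rows∈ = trans (cong (Lattice.β rowLattice ∘ tail) ea≡g∷𝟘) (𝟘-homo (Lattice.β-linear rowLattice))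
        ∷ VAllₚ.map⁻ rows∈
    ; kernel = preimage e* (0× kernel)
    ; kernel⁺ = λ {y} Ay≡0 →
        let y₀≡0 = ℤₚ.*-cancelˡ-≡ g _ 0ℤ (trans (sym (dot-pivot y)) (trans (cong head Ay≡0) (sym (ℤₚ.*-zeroʳ g))))
        in cong₂ _∷_ y₀≡0 (kernel⁺ (trans (sym (act-eliminated y y₀≡0)) (cong tail Ay≡0)))
    ; kernel⁻ = λ {y} y∈ → let y₀≡0 = cong head y∈ in
        cong₂ _∷_ (trans (dot-pivot y) (trans (cong (g ℤ.*_) y₀≡0) (ℤₚ.*-zeroʳ g)))
          (trans (act-eliminated y y₀≡0) (kernel⁻ (cong tail y∈))) }
    where
    open RankDecomposition D
    instance _ = ℤ.≢-nonZero g≢0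

rankDecomposition : ∀ {m n} (A : Mat m n) → RankDecomposition A
rankDecomposition             []       = no-rows
rankDecomposition {n = zero}  ([] ∷ A) = add-zero-row (rankDecomposition A)
rankDecomposition {n = suc n} (a ∷ A)  with clear-tail a
... | e , g , ea≡g∷𝟘 with g ℤ.≟ 0ℤ
... | no g≢0   = add-pivot-row e ea≡g∷𝟘 g≢0 (rankDecomposition (eliminate e A))
... | yes refl with ⟦⟧≡𝟘⇒≡𝟘 e ea≡g∷𝟘
... | refl = add-zero-row (rankDecomposition A)

module _ {m n : ℕ} (A : Mat m n) where
  open RankDecomposition (rankDecomposition A) public

dimension-0 : ∀ {t} → t ≡ 0 → (x : Vec ℤ t) → x ≡ 𝟘
dimension-0 refl [] = refl

rank≡0⇒rows≡𝟘 : ∀ {m n} (A : Mat m n) → rank A ≡ 0 → VAll.All (_≡ 𝟘) A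
rank≡0⇒rows≡𝟘 A r≡0 = VAll.map (λ a∈ → Lattice.τ-injective (rowLattice A) a∈ (dimension-0 r≡0 _)) (rows∈ A)

nullity≡0⇒act-injective : ∀ {m n} (A : Mat m n) → nullity A ≡ 0 → ∀ {x y} → act A x ≡ act A y → x ≡ y
nullity≡0⇒act-injective A s≡0 {x} {y} Ax≡Ay =
  ⊕ₚ.x∙y⁻¹≈ε⇒x≈y x y (Lattice.τ-injective (kernel A) (kernel⁺ A A[x-y]≡0) (dimension-0 s≡0 _))
  where
  A[x-y]≡0 : act A (x ⊖ y) ≡ 𝟘
  A[x-y]≡0 = trans (⊖-homo (act-linear A) x y) (trans (cong (_⊖ act A y) Ax≡Ay) (⊕-inverseʳ (act A y)))

nonzero-member : ∀ {n t} (L : Lattice n t) → 0 < t → ∃[ x ] x ≢ 𝟘 × Mem L x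
nonzero-member {t = suc t} L _ with Lattice.τ-surjective L (1ℤ ∷ 𝟘)
... | x , x∈ , τx≡1∷𝟘 = x , (λ { refl → contradiction (trans (sym τx≡1∷𝟘) (𝟘-homo (Lattice.τ-linear L))) λ () }) , x∈

kernel-nontrivial : ∀ {m n} → m < n → (A : Mat m n) → ∃[ w ] w ≢ 𝟘 × act A w ≡ 𝟘
kernel-nontrivial {m} {n} m<n A with nonzero-member (kernel A) nullity>0
  where
  open ℕₚ.≤-Reasoning
  nullity>0 : 0 < nullity A
  nullity>0 = ℕₚ.+-cancelˡ-< (rank A) 0 (nullity A) (begin-strict
    rank A + 0            ≡⟨ ℕₚ.+-identityʳ (rank A) ⟩
    rank A                ≤⟨ rank≤rows A ⟩
    m                     <⟨ m<n ⟩
    n                     ≡⟨ rank+nullity A ⟨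
    rank A + nullity A    ∎)
... | w , w≢0 , w∈ = w , w≢0 , kernel⁻ A w∈

-- Square matrices and their products

lookup-ext : ∀ {A : Set} {n} (x y : Vec A n) → lookup x ≗ lookup y → x ≡ y
lookup-ext x y x≗y =
  trans (sym (Vecₚ.tabulate∘lookup x)) (trans (Vecₚ.tabulate-cong x≗y) (Vecₚ.tabulate∘lookup y))

tabulate-const : ∀ {A : Set} n (x : A) → tabulate {n = n} (λ _ → x) ≡ replicate n x
tabulate-const zero    x = refl
tabulate-const (suc n) x = cong (x ∷_) (tabulate-const n x)

zeroMat≡replicate : ∀ n → zeroMat n ≡ replicate n 𝟘
zeroMat≡replicate n = trans (tabulate-const n _) (cong (replicate n) (tabulate-const n 0ℤ))

act-zeroMat : ∀ {n} v → act (zeroMat n) v ≡ 𝟘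
act-zeroMat {n} v = begin
  act (zeroMat n) v           ≡⟨ cong (λ A → act A v) (zeroMat≡replicate n) ⟩
  act (replicate n 𝟘) v       ≡⟨ Vecₚ.map-replicate (λ a → dot a v) 𝟘 n ⟩
  replicate n (dot 𝟘 v)       ≡⟨ cong (replicate n) (dot-𝟘ˡ v) ⟩
  𝟘                           ∎
  where open ≡-Reasoning

unit : ∀ {n} → Fin n → Vec ℤ n
unit i = 𝟘 [ i ]≔ 1ℤ

dot-unitˡ : ∀ {n} (i : Fin n) v → dot (unit i) v ≡ lookup v i
dot-unitˡ zero    (a ∷ v) = trans (cong₂ ℤ._+_ (ℤₚ.*-identityˡ a) (dot-𝟘ˡ v)) (ℤₚ.+-identityʳ a)
dot-unitˡ (suc i) (a ∷ v) = trans (ℤₚ.+-identityˡ _) (dot-unitˡ i v)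

dot-unitʳ : ∀ {n} v (i : Fin n) → dot v (unit i) ≡ lookup v i
dot-unitʳ v i = trans (dot-comm v (unit i)) (dot-unitˡ i v)

lookup-unit-≡ : ∀ {n} (i : Fin n) → lookup (unit i) i ≡ 1ℤ
lookup-unit-≡ i = Vecₚ.lookup∘update i 𝟘 1ℤ

lookup-unit-≢ : ∀ {n} {i j : Fin n} → j ≢ i → lookup (unit i) j ≡ 0ℤ
lookup-unit-≢ {j = j} j≢i = trans (Vecₚ.lookup∘update′ j≢i 𝟘 1ℤ) (Vecₚ.lookup-replicate j 0ℤ)

entry-identity : ∀ {n} (i j : Fin n) → entry (identity n) i j ≡ lookup (unit i) j
entry-identity {n} i j with i Fin.≟ j | (entry (identity n) i j ≡ _) ∋
  trans (cong (λ r → lookup r j) (Vecₚ.lookup∘tabulate _ i)) (Vecₚ.lookup∘tabulate _ j)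
... | yes refl | entry≡1 = trans entry≡1 (sym (lookup-unit-≡ i))
... | no i≢j   | entry≡0 = trans entry≡0 (sym (lookup-unit-≢ (i≢j ∘ sym)))

lookup-act : ∀ {m n} (A : Mat m n) v i → lookup (act A v) i ≡ dot (lookup A i) v
lookup-act A v i = Vecₚ.lookup-map i (λ a → dot a v) A

act-identity : ∀ {n} (v : Vec ℤ n) → act (identity n) v ≡ v
act-identity {n} v = lookup-ext _ _ λ i → begin
  lookup (act (identity n) v) i     ≡⟨ lookup-act (identity n) v i ⟩
  dot (lookup (identity n) i) v
    ≡⟨ cong (λ r → dot r v) (lookup-ext (lookup (identity n) i) (unit i) (entry-identity i)) ⟩
  dot (unit i) v                    ≡⟨ dot-unitˡ i v ⟩
  lookup v i                        ∎
  where open ≡-Reasoning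

act-injective : ∀ {m n} {A B : Mat m n} → act A ≗ act B → A ≡ B
act-injective {A = A} {B} A≗B = lookup-ext _ _ λ i → lookup-ext _ _ λ j → begin
  lookup (lookup A i) j           ≡⟨ lookup-act-unit A i j ⟨
  lookup (act A (unit j)) i       ≡⟨ cong (λ r → lookup r i) (A≗B (unit j)) ⟩
  lookup (act B (unit j)) i       ≡⟨ lookup-act-unit B i j ⟩
  lookup (lookup B i) j           ∎
  where
  open ≡-Reasoning
  lookup-act-unit : ∀ A i j → lookup (act A (unit j)) i ≡ lookup (lookup A i) j
  lookup-act-unit A i j = trans (lookup-act A (unit j) i) (dot-unitʳ (lookup A i) j)

lookup-comb : ∀ {m n} (a : Vec ℤ m) (B : Mat m n) j →
  lookup (comb a B) j ≡ sumFin m (λ k → lookup a k ℤ.* lookup (lookup B k) j)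
lookup-comb []      []      j = Vecₚ.lookup-replicate j 0ℤ
lookup-comb (z ∷ a) (b ∷ B) j = trans (Vecₚ.lookup-zipWith ℤ._+_ j (z ⊙ b) (comb a B))
  (cong₂ ℤ._+_ (Vecₚ.lookup-map j (z ℤ.*_) b) (lookup-comb a B j))

lookup-⊗ : ∀ {n} (A B : Matrix n) i → lookup (A ⊗ B) i ≡ comb (lookup A i) B
lookup-⊗ A B i = trans (Vecₚ.lookup∘tabulate _ i) (lookup-ext _ _ λ j →
  trans (Vecₚ.lookup∘tabulate _ j) (sym (lookup-comb (lookup A i) B j)))

act-⊗ : ∀ {n} (A B : Matrix n) v → act (A ⊗ B) v ≡ act A (act B v)
act-⊗ A B v = lookup-ext _ _ λ i → begin
  lookup (act (A ⊗ B) v) i        ≡⟨ lookup-act (A ⊗ B) v i ⟩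
  dot (lookup (A ⊗ B) i) v        ≡⟨ cong (λ r → dot r v) (lookup-⊗ A B i) ⟩
  dot (comb (lookup A i) B) v     ≡⟨ dot-comb (lookup A i) B v ⟩
  dot (lookup A i) (act B v)      ≡⟨ lookup-act A (act B v) i ⟨
  lookup (act A (act B v)) i      ∎
  where open ≡-Reasoning

compose : ∀ {n m} → Vec (Matrix n) m → Vec ℤ n → Vec ℤ n
compose []       v = v
compose (A ∷ As) v = act A (compose As v)

act-prodMats : ∀ {n m} (As : Vec (Matrix n) m) → act (prodMats As) ≗ compose As
act-prodMats []       v = act-identity v
act-prodMats (A ∷ As) v = trans (act-⊗ A (prodMats As) v) (cong (act A) (act-prodMats As v))

compose-linear : ∀ {n m} (As : Vec (Matrix n) m) → Linear (compose As)
compose-linear []       = id-linear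
compose-linear (A ∷ As) = ∘-linear (act-linear A) (compose-linear As)

linear≗comb : ∀ {m n} {f : Vec ℤ m → Vec ℤ n} → Linear f → ∀ x → f x ≡ comb x (tabulate (f ∘ unit))
linear≗comb F []      = 𝟘-homo F
linear≗comb {f = f} F (a ∷ x) = begin
  f (a ∷ x)
    ≡⟨ cong f (a∷x≡ a x) ⟩
  f (a ⊙ unit zero ⊕ (0ℤ ∷ x))                     ≡⟨ ⊕-homo F _ _ ⟩
  f (a ⊙ unit zero) ⊕ f (0ℤ ∷ x)                   ≡⟨ cong₂ _⊕_ (⊙-homo F a _) (linear≗comb (∘-linear F 0∷-linear) x) ⟩
  a ⊙ f (unit zero) ⊕ comb x (tabulate (f ∘ unit ∘ suc)) ∎
  where
  open ≡-Reasoning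
  a∷x≡ : ∀ {n} a (x : Vec ℤ n) → a ∷ x ≡ a ⊙ unit zero ⊕ (0ℤ ∷ x)
  a∷x≡ a x = cong₂ _∷_ (sym (trans (ℤₚ.+-identityʳ _) (ℤₚ.*-identityʳ a)))
    (sym (trans (cong (_⊕ x) (⊙-zeroʳ a)) (⊕ₚ.identityˡ x)))
  0∷-linear : ∀ {n} → Linear {n} (0ℤ ∷_)
  0∷-linear = record { ⊕-homo = λ _ _ → refl ; ⊙-homo = λ c x → cong (_∷ c ⊙ x) (sym (ℤₚ.*-zeroʳ c)) }

act-transpose : ∀ {m n} (M : Mat m n) w → act (transpose M) w ≡ comb w M
act-transpose {n = n} []      []      = Vecₚ.map-replicate (λ a → dot a []) [] n
act-transpose (a ∷ M) (z ∷ w) = begin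
  act (transpose (a ∷ M)) (z ∷ w)               ≡⟨ cong (λ T → act T (z ∷ w)) (Vecₚ.zipWith-is-⊛ _∷_ a (transpose M)) ⟨
  act (zipWith _∷_ a (transpose M)) (z ∷ w)     ≡⟨ act-prepend a (transpose M) ⟩
  z ⊙ a ⊕ act (transpose M) w                   ≡⟨ cong (z ⊙ a ⊕_) (act-transpose M w) ⟩
  z ⊙ a ⊕ comb w M                              ∎
  where
  open ≡-Reasoning
  act-prepend : ∀ {n} (a : Vec ℤ n) T → act (zipWith _∷_ a T) (z ∷ w) ≡ z ⊙ a ⊕ act T w
  act-prepend []      []      = refl
  act-prepend (b ∷ a) (t ∷ T) = cong₂ _∷_ (cong (ℤ._+ dot t w) (ℤₚ.*-comm b z)) (act-prepend a T)

linear-kernel-nontrivial : ∀ {m n} {f : Vec ℤ n → Vec ℤ m} → Linear f → m < n → ∃[ w ] w ≢ 𝟘 × f w ≡ 𝟘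
linear-kernel-nontrivial F m<n with kernel-nontrivial m<n (transpose (tabulate _))
... | w , w≢0 , Mw≡0 = w , w≢0 , trans (linear≗comb F w) (trans (sym (act-transpose _ w)) Mw≡0)

-- The n columns of g together with v are linearly dependent, with a nonzero coefficient at v.
injective⇒multiple∈image : ∀ {n} {g : Vec ℤ n → Vec ℤ n} → Linear g → (∀ x → g x ≡ 𝟘 → x ≡ 𝟘) →
  ∀ v → ∃[ c ] c ≢ 0ℤ × ∃[ u ] c ⊙ v ≡ g u
injective⇒multiple∈image {n} {g} G g-injective v with linear-kernel-nontrivial relation-linear ℕₚ.≤-refl
  where
  relation-linear : Linear {suc n} (λ x → head x ⊙ v ⊕ g (tail x))
  relation-linear = record
    { ⊕-homo = λ { (c ∷ x) (d ∷ y) → trans (cong₂ _⊕_ (⊙-distribʳ-+ v c d) (⊕-homo G x y)) (⊕ₚ.interchange _ _ _ _) }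
    ; ⊙-homo = λ { c (d ∷ x) → trans (cong₂ _⊕_ (⊙-assoc c d v) (⊙-homo G c x)) (sym (⊙-distribˡ-⊕ c _ _)) } }
... | c ∷ p , cp≢0 , relation = c , c≢0 , - 1ℤ ⊙ p , (begin
  c ⊙ v                     ≡⟨ ⊕ₚ.xyx⁻¹≈y (g p) (c ⊙ v) ⟨
  (g p ⊕ c ⊙ v) ⊖ g p       ≡⟨ cong (_⊖ g p) (trans (⊕-comm (g p) _) relation) ⟩
  𝟘 ⊖ g p                   ≡⟨ ⊕ₚ.identityˡ _ ⟩
  - 1ℤ ⊙ g p                ≡⟨ ⊙-homo G (- 1ℤ) p ⟨
  g (- 1ℤ ⊙ p)              ∎)
  where
  open ≡-Reasoning
  c≢0 : c ≢ 0ℤ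
  c≢0 refl = cp≢0 (cong (0ℤ ∷_) (g-injective p (begin
    g p               ≡⟨ ⊕ₚ.identityˡ (g p) ⟨
    𝟘 ⊕ g p           ≡⟨ cong (_⊕ g p) (⊙-zeroˡ v) ⟨
    0ℤ ⊙ v ⊕ g p      ≡⟨ relation ⟩
    𝟘                 ∎)))

right⇒left-inverse : ∀ {n d} {f g : Vec ℤ n → Vec ℤ n} → d ≢ 0ℤ → Linear f → Linear g →
  (∀ v → f (g v) ≡ d ⊙ v) → ∀ v → g (f v) ≡ d ⊙ v
right⇒left-inverse {d = d} {f} {g} d≢0 F G fg v with injective⇒multiple∈image G g-injective v
  where
  g-injective : ∀ x → g x ≡ 𝟘 → x ≡ 𝟘
  g-injective x gx≡0 = ⊙≡𝟘⇒≡𝟘 d≢0 x (trans (sym (fg x)) (trans (cong f gx≡0) (𝟘-homo F)))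
... | c , c≢0 , u , cv≡gu = ⊙-cancelˡ c≢0 _ _ (begin
  c ⊙ g (f v)       ≡⟨ ⊙-homo (∘-linear G F) c v ⟨
  g (f (c ⊙ v))     ≡⟨ cong (g ∘ f) cv≡gu ⟩
  g (f (g u))       ≡⟨ cong g (fg u) ⟩
  g (d ⊙ u)         ≡⟨ ⊙-homo G d u ⟩
  d ⊙ g u           ≡⟨ cong (d ⊙_) cv≡gu ⟨
  d ⊙ c ⊙ v         ≡⟨ ⊙-comm d c v ⟩
  c ⊙ d ⊙ v         ∎)
  where open ≡-Reasoning

-- Bounding the number of elements of a predicate

-- Stated for lists of distinct elements, since the predicates to be counted are not all decidable.
AtMost : {X : Set} → (X → Set) → ℕ → Set
AtMost P N = ∀ xs → Unique xs → All P xs → length xs ≤ N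

atmost-≤ : ∀ {X : Set} {P : X → Set} {M N} → M ≤ N → AtMost P M → AtMost P N
atmost-≤ M≤N atmostP xs u ps = ℕₚ.≤-trans (atmostP xs u ps) M≤N

atmost-⊆ : ∀ {X : Set} {P Q : X → Set} {N} → (∀ {x} → P x → Q x) → AtMost Q N → AtMost P N
atmost-⊆ P⊆Q atmostQ xs u ps = atmostQ xs u (All.map P⊆Q ps)

atmost-inhabited : ∀ {X : Set} {P : X → Set} {N} → (∀ x → P x → AtMost P N) → AtMost P N
atmost-inhabited P⇒atmostP []         _ _         = z≤n
atmost-inhabited P⇒atmostP xs@(x ∷ _) u (px ∷ ps) = P⇒atmostP x px xs u (px ∷ ps)

atmost-subsingleton : ∀ {X : Set} {P : X → Set} → (∀ {x y} → P x → P y → x ≡ y) → AtMost P 1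
atmost-subsingleton unique []          _ _ = z≤n
atmost-subsingleton unique (x ∷ [])    _ _ = s≤s z≤n
atmost-subsingleton unique (x ∷ y ∷ _) ((x≢y ∷ _) ∷ _) (px ∷ py ∷ _) = contradiction (unique px py) x≢y

module _ {X : Set} where

  private
    split : ∀ {P Q : X → Set} {xs} → All (λ x → P x ⊎ Q x) xs →
      ∃₂ λ ys zs → Interleaving ys zs xs × All P ys × All Q zs
    split []             = [] , [] , [] , [] , []
    split (inj₁ p ∷ pqs) = let ys , zs , sp , ps , qs = split pqs in _ ∷ ys , zs , consˡ sp , p ∷ ps , qs
    split (inj₂ q ∷ pqs) = let ys , zs , sp , ps , qs = split pqs in ys , _ ∷ zs , consʳ sp , ps , q ∷ qs

    All-left : ∀ {P : X → Set} {ys zs xs} → Interleaving ys zs xs → All P xs → All P ys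
    All-left []         []       = []
    All-left (consˡ sp) (p ∷ ps) = p ∷ All-left sp ps
    All-left (consʳ sp) (_ ∷ ps) = All-left sp ps

    Unique-left : ∀ {ys zs xs : List X} → Interleaving ys zs xs → Unique xs → Unique ys
    Unique-left []         []      = []
    Unique-left (consˡ sp) (d ∷ u) = All-left sp d ∷ Unique-left sp u
    Unique-left (consʳ sp) (_ ∷ u) = Unique-left sp u

  atmost-⊎ : ∀ {P Q : X → Set} {M N} → AtMost P M → AtMost Q N → AtMost (λ x → P x ⊎ Q x) (M + N)
  atmost-⊎ {M = M} {N} atmostP atmostQ xs u pqs with split pqs
  ... | ys , zs , sp , ps , qs = begin
    length xs                ≡⟨ interleave-length sp ⟩
    length ys + length zs
      ≤⟨ ℕₚ.+-mono-≤ (atmostP ys (Unique-left sp u) ps) (atmostQ zs (Unique-left (Interleaving.swap sp) u) qs) ⟩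
    M + N                    ∎
    where open ℕₚ.≤-Reasoning

module _ {X Y : Set} (R : X → Y → Set) where

  atmost-Any : ∀ {M ys} → All (λ y → AtMost (λ x → R x y) M) ys → AtMost (λ x → Any (R x) ys) (length ys * M)
  atmost-Any []               = λ { [] _ _ → z≤n ; (_ ∷ _) _ (() ∷ _) }
  atmost-Any (fibre ∷ fibres) =
    atmost-⊆ (λ { (here r) → inj₁ r ; (there rs) → inj₂ rs }) (atmost-⊎ fibre (atmost-Any fibres))

  private
    choose : ∀ {Q : Y → Set} {xs} → All (λ x → ∃[ y ] Q y × R x y) xs → ∃[ ys ] Pointwise R xs ys × All Q ys
    choose []                 = [] , [] , []
    choose ((y , q , r) ∷ qs) = let ys , rs , qs′ = choose qs in y ∷ ys , r ∷ rs , q ∷ qs′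

    Pointwise⇒Any : ∀ {xs ys} → Pointwise R xs ys → All (λ x → Any (R x) ys) xs
    Pointwise⇒Any []       = []
    Pointwise⇒Any (r ∷ rs) = here r ∷ All.map there (Pointwise⇒Any rs)

  atmost-encoding : ∀ {P : X → Set} {Q : Y → Set} {N} → (∀ {x} → P x → ∃[ y ] Q y × R x y) →
    (∀ {x x′ y} → R x y → R x′ y → x ≡ x′) → AtMost Q N → AtMost P N
  atmost-encoding {N = N} encode injective atmostQ xs u ps with choose (All.map encode ps)
  ... | ys , rs , qs = subst (_≤ N) (sym (Pointwise-length rs)) (atmostQ ys (unique u rs) qs)
    where
    distinct : ∀ {x y xs ys} → R x y → All (x ≢_) xs → Pointwise R xs ys → All (y ≢_) ys
    distinct r []           []       = []
    distinct r (x≢x′ ∷ x≢s) (s ∷ rs) = (λ { refl → x≢x′ (injective r s) }) ∷ distinct r x≢s rs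
    unique : ∀ {xs ys} → Unique xs → Pointwise R xs ys → Unique ys
    unique []        []       = []
    unique (x≢s ∷ u) (r ∷ rs) = distinct r x≢s rs ∷ unique u rs

  atmost-fibration : ∀ {P : X → Set} {Q : Y → Set} {M N} → DecidableEquality Y →
    (∀ {x} → P x → ∃[ y ] Q y × R x y) → AtMost Q N → (∀ {y} → Q y → AtMost (λ x → R x y) M) → AtMost P (N * M)
  atmost-fibration {M = M} {N} _≟_ project atmostQ fibre xs u ps with choose (All.map project ps)
  ... | ys , rs , qs = begin
    length xs            ≤⟨ atmost-Any (All.map fibre qs!) xs u (All.map deduplicate⁺ (Pointwise⇒Any rs)) ⟩
    length ys! * M       ≤⟨ ℕₚ.*-monoˡ-≤ M (atmostQ ys! (DecUniqueₚ.deduplicate-! _≟_ ys) qs!) ⟩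
    N * M                ∎
    where
    open ℕₚ.≤-Reasoning
    ys! = List.deduplicate _≟_ ys
    qs! = Allₚ.deduplicate⁺ _≟_ qs
    deduplicate⁺ : ∀ {x} → Any (R x) ys → Any (R x) ys!
    deduplicate⁺ r∈ = let y , y∈ , r = find r∈ in lose (∈ₚ.∈-deduplicate⁺ _≟_ y∈) r

atmost-fibres : ∀ {X Y : Set} {P : X → Set} {Q : Y → Set} {M N} → DecidableEquality Y → (f : X → Y) →
  (∀ {x} → P x → Q (f x)) → AtMost Q N → (∀ {y} → Q y → AtMost (λ x → P x × f x ≡ y) M) → AtMost P (N * M)
atmost-fibres {P = P} _≟_ f P⇒Q = atmost-fibration (λ x y → P x × f x ≡ y) _≟_ λ p → _ , P⇒Q p , p , refl

atmost-injection : ∀ {X Y : Set} {P : X → Set} {Q : Y → Set} {N} (f : X → Y) →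
  (∀ {x} → P x → Q (f x)) → (∀ {x x′} → P x → P x′ → f x ≡ f x′ → x ≡ x′) → AtMost Q N → AtMost P N
atmost-injection {P = P} f P⇒Q injective = atmost-encoding (λ x y → P x × f x ≡ y)
  (λ p → _ , P⇒Q p , p , refl) (λ { (p , fx≡y) (p′ , fx′≡y) → injective p p′ (trans fx≡y (sym fx′≡y)) })

atmost-list : ∀ {X : Set} {P : X → Set} (ys : List X) → (∀ {x} → P x → x ∈ ys) → AtMost P (length ys)
atmost-list ys P⊆ys = atmost-≤ (ℕₚ.≤-reflexive (ℕₚ.*-identityʳ _))
  (atmost-⊆ P⊆ys (atmost-Any _≡_ (All.universal (λ y → atmost-subsingleton λ x≡y x′≡y → trans x≡y (sym x′≡y)) ys)))

atmost-< : ∀ k → AtMost (_< k) k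
atmost-< k = subst (AtMost (_< k)) (Listₚ.length-upTo k) (atmost-list (List.upTo k) ∈ₚ.∈-upTo⁺)

atmost-values : ∀ {X : Set} {P : X → Set} {M k} (f : X → ℕ) → (∀ {x} → P x → f x < k) →
  (∀ {r} → r < k → AtMost (λ x → P x × f x ≡ r) M) → AtMost P (k * M)
atmost-values f f<k = atmost-fibres ℕₚ._≟_ f f<k (atmost-< _)

atmost-∷ : ∀ {X : Set} {k M N} {P : X → Set} {Q : Vec X (suc k) → Set} → DecidableEquality X →
  (∀ {x v} → Q (x ∷ v) → P x) → AtMost P M → (∀ {x} → P x → AtMost (λ v → Q (x ∷ v)) N) → AtMost Q (M * N)
atmost-∷ _≟_ Q⇒P atmostP atmostQ = atmost-fibres _≟_ head (λ { {_ ∷ _} q → Q⇒P q }) atmostP λ p →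
  atmost-injection tail (λ { {_ ∷ _} (q , refl) → q })
    (λ { {_ ∷ _} {_ ∷ _} (_ , refl) (_ , refl) refl → refl }) (atmostQ p)

atmost-lookup : ∀ {X : Set} {k N} {P : Fin k → X → Set} → DecidableEquality X → (∀ j → AtMost (P j) N) →
  AtMost (λ (v : Vec X k) → ∀ j → P j (lookup v j)) (N ^ k)
atmost-lookup {k = zero}  _≟_ atmostP = atmost-subsingleton λ { {[]} {[]} _ _ → refl }
atmost-lookup {k = suc k} _≟_ atmostP = atmost-∷ _≟_ (λ p → p zero) (atmostP zero) λ _ →
  atmost-⊆ (λ p j → p (suc j)) (atmost-lookup _≟_ (atmostP ∘ suc))

atmost-all : ∀ {X : Set} {P : X → Set} {N} k → DecidableEquality X → AtMost P N →
  AtMost (λ (v : Vec X k) → VAll.All P v) (N ^ k)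
atmost-all k _≟_ atmostP = atmost-⊆ VAllₚ.lookup⁺ (atmost-lookup _≟_ λ _ → atmostP)

-- Boxes

length-cartesianProductWith : ∀ {A B C : Set} (f : A → B → C) xs ys →
  length (List.cartesianProductWith f xs ys) ≡ length xs * length ys
length-cartesianProductWith f []       ys = refl
length-cartesianProductWith f (x ∷ xs) ys = trans (Listₚ.length-++ (List.map (f x) ys))
  (cong₂ _+_ (Listₚ.length-map (f x) ys) (length-cartesianProductWith f xs ys))

vecsOf-suc : ∀ {A : Set} k (xs : List A) → vecsOf (suc k) xs ≡ List.cartesianProductWith _∷_ xs (vecsOf k xs)
vecsOf-suc k xs = prepend-all xs
  where
  prepend-all : ∀ ys →
    List.concatMap (λ x → List.map (x ∷_) (vecsOf k xs)) ys ≡ List.cartesianProductWith _∷_ ys (vecsOf k xs)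
  prepend-all []       = refl
  prepend-all (y ∷ ys) = cong (List.map (y ∷_) (vecsOf k xs) List.++_) (prepend-all ys)

∈-vecsOf⁺ : ∀ {A : Set} {k} {xs : List A} {v : Vec A k} → VAll.All (_∈ xs) v → v ∈ vecsOf k xs
∈-vecsOf⁺ []           = here refl
∈-vecsOf⁺ {xs = xs} (x∈ ∷ v∈) = subst (_ ∈_) (sym (vecsOf-suc _ xs)) (∈ₚ.∈-cartesianProductWith⁺ _∷_ x∈ (∈-vecsOf⁺ v∈))

∈-vecsOf⁻ : ∀ {A : Set} {k} {xs : List A} {v : Vec A k} → v ∈ vecsOf k xs → VAll.All (_∈ xs) v
∈-vecsOf⁻ {v = []}             _  = []
∈-vecsOf⁻ {k = suc k} {xs} {x ∷ v} v∈
  with ∈ₚ.∈-cartesianProductWith⁻ _∷_ xs (vecsOf k xs) (subst (_ ∈_) (vecsOf-suc k xs) v∈)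
... | _ , _ , x∈ , v∈′ , refl = x∈ ∷ ∈-vecsOf⁻ v∈′

vecsOf-unique : ∀ {A : Set} k {xs : List A} → Unique xs → Unique (vecsOf k xs)
vecsOf-unique zero         u = [] ∷ []
vecsOf-unique (suc k) {xs} u = subst Unique (sym (vecsOf-suc k xs))
  (Uniqueₚ.cartesianProductWith⁺ _∷_ Vecₚ.∷-injective u (vecsOf-unique k u))

length-vecsOf : ∀ {A : Set} k (xs : List A) → length (vecsOf k xs) ≡ length xs ^ k
length-vecsOf zero    xs = refl
length-vecsOf (suc k) xs = begin
  length (vecsOf (suc k) xs)                                      ≡⟨ cong length (vecsOf-suc k xs) ⟩
  length (List.cartesianProductWith _∷_ xs (vecsOf k xs))         ≡⟨ length-cartesianProductWith _∷_ xs (vecsOf k xs) ⟩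
  length xs * length (vecsOf k xs)                                ≡⟨ cong (length xs *_) (length-vecsOf k xs) ⟩
  length xs * length xs ^ k                                       ∎
  where open ≡-Reasoning

length-range : ∀ H → length (range H) ≡ suc (2 * H)
length-range H = trans (Listₚ.length-map _ (List.upTo (suc (2 * H)))) (Listₚ.length-upTo (suc (2 * H)))

range-unique : ∀ H → Unique (range H)
range-unique H = Uniqueₚ.map⁺
  (λ {x} {y} e → ℤₚ.+-injective (AbelianGroupₚ.∙-cancelʳ ℤₚ.+-0-abelianGroup (- + H) (+ x) (+ y) e)) (Uniqueₚ.upTo⁺ _)

n+n≡2*n : ∀ n → n + n ≡ 2 * n
n+n≡2*n n = cong (λ t → n + t) (sym (ℕₚ.+-identityʳ n))

∈-range⁺ : ∀ {H i} → ∣ i ∣ ≤ H → i ∈ range H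
∈-range⁺ {H} {i} ∣i∣≤H = subst (_∈ range H) shift (∈ₚ.∈-map⁺ _ (∈ₚ.∈-upTo⁺ (s≤s (begin
  ∣ i ℤ.+ + H ∣     ≤⟨ ℤₚ.∣i+j∣≤∣i∣+∣j∣ i (+ H) ⟩
  ∣ i ∣ + H         ≤⟨ ℕₚ.+-monoˡ-≤ H ∣i∣≤H ⟩
  H + H             ≡⟨ n+n≡2*n H ⟩
  2 * H             ∎))))
  where
  open ℕₚ.≤-Reasoning
  nonnegative : ∀ i → ∣ i ∣ ≤ H → 0ℤ ℤ.≤ i ℤ.+ + H
  nonnegative (+ i)      _   = ℤ.+≤+ z≤n
  nonnegative ℤ.-[1+ i ] i<H = subst (0ℤ ℤ.≤_) (sym (ℤₚ.⊖-≥ i<H)) (ℤ.+≤+ z≤n)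
  cancel : ∀ a b → a ℤ.+ b ℤ.- b ≡ a
  cancel = solve-∀
  shift : + ∣ i ℤ.+ + H ∣ ℤ.- + H ≡ i
  shift = trans (cong (ℤ._- + H) (ℤₚ.0≤i⇒+∣i∣≡i (nonnegative i ∣i∣≤H))) (cancel i (+ H))

∈-range⁻ : ∀ {H i} → i ∈ range H → ∣ i ∣ ≤ H
∈-range⁻ {H} i∈ with ∈ₚ.∈-map⁻ _ i∈
... | k , k∈ , refl with ∈ₚ.∈-upTo⁻ k∈
... | s≤s k≤2H = subst (λ t → ∣ t ∣ ≤ H) (sym (ℤₚ.m-n≡m⊖n k H)) (∣k⊖H∣≤H (ℕₚ.≤-total k H))
  where
  open ℕₚ.≤-Reasoning
  ∣k⊖H∣≤H : k ≤ H ⊎ H ≤ k → ∣ k ℤ.⊖ H ∣ ≤ H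
  ∣k⊖H∣≤H (inj₁ k≤H) = subst (_≤ H) (sym (ℤₚ.∣⊖∣-≤ k≤H)) (ℕₚ.m∸n≤m H k)
  ∣k⊖H∣≤H (inj₂ H≤k) = begin
    ∣ k ℤ.⊖ H ∣     ≡⟨ cong ∣_∣ (ℤₚ.⊖-≥ H≤k) ⟩
    k ∸ H           ≤⟨ ℕₚ.∸-monoˡ-≤ H k≤2H ⟩
    2 * H ∸ H       ≡⟨ cong (_∸ H) (n+n≡2*n H) ⟨
    H + H ∸ H       ≡⟨ ℕₚ.m+n∸n≡m H H ⟩
    H               ∎

all-replicate : ∀ {A : Set} {P : A → Set} {x} k → P x → VAll.All P (replicate k x)
all-replicate zero    p = []
all-replicate (suc k) p = p ∷ all-replicate k p

all-map₂ : ∀ {A : Set} {P Q R : A → Set} {k} {v : Vec A k} → (∀ {x} → P x → Q x → R x) →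
  VAll.All P v → VAll.All Q v → VAll.All R v
all-map₂ f ps qs = VAll.map (λ (p , q) → f p q) (VAll.zip (ps , qs))

Bounded : ∀ {n} → ℕ → Vec ℤ n → Set
Bounded H = VAll.All (λ a → ∣ a ∣ ≤ H)

BoundedMat : ∀ {m n} → ℕ → Mat m n → Set
BoundedMat H = VAll.All (Bounded H)

box : ∀ n → ℕ → List (Vec ℤ n)
box n H = vecsOf n (range H)

∈-box⁺ : ∀ {n H} {v : Vec ℤ n} → Bounded H v → v ∈ box n H
∈-box⁺ v≤H = ∈-vecsOf⁺ (VAll.map ∈-range⁺ v≤H)

∈-box⁻ : ∀ {n H} {v : Vec ℤ n} → v ∈ box n H → Bounded H v
∈-box⁻ v∈ = VAll.map ∈-range⁻ (∈-vecsOf⁻ v∈)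

∈-boundedMats⁺ : ∀ {n H} {A : Matrix n} → BoundedMat H A → A ∈ boundedMats n H
∈-boundedMats⁺ A≤H = ∈-vecsOf⁺ (VAll.map ∈-box⁺ A≤H)

∈-boundedMats⁻ : ∀ {n H} {A : Matrix n} → A ∈ boundedMats n H → BoundedMat H A
∈-boundedMats⁻ A∈ = VAll.map ∈-box⁻ (∈-vecsOf⁻ A∈)

box-unique : ∀ n H → Unique (box n H)
box-unique n H = vecsOf-unique n (range-unique H)

length-box : ∀ n H → length (box n H) ≡ suc (2 * H) ^ n
length-box n H = trans (length-vecsOf n (range H)) (cong (_^ n) (length-range H))

_≟ᵛ_ : ∀ {n} → DecidableEquality (Vec ℤ n)
_≟ᵛ_ = Vecₚ.≡-dec ℤ._≟_

_≟ᵐ_ : ∀ {m n} → DecidableEquality (Mat m n)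
_≟ᵐ_ = Vecₚ.≡-dec _≟ᵛ_

atmost-bounded : ∀ n H → AtMost (Bounded {n} H) (suc (2 * H) ^ n)
atmost-bounded n H = subst (AtMost _) (length-box n H) (atmost-list _ ∈-box⁺)

bounded-≤ : ∀ {n M N} {x : Vec ℤ n} → M ≤ N → Bounded M x → Bounded N x
bounded-≤ M≤N = VAll.map (λ p → ℕₚ.≤-trans p M≤N)

bounded-𝟘 : ∀ {n M} → Bounded M (𝟘 {n})
bounded-𝟘 = all-replicate _ z≤n

bounded-⊕ : ∀ {n M N} {x y : Vec ℤ n} → Bounded M x → Bounded N y → Bounded (M + N) (x ⊕ y)
bounded-⊕ {x = []}    {[]}    []       []       = []
bounded-⊕ {x = a ∷ _} {b ∷ _} (p ∷ ps) (q ∷ qs) =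
  ℕₚ.≤-trans (ℤₚ.∣i+j∣≤∣i∣+∣j∣ a b) (ℕₚ.+-mono-≤ p q) ∷ bounded-⊕ ps qs

bounded-⊙ : ∀ {n M N} {c} {x : Vec ℤ n} → ∣ c ∣ ≤ M → Bounded N x → Bounded (M * N) (c ⊙ x)
bounded-⊙ {x = []}    p []       = []
bounded-⊙ {c = c} {a ∷ _} p (q ∷ qs) =
  subst (_≤ _) (sym (ℤₚ.∣i*j∣≡∣i∣*∣j∣ c a)) (ℕₚ.*-mono-≤ p q) ∷ bounded-⊙ {c = c} p qs

bounded-⊖ : ∀ {n M N} {x y : Vec ℤ n} → Bounded M x → Bounded N y → Bounded (M + N) (x ⊖ y)
bounded-⊖ {N = N} p q =
  bounded-⊕ p (bounded-≤ (ℕₚ.≤-reflexive (ℕₚ.*-identityˡ N)) (bounded-⊙ {c = - 1ℤ} ℕₚ.≤-refl q))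

bounded-⊖-same : ∀ {n H} {x y : Vec ℤ n} → Bounded H x → Bounded H y → Bounded (2 * H) (x ⊖ y)
bounded-⊖-same {H = H} p q = bounded-≤ (ℕₚ.≤-reflexive (n+n≡2*n H)) (bounded-⊖ p q)

bounded-multiple⇒≡𝟘 : ∀ {n T} q {x : Vec ℤ n} → T < q → Bounded T (+ q ⊙ x) → x ≡ 𝟘
bounded-multiple⇒≡𝟘 q {[]}    T<q []       = refl
bounded-multiple⇒≡𝟘 {T = T} q {a ∷ x} T<q (p ∷ ps) =
  cong₂ _∷_ (ℤₚ.∣i∣≡0⇒i≡0 (ℕₚ.n<1⇒n≡0 (ℕₚ.*-cancelˡ-< q ∣ a ∣ 1 (begin-strict
    q * ∣ a ∣          ≡⟨ ℤₚ.∣i*j∣≡∣i∣*∣j∣ (+ q) a ⟨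
    ∣ + q ℤ.* a ∣      ≤⟨ p ⟩
    T                  <⟨ T<q ⟩
    q                  ≡⟨ ℕₚ.*-identityʳ q ⟨
    q * 1              ∎)))) (bounded-multiple⇒≡𝟘 q T<q ps)
  where open ℕₚ.≤-Reasoning

CombBounded : ∀ {k n} → ℕ → Mat k n → Set
CombBounded S bs = ∀ {R ρ} → Bounded R ρ → Bounded (R * S) (comb ρ bs)

combBounded-[] : ∀ {n} → CombBounded {n = n} 0 []
combBounded-[] {ρ = []} [] = bounded-𝟘

combBounded-∷ : ∀ {k n M S} {b : Vec ℤ n} {bs : Mat k n} → Bounded M b → CombBounded S bs → CombBounded (M + S) (b ∷ bs)
combBounded-∷ {M = M} {S} b≤M bs≤S {R} {a ∷ ρ} (a≤R ∷ ρ≤R) =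
  bounded-≤ (ℕₚ.≤-reflexive (sym (ℕₚ.*-distribˡ-+ R M S))) (bounded-⊕ (bounded-⊙ {c = a} a≤R b≤M) (bs≤S ρ≤R))

bounded⇒combBounded : ∀ {k n M} {bs : Mat k n} → BoundedMat M bs → CombBounded (k * M) bs
bounded⇒combBounded {bs = []}     []           = combBounded-[]
bounded⇒combBounded {bs = b ∷ bs} (b≤M ∷ bs≤M) = combBounded-∷ {b = b} {bs} b≤M (bounded⇒combBounded bs≤M)

∃-combBounded : ∀ {k n} (bs : Mat k n) → ∃[ S ] CombBounded S bs
∃-combBounded []       = 0 , combBounded-[]
∃-combBounded (b ∷ bs) =
  let M , b≤M = ∃-bounded b ; S , bs≤S = ∃-combBounded bs in M + S , combBounded-∷ {b = b} {bs} b≤M bs≤S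
  where
  ∃-bounded : ∀ {n} (x : Vec ℤ n) → ∃[ M ] Bounded M x
  ∃-bounded []      = 0 , []
  ∃-bounded (a ∷ x) = let M , x≤M = ∃-bounded x in
    (∣ a ∣ + M) , (ℕₚ.m≤m+n (∣ a ∣) M ∷ bounded-≤ (ℕₚ.m≤n+m M (∣ a ∣)) x≤M)

linear⇒bounded : ∀ {m n} {f : Vec ℤ m → Vec ℤ n} → Linear f → ∃[ S ] ∀ {T x} → Bounded T x → Bounded (T * S) (f x)
linear⇒bounded {f = f} F = let S , columns≤S = ∃-combBounded (tabulate (f ∘ unit)) in
  S , λ {T} {x} x≤T → subst (Bounded (T * S)) (sym (linear≗comb F x)) (columns≤S x≤T)

-- Coordinates modulo given integers

∏ : ∀ {k} → Vec ℕ k → ℕ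
∏ = Vec.foldr _ _*_ 1

scaleBy : ∀ {k} → Vec ℕ k → Vec ℤ k → Vec ℤ k
scaleBy = zipWith (λ q a → + q ℤ.* a)

scaleBy-linear : ∀ {k} (qs : Vec ℕ k) → Linear (scaleBy qs)
scaleBy-linear []       = record { ⊕-homo = λ { [] [] → refl } ; ⊙-homo = λ { _ [] → refl } }
scaleBy-linear (q ∷ qs) = record
  { ⊕-homo = λ { (a ∷ x) (b ∷ y) → cong₂ _∷_ (ℤₚ.*-distribˡ-+ (+ q) a b) (⊕-homo (scaleBy-linear qs) x y) }
  ; ⊙-homo = λ { c (a ∷ x) → cong₂ _∷_ (swap-factors (+ q) c a) (⊙-homo (scaleBy-linear qs) c x) } }
  where
  swap-factors : ∀ q c a → q ℤ.* (c ℤ.* a) ≡ c ℤ.* (q ℤ.* a)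
  swap-factors = solve-∀

scaleBy-replicate : ∀ {k} q (w : Vec ℤ k) → scaleBy (replicate k q) w ≡ + q ⊙ w
scaleBy-replicate q = Vecₚ.zipWith-replicate₁ (λ q a → + q ℤ.* a) q

residues : ∀ {k} → Vec ℕ k → List (Vec ℤ k)
residues []       = [] ∷ []
residues (q ∷ qs) = List.cartesianProductWith _∷_ (List.map +_ (List.upTo q)) (residues qs)

length-residues : ∀ {k} (qs : Vec ℕ k) → length (residues qs) ≡ ∏ qs
length-residues []       = refl
length-residues (q ∷ qs) = trans (length-cartesianProductWith _∷_ (List.map +_ (List.upTo q)) (residues qs))
  (cong₂ _*_ (trans (Listₚ.length-map +_ (List.upTo q)) (Listₚ.length-upTo q)) (length-residues qs))

residue+multiple : ∀ {k} {qs : Vec ℕ k} → VAll.All (0 <_) qs → ∀ z →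
  ∃[ ρ ] ρ ∈ residues qs × ∃[ w ] z ≡ ρ ⊕ scaleBy qs w
residue+multiple []                  []      = [] , here refl , [] , refl
residue+multiple {qs = q ∷ _} (q>0 ∷ qs>0) (a ∷ z) with residue+multiple qs>0 z
... | ρ , ρ∈ , w , z≡ = + (a ℤ/.%ℕ q) ∷ ρ ,
  ∈ₚ.∈-cartesianProductWith⁺ _∷_ (∈ₚ.∈-map⁺ +_ (∈ₚ.∈-upTo⁺ (ℤ/.n%ℕd<d a q))) ρ∈ ,
  a ℤ/./ℕ q ∷ w , cong₂ _∷_ (trans (ℤ/.a≡a%ℕn+[a/ℕn]*n a q)
    (cong (λ t → + (a ℤ/.%ℕ q) ℤ.+ t) (ℤₚ.*-comm (a ℤ/./ℕ q) (+ q)))) z≡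
  where instance _ = >-nonZero q>0

atmost-residues : ∀ {X : Set} {k} {P : X → Set} {qs : Vec ℕ k} → VAll.All (0 <_) qs →
  (Coordinates : X → Vec ℤ k → Set) → (∀ {x} → P x → ∃ (Coordinates x)) →
  (∀ {x y z z′ w} → P x → P y → Coordinates x z → Coordinates y z′ → z ⊖ z′ ≡ scaleBy qs w → x ≡ y) →
  AtMost P (∏ qs)
atmost-residues {X} {P = P} {qs} qs>0 Coordinates coordinates separates =
  subst (AtMost P) (length-residues qs) (atmost-encoding Residue residue injective (atmost-list (residues qs) id))
  where
  Residue : X → Vec ℤ _ → Set
  Residue x ρ = P x × ∃[ z ] ∃[ w ] Coordinates x z × z ≡ ρ ⊕ scaleBy qs w
  residue : ∀ {x} → P x → ∃[ ρ ] ρ ∈ residues qs × Residue x ρ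
  residue p = let z , c = coordinates p ; ρ , ρ∈ , w , z≡ = residue+multiple qs>0 z in ρ , ρ∈ , p , z , w , c , z≡
  injective : ∀ {x y ρ} → Residue x ρ → Residue y ρ → x ≡ y
  injective {ρ = ρ} (p , _ , w , c , refl) (p′ , _ , w′ , c′ , refl) = separates p p′ c c′
    (trans (z⊕x⊖[z⊕y]≡x⊖y (scaleBy qs w) (scaleBy qs w′) ρ) (sym (⊖-homo (scaleBy-linear qs) w w′)))

-- Two vectors of a lattice in the box that are congruent modulo 2T+1 in the coordinates τ differ by
-- 2T+1 times a lattice vector, hence coincide.
atmost-lattice-coset : ∀ {n t T} (L : Lattice n t) {P : Vec ℤ n → Set} → (∀ {x} → P x → Bounded T x) →
  (∀ {x y} → P x → P y → Mem L (x ⊖ y)) → AtMost P (suc (2 * T) ^ t)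
atmost-lattice-coset {t = t} {T} L {P} P≤T difference∈ = subst (AtMost P) (∏-replicate t)
  (atmost-residues (all-replicate t (s≤s z≤n)) (λ x z → τ x ≡ z) (λ _ → _ , refl) separates)
  where
  open Lattice L using (τ; τ-linear; τ-divisible)
  q : ℕ
  q = suc (2 * T)
  ∏-replicate : ∀ k → ∏ (replicate k q) ≡ q ^ k
  ∏-replicate zero    = refl
  ∏-replicate (suc k) = cong (q *_) (∏-replicate k)
  separates : ∀ {x y z z′ w} → P x → P y → τ x ≡ z → τ y ≡ z′ → z ⊖ z′ ≡ scaleBy (replicate t q) w → x ≡ y
  separates {x} {y} {w = w} px py refl refl τx-τy≡qw
    with τ-divisible (+ q) w (difference∈ px py) (trans (⊖-homo τ-linear x y) (trans τx-τy≡qw (scaleBy-replicate q w)))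
  ... | u , x-y≡qu = ⊕ₚ.x∙y⁻¹≈ε⇒x≈y x y (begin
    x ⊖ y       ≡⟨ x-y≡qu ⟩
    + q ⊙ u
      ≡⟨ cong (+ q ⊙_) (bounded-multiple⇒≡𝟘 q ℕₚ.≤-refl qu-bounded) ⟩
    + q ⊙ 𝟘     ≡⟨ ⊙-zeroʳ (+ q) ⟩
    𝟘           ∎)
    where
    open ≡-Reasoning
    qu-bounded : Bounded (2 * T) (+ q ⊙ u)
    qu-bounded = subst (Bounded (2 * T)) x-y≡qu (bounded-⊖-same (P≤T px) (P≤T py))

-- Reduced bases

Short : ∀ {n} → ℕ → Vec ℤ n → Set
Short e = VAll.All (λ a → ∣ a ∣ < 2 ^ e)

short⇒bounded : ∀ {n} e {x : Vec ℤ n} → Short e x → Bounded (2 ^ e) x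
short⇒bounded e = VAll.map ℕₚ.<⇒≤

bounded⇒short : ∀ {n} e {H} {x : Vec ℤ n} → H < 2 ^ e → Bounded H x → Short e x
bounded⇒short e H<2^e = VAll.map (λ a≤H → ℕₚ.≤-<-trans a≤H H<2^e)

short-0⇒≡𝟘 : ∀ {n} {x : Vec ℤ n} → Short 0 x → x ≡ 𝟘
short-0⇒≡𝟘 []       = refl
short-0⇒≡𝟘 (p ∷ ps) = cong₂ _∷_ (ℤₚ.∣i∣≡0⇒i≡0 (ℕₚ.n<1⇒n≡0 p)) (short-0⇒≡𝟘 ps)

2^[h∸e]*2^e≡2^h : ∀ {e h} → e ≤ h → 2 ^ (h ∸ e) * 2 ^ e ≡ 2 ^ h
2^[h∸e]*2^e≡2^h {e} {h} e≤h = trans (sym (ℕₚ.^-distribˡ-+-* 2 (h ∸ e) e)) (cong (2 ^_) (ℕₚ.m∸n+n≡m e≤h))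

short-divide : ∀ {n e h} {x : Vec ℤ n} → e ≤ h → Short h (+ (2 ^ (h ∸ e)) ⊙ x) → Short e x
short-divide {x = []} e≤h [] = []
short-divide {e = e} {h} {a ∷ x} e≤h (p ∷ ps) = ℕₚ.*-cancelˡ-< (2 ^ (h ∸ e)) ∣ a ∣ (2 ^ e) (begin-strict
  2 ^ (h ∸ e) * ∣ a ∣            ≡⟨ ℤₚ.∣i*j∣≡∣i∣*∣j∣ (+ (2 ^ (h ∸ e))) a ⟨
  ∣ + (2 ^ (h ∸ e)) ℤ.* a ∣      <⟨ p ⟩
  2 ^ h                          ≡⟨ 2^[h∸e]*2^e≡2^h e≤h ⟨
  2 ^ (h ∸ e) * 2 ^ e            ∎) ∷ short-divide e≤h ps
  where open ℕₚ.≤-Reasoning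

-- Reduced h bs es: the vectors bs, the last one found coming first, have sizes about 2^e for the
-- corresponding levels e ≤ h, and a combination shorter than 2^e does not involve the vector of level e.
data Reduced {n} (h : ℕ) : ∀ {k} → Mat k n → Vec ℕ k → Set where
  []     : Reduced h [] []
  adjoin : ∀ {k e b} {bs : Mat k n} {es} → e ≤ h → Bounded (2 ^ (e + suc k)) b →
           (∀ z zs → Short e (z ⊙ b ⊕ comb zs bs) → z ≡ 0ℤ) → Reduced e bs es → Reduced h (b ∷ bs) (e ∷ es)

reduced-≤ : ∀ {n k h h′} {bs : Mat k n} {es} → h ≤ h′ → Reduced h bs es → Reduced h′ bs es
reduced-≤ h≤h′ []                                   = []
reduced-≤ h≤h′ (adjoin e≤h b≤ separated bs-reduced) = adjoin (ℕₚ.≤-trans e≤h h≤h′) b≤ separated bs-reduced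

levels≤ : ∀ {n k h} {bs : Mat k n} {es} → Reduced h bs es → VAll.All (_≤ h) es
levels≤ []                          = []
levels≤ (adjoin e≤h _ _ bs-reduced) = e≤h ∷ VAll.map (λ f≤e → ℕₚ.≤-trans f≤e e≤h) (levels≤ bs-reduced)

moduli : ∀ {k} → ℕ → Vec ℕ k → Vec ℕ k
moduli h = Vec.map (λ e → 2 ^ (h ∸ e))

moduli>0 : ∀ {k} h (es : Vec ℕ k) → VAll.All (0 <_) (moduli h es)
moduli>0 h es = VAllₚ.map⁺ (VAll.universal (λ e → ℕₚ.m^n>0 2 (h ∸ e)) es)

moduli-divisible : ∀ {k h e} {es : Vec ℕ k} → e ≤ h → VAll.All (_≤ e) es → ∀ w →
  ∃[ u ] scaleBy (moduli h es) w ≡ + (2 ^ (h ∸ e)) ⊙ u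
moduli-divisible e≤h []          []      = [] , refl
moduli-divisible {h = h} {e} {f ∷ es} e≤h (f≤e ∷ es≤e) (a ∷ w) with moduli-divisible e≤h es≤e w
... | u , w≡ = + (2 ^ (e ∸ f)) ℤ.* a ∷ u , cong₂ _∷_ (begin
  + (2 ^ (h ∸ f)) ℤ.* a                          ≡⟨ cong (λ t → + (2 ^ t) ℤ.* a) h∸f ⟩
  + (2 ^ (h ∸ e + (e ∸ f))) ℤ.* a                ≡⟨ cong (λ t → + t ℤ.* a) (ℕₚ.^-distribˡ-+-* 2 (h ∸ e) (e ∸ f)) ⟩
  + (2 ^ (h ∸ e) * 2 ^ (e ∸ f)) ℤ.* a            ≡⟨ cong (ℤ._* a) (ℤₚ.pos-* (2 ^ (h ∸ e)) (2 ^ (e ∸ f))) ⟩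
  + (2 ^ (h ∸ e)) ℤ.* + (2 ^ (e ∸ f)) ℤ.* a      ≡⟨ ℤₚ.*-assoc (+ (2 ^ (h ∸ e))) (+ (2 ^ (e ∸ f))) a ⟩
  + (2 ^ (h ∸ e)) ℤ.* (+ (2 ^ (e ∸ f)) ℤ.* a)    ∎) w≡
  where
  open ≡-Reasoning
  h∸f : h ∸ f ≡ h ∸ e + (e ∸ f)
  h∸f = trans (cong (_∸ f) (sym (ℕₚ.m∸n+n≡m e≤h))) (ℕₚ.+-∸-assoc (h ∸ e) f≤e)

reduced-separates : ∀ {n k h h′} {bs : Mat k n} {es} → Reduced h′ bs es → h′ ≤ h → ∀ w →
  Short h (comb (scaleBy (moduli h es) w) bs) → comb (scaleBy (moduli h es) w) bs ≡ 𝟘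
reduced-separates []                                       _     []      _     = refl
reduced-separates {h = h} {bs = b ∷ bs} {e ∷ es} (adjoin e≤h′ _ separated bs-reduced) h′≤h (a ∷ w) short
  with moduli-divisible (ℕₚ.≤-trans e≤h′ h′≤h) (levels≤ bs-reduced) w
... | u , w≡qu = trans drop-b (reduced-separates bs-reduced e≤h w (subst (Short h) drop-b short))
  where
  open ≡-Reasoning
  e≤h : e ≤ h
  e≤h = ℕₚ.≤-trans e≤h′ h′≤h
  q = + (2 ^ (h ∸ e))
  rest = comb (scaleBy (moduli h es) w) bs
  factor : (q ℤ.* a) ⊙ b ⊕ rest ≡ q ⊙ (a ⊙ b ⊕ comb u bs)
  factor = begin
    (q ℤ.* a) ⊙ b ⊕ rest                  ≡⟨ cong₂ _⊕_ (⊙-assoc q a b) (cong (λ t → comb t bs) w≡qu) ⟩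
    q ⊙ a ⊙ b ⊕ comb (q ⊙ u) bs           ≡⟨ cong (q ⊙ a ⊙ b ⊕_) (⊙-homo (comb-linear bs) q u) ⟩
    q ⊙ a ⊙ b ⊕ q ⊙ comb u bs             ≡⟨ ⊙-distribˡ-⊕ q (a ⊙ b) (comb u bs) ⟨
    q ⊙ (a ⊙ b ⊕ comb u bs)               ∎
  a≡0 : a ≡ 0ℤ
  a≡0 = separated a u (short-divide e≤h (subst (Short h) factor short))
  drop-b : (q ℤ.* a) ⊙ b ⊕ rest ≡ rest
  drop-b = begin
    (q ℤ.* a) ⊙ b ⊕ rest      ≡⟨ cong (λ t → t ⊙ b ⊕ rest) (trans (cong (q ℤ.*_) a≡0) (ℤₚ.*-zeroʳ q)) ⟩
    0ℤ ⊙ b ⊕ rest             ≡⟨ cong (_⊕ rest) (⊙-zeroˡ b) ⟩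
    𝟘 ⊕ rest                  ≡⟨ ⊕ₚ.identityˡ rest ⟩
    rest                      ∎

atmost-reduced-coset : ∀ {n k h} {P : Vec ℤ n → Set} {bs : Mat k n} {es} → Reduced h bs es →
  (∀ {x y} → P x → P y → Short h (x ⊖ y) × InSpan bs (x ⊖ y)) → AtMost P (∏ (moduli h es))
atmost-reduced-coset {h = h} {P} {bs} {es} bs-reduced difference = atmost-inhabited λ x₀ px₀ →
  atmost-residues (moduli>0 h es) (λ x z → x ⊖ x₀ ≡ comb z bs) (λ px → proj₂ (difference px px₀)) (separates x₀)
  where
  open ≡-Reasoning
  separates : ∀ x₀ {x y z z′ w} → P x → P y → x ⊖ x₀ ≡ comb z bs → y ⊖ x₀ ≡ comb z′ bs →
    z ⊖ z′ ≡ scaleBy (moduli h es) w → x ≡ y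
  separates x₀ {x} {y} {z} {z′} {w} px py x≡ y≡ z-z′≡ = ⊕ₚ.x∙y⁻¹≈ε⇒x≈y x y (trans x-y≡
    (reduced-separates bs-reduced ℕₚ.≤-refl w (subst (Short h) x-y≡ (proj₁ (difference px py)))))
    where
    x-y≡ : x ⊖ y ≡ comb (scaleBy (moduli h es) w) bs
    x-y≡ = begin
      x ⊖ y                                   ≡⟨ x⊖z⊖[y⊖z]≡x⊖y x y x₀ ⟨
      (x ⊖ x₀) ⊖ (y ⊖ x₀)                     ≡⟨ cong₂ _⊖_ x≡ y≡ ⟩
      comb z bs ⊖ comb z′ bs                  ≡⟨ ⊖-homo (comb-linear bs) z z′ ⟨
      comb (z ⊖ z′) bs                        ≡⟨ cong (λ t → comb t bs) z-z′≡ ⟩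
      comb (scaleBy (moduli h es) w) bs       ∎

levelSum : ℕ → ℕ → ℕ
levelSum e zero    = 0
levelSum e (suc k) = 2 ^ (e + suc k) + levelSum e k

levelSum+2^[1+e]≡ : ∀ e k → levelSum e k + 2 ^ suc e ≡ 2 ^ (e + suc k)
levelSum+2^[1+e]≡ e zero    = cong (2 ^_) (ℕₚ.+-comm 1 e)
levelSum+2^[1+e]≡ e (suc k) = begin
  p + levelSum e k + 2 ^ suc e        ≡⟨ ℕₚ.+-assoc p (levelSum e k) (2 ^ suc e) ⟩
  p + (levelSum e k + 2 ^ suc e)      ≡⟨ cong (λ t → p + t) (levelSum+2^[1+e]≡ e k) ⟩
  p + p                               ≡⟨ n+n≡2*n p ⟩
  2 ^ suc (e + suc k)                 ≡⟨ cong (2 ^_) (ℕₚ.+-suc e (suc k)) ⟨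
  2 ^ (e + suc (suc k))               ∎
  where
  open ≡-Reasoning
  p = 2 ^ (e + suc k)

reduced⇒combBounded : ∀ {n k e h} {bs : Mat k n} {es} → Reduced e bs es → e ≤ h → CombBounded (levelSum h k) bs
reduced⇒combBounded []                           _   = combBounded-[]
reduced⇒combBounded {k = suc k} {bs = b ∷ bs} (adjoin f≤e b≤ _ bs-reduced) e≤h = combBounded-∷ {b = b} {bs}
  (bounded-≤ (ℕₚ.^-monoʳ-≤ 2 (ℕₚ.+-monoˡ-≤ (suc k) f≤h)) b≤) (reduced⇒combBounded bs-reduced f≤h)
  where f≤h = ℕₚ.≤-trans f≤e e≤h

-- Existence of reduced bases

record PartialBasis {n t₀} (L : Lattice n t₀) (k t : ℕ) : Set where
  field
    k+t≡t₀              : k + t ≡ t₀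
    vectors             : Mat k n
    vectors∈            : VAll.All (Mem L) vectors
    quotient            : Vec ℤ n → Vec ℤ t
    quotient-linear     : Linear quotient
    quotient-surjective : ∀ w → ∃[ x ] Mem L x × quotient x ≡ w
    vectors↦𝟘           : VAll.All (λ b → quotient b ≡ 𝟘) vectors
    kernel⇒span         : ∀ {x} → Mem L x → quotient x ≡ 𝟘 → InSpan vectors x

  vectors-span∈ : ∀ z → Mem L (comb z vectors)
  vectors-span∈ = Lattice.Mem-comb L vectors∈

  quotient-⊕-span : ∀ x z → quotient (x ⊕ comb z vectors) ≡ quotient x
  quotient-⊕-span x z = begin
    quotient (x ⊕ comb z vectors)               ≡⟨ ⊕-homo quotient-linear x _ ⟩
    quotient x ⊕ quotient (comb z vectors)      ≡⟨ cong (quotient x ⊕_) (linear-comb≡𝟘 quotient-linear z vectors↦𝟘) ⟩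
    quotient x ⊕ 𝟘                              ≡⟨ ⊕ₚ.identityʳ _ ⟩
    quotient x                                  ∎
    where open ≡-Reasoning

emptyBasis : ∀ {n t₀} (L : Lattice n t₀) → PartialBasis L 0 t₀
emptyBasis L = record
  { k+t≡t₀ = refl ; vectors = [] ; vectors∈ = []
  ; quotient = τ ; quotient-linear = τ-linear ; quotient-surjective = τ-surjective
  ; vectors↦𝟘 = [] ; kernel⇒span = λ x∈ τx≡0 → [] , τ-injective x∈ τx≡0 }
  where open Lattice L

recoordinatise : ∀ {n t₀ k t} {L : Lattice n t₀} → Unimodular t → PartialBasis L k t → PartialBasis L k t
recoordinatise e B = record
  { k+t≡t₀ = k+t≡t₀ ; vectors = vectors ; vectors∈ = vectors∈
  ; quotient = ⟦ e ⟧ ∘ quotient ; quotient-linear = ∘-linear (⟦⟧-linear e) quotient-linear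
  ; quotient-surjective = λ w → let x , x∈ , x↦ = quotient-surjective (⟦ inverse e ⟧ w) in
      x , x∈ , trans (cong ⟦ e ⟧ x↦) (inverseʳ e w)
  ; vectors↦𝟘 = VAll.map (λ b↦𝟘 → trans (cong ⟦ e ⟧ b↦𝟘) (𝟘-homo (⟦⟧-linear e))) vectors↦𝟘
  ; kernel⇒span = λ x∈ ex≡0 → kernel⇒span x∈ (⟦⟧≡𝟘⇒≡𝟘 e ex≡0) }
  where open PartialBasis B

bounded-divide : ∀ {n M S} g → g ≢ 0ℤ → {x : Vec ℤ n} → Bounded (M + ∣ g ∣ * S) (g ⊙ x) → Bounded (M + S) x
bounded-divide g g≢0 {[]}    []       = []
bounded-divide {M = M} {S} g g≢0 {a ∷ x} (p ∷ ps) = ℕₚ.*-cancelˡ-≤ ∣ g ∣ (begin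
    ∣ g ∣ * ∣ a ∣              ≡⟨ ℤₚ.∣i*j∣≡∣i∣*∣j∣ g a ⟨
    ∣ g ℤ.* a ∣                ≤⟨ p ⟩
    M + ∣ g ∣ * S              ≤⟨ ℕₚ.+-monoˡ-≤ (∣ g ∣ * S) (ℕₚ.m≤n*m M ∣ g ∣) ⟩
    ∣ g ∣ * M + ∣ g ∣ * S      ≡⟨ ℕₚ.*-distribˡ-+ ∣ g ∣ M S ⟨
    ∣ g ∣ * (M + S)            ∎) ∷ bounded-divide g g≢0 ps
  where
  open ℕₚ.≤-Reasoning
  instance _ = ℤ.≢-nonZero g≢0

remainder+multiple : ∀ {k} g → g ≢ 0ℤ → (z : Vec ℤ k) → ∃[ q ] ∃[ ρ ] z ≡ g ⊙ q ⊕ ρ × Bounded ∣ g ∣ ρ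
remainder+multiple g g≢0 []      = [] , [] , refl , []
remainder+multiple g g≢0 (a ∷ z) with remainder+multiple g g≢0 z
... | q , ρ , z≡ , ρ≤ = a ℤ/./ g ∷ q , + (a ℤ/.% g) ∷ ρ , cong₂ _∷_ a≡ z≡ , ℕₚ.<⇒≤ (ℤ/.n%d<d a g) ∷ ρ≤
  where
  instance _ = ℤ.≢-nonZero g≢0
  a≡ : a ≡ g ℤ.* (a ℤ/./ g) ℤ.+ + (a ℤ/.% g)
  a≡ = trans (ℤ/.a≡a%n+[a/n]*n a g)
    (trans (ℤₚ.+-comm (+ (a ℤ/.% g)) ((a ℤ/./ g) ℤ.* g)) (cong (ℤ._+ + (a ℤ/.% g)) (ℤₚ.*-comm (a ℤ/./ g) g)))

module _ {n t₀ k t : ℕ} {L : Lattice n t₀} (B : PartialBasis L k (suc t)) where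
  open PartialBasis B
  open Lattice L using (Mem-⊕; Mem-⊙; Mem-⊖)

  quotient-⊙ : ∀ {b} → quotient b ≡ 1ℤ ∷ 𝟘 → ∀ a → quotient (a ⊙ b) ≡ a ∷ 𝟘
  quotient-⊙ {b} b↦ a = begin
    quotient (a ⊙ b)         ≡⟨ ⊙-homo quotient-linear a b ⟩
    a ⊙ quotient b           ≡⟨ cong (a ⊙_) b↦ ⟩
    a ℤ.* 1ℤ ∷ a ⊙ 𝟘         ≡⟨ cong₂ _∷_ (ℤₚ.*-identityʳ a) (⊙-zeroʳ a) ⟩
    a ∷ 𝟘                    ∎
    where open ≡-Reasoning

  quotient-⊖≡𝟘 : ∀ {a b y} → quotient b ≡ 1ℤ ∷ 𝟘 → quotient y ≡ a ∷ 𝟘 → quotient (y ⊖ a ⊙ b) ≡ 𝟘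
  quotient-⊖≡𝟘 {a} {b} {y} b↦ y↦ = begin
    quotient (y ⊖ a ⊙ b)                 ≡⟨ ⊖-homo quotient-linear y (a ⊙ b) ⟩
    quotient y ⊖ quotient (a ⊙ b)        ≡⟨ cong₂ _⊖_ y↦ (quotient-⊙ b↦ a) ⟩
    (a ∷ 𝟘) ⊖ (a ∷ 𝟘)                    ≡⟨ ⊕-inverseʳ (a ∷ 𝟘) ⟩
    𝟘                                    ∎
    where open ≡-Reasoning

  adjoin-vector : ∀ {b} → Mem L b → quotient b ≡ 1ℤ ∷ 𝟘 → PartialBasis L (suc k) t
  adjoin-vector {b} b∈ b↦ = record
    { k+t≡t₀ = trans (sym (ℕₚ.+-suc k t)) k+t≡t₀
    ; vectors = b ∷ vectors ; vectors∈ = b∈ ∷ vectors∈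
    ; quotient = tail ∘ quotient ; quotient-linear = ∘-linear tail-linear quotient-linear
    ; quotient-surjective = λ w → let x , x∈ , x↦ = quotient-surjective (0ℤ ∷ w) in x , x∈ , cong tail x↦
    ; vectors↦𝟘 = cong tail b↦ ∷ VAll.map (cong tail) vectors↦𝟘
    ; kernel⇒span = in-span }
    where
    open ≡-Reasoning
    in-span : ∀ {x} → Mem L x → tail (quotient x) ≡ 𝟘 → InSpan (b ∷ vectors) x
    in-span {x} x∈ x↦ with kernel⇒span (Mem-⊖ x∈ (Mem-⊙ a b∈))
        (quotient-⊖≡𝟘 b↦ (trans (sym (head∷tail (quotient x))) (cong (a ∷_) x↦)))
      where a = head (quotient x)
    ... | z , x-ab≡ = a ∷ z , (begin
      x                             ≡⟨ ⊕ₚ.//-rightDividesˡ (a ⊙ b) x ⟨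
      (x ⊖ a ⊙ b) ⊕ a ⊙ b           ≡⟨ cong (_⊕ a ⊙ b) x-ab≡ ⟩
      comb z vectors ⊕ a ⊙ b        ≡⟨ ⊕-comm (comb z vectors) (a ⊙ b) ⟩
      a ⊙ b ⊕ comb z vectors        ∎)
      where a = head (quotient x)

  primitive-part : ∀ {g x} → g ≢ 0ℤ → Mem L x → quotient x ≡ g ∷ 𝟘 →
    ∃[ b ] ∃[ ρ ] Mem L b × quotient b ≡ 1ℤ ∷ 𝟘 × Bounded ∣ g ∣ ρ × x ≡ comb ρ vectors ⊕ g ⊙ b
  primitive-part {g} {x} g≢0 x∈ x↦ with quotient-surjective (1ℤ ∷ 𝟘)
  ... | c , c∈ , c↦ with kernel⇒span (Mem-⊖ x∈ (Mem-⊙ g c∈)) (quotient-⊖≡𝟘 c↦ x↦)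
  ... | z , x-gc≡ with remainder+multiple g g≢0 z
  ... | q , ρ , z≡ , ρ≤ = c ⊕ comb q vectors , ρ , Mem-⊕ c∈ (vectors-span∈ q) , trans (quotient-⊕-span c q) c↦ , ρ≤ , x≡
    where
    open ≡-Reasoning
    [ρ] = comb ρ vectors
    x≡ : x ≡ [ρ] ⊕ g ⊙ (c ⊕ comb q vectors)
    x≡ = begin
      x                                               ≡⟨ ⊕ₚ.//-rightDividesˡ (g ⊙ c) x ⟨
      (x ⊖ g ⊙ c) ⊕ g ⊙ c
        ≡⟨ cong (_⊕ g ⊙ c) (trans x-gc≡ (cong (λ t → comb t vectors) z≡)) ⟩
      comb (g ⊙ q ⊕ ρ) vectors ⊕ g ⊙ c
        ≡⟨ cong (_⊕ g ⊙ c) (trans (⊕-homo (comb-linear vectors) (g ⊙ q) ρ) (⊕-comm _ [ρ])) ⟩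
      ([ρ] ⊕ comb (g ⊙ q) vectors) ⊕ g ⊙ c            ≡⟨ ⊕ₚ.assoc [ρ] _ _ ⟩
      [ρ] ⊕ (comb (g ⊙ q) vectors ⊕ g ⊙ c)            ≡⟨ cong ([ρ] ⊕_) (⊕-comm _ (g ⊙ c)) ⟩
      [ρ] ⊕ (g ⊙ c ⊕ comb (g ⊙ q) vectors)
        ≡⟨ cong (λ t → [ρ] ⊕ (g ⊙ c ⊕ t)) (⊙-homo (comb-linear vectors) g q) ⟩
      [ρ] ⊕ (g ⊙ c ⊕ g ⊙ comb q vectors)              ≡⟨ cong ([ρ] ⊕_) (⊙-distribˡ-⊕ g c _) ⟨
      [ρ] ⊕ g ⊙ (c ⊕ comb q vectors)                  ∎

module _ {n t₀ : ℕ} (L : Lattice n t₀) where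

  record Stage (e k t : ℕ) : Set where
    field
      partialBasis : PartialBasis L k t
    open PartialBasis partialBasis public
    field
      levels    : Vec ℕ k
      reduced   : Reduced e vectors levels
      short↦𝟘   : ∀ {x} → Mem L x → Short e x → quotient x ≡ 𝟘

  open Stage

  initial : Stage 0 0 t₀
  initial = record
    { partialBasis = emptyBasis L ; levels = [] ; reduced = []
    ; short↦𝟘 = λ _ short → trans (cong τ (short-0⇒≡𝟘 short)) (𝟘-homo τ-linear) }
    where open Lattice L

  raise : ∀ {e k t} (s : Stage e k t) → (∀ {x} → Mem L x → Short (suc e) x → quotient s x ≡ 𝟘) → Stage (suc e) k t
  raise s short↦𝟘′ = record
    { partialBasis = partialBasis s ; levels = levels s
    ; reduced = reduced-≤ (ℕₚ.n≤1+n _) (reduced s) ; short↦𝟘 = short↦𝟘′ }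

  -- Reducing the coordinates of x modulo g keeps x / g short.
  enlarge-normalised : ∀ {e k t g x} (s : Stage e k (suc t)) → g ≢ 0ℤ → Mem L x → Short (suc e) x →
    quotient s x ≡ g ∷ 𝟘 → Stage e (suc k) t
  enlarge-normalised {e} {k} {g = g} {x} s g≢0 x∈ x-short x↦ with primitive-part (partialBasis s) g≢0 x∈ x↦
  ... | b , ρ , b∈ , b↦ , ρ≤ , x≡ = record
    { partialBasis = adjoin-vector (partialBasis s) b∈ b↦ ; levels = e ∷ levels s
    ; reduced = adjoin ℕₚ.≤-refl b-bounded separated (reduced s)
    ; short↦𝟘 = λ y∈ y-short → cong tail (short↦𝟘 s y∈ y-short) }
    where
    S = levelSum e k
    gb≡ : g ⊙ b ≡ x ⊖ comb ρ (vectors s)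
    gb≡ = trans (sym (⊕ₚ.xyx⁻¹≈y (comb ρ (vectors s)) (g ⊙ b))) (cong (_⊖ comb ρ (vectors s)) (sym x≡))
    b-bounded : Bounded (2 ^ (e + suc k)) b
    b-bounded = bounded-≤ (ℕₚ.≤-reflexive (trans (ℕₚ.+-comm (2 ^ suc e) S) (levelSum+2^[1+e]≡ e k)))
      (bounded-divide g g≢0 (subst (Bounded (2 ^ suc e + ∣ g ∣ * S)) (sym gb≡)
        (bounded-⊖ (short⇒bounded (suc e) x-short) (reduced⇒combBounded (reduced s) ℕₚ.≤-refl ρ≤))))
    separated : ∀ a zs → Short e (a ⊙ b ⊕ comb zs (vectors s)) → a ≡ 0ℤ
    separated a zs short = cong head (begin
      a ∷ 𝟘                                                   ≡⟨ quotient-⊙ (partialBasis s) b↦ a ⟨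
      quotient s (a ⊙ b)                                      ≡⟨ quotient-⊕-span s (a ⊙ b) zs ⟨
      quotient s (a ⊙ b ⊕ comb zs (vectors s))
        ≡⟨ short↦𝟘 s (Mem-⊕ (Mem-⊙ a b∈) (vectors-span∈ s zs)) short ⟩
      𝟘                                                       ∎)
      where
      open ≡-Reasoning
      open Lattice L using (Mem-⊕; Mem-⊙)

  enlarge : ∀ {e k t x} (s : Stage e k (suc t)) → Mem L x → Short (suc e) x → quotient s x ≢ 𝟘 → Stage e (suc k) t
  enlarge {x = x} s x∈ x-short x↦≢0 with clear-tail (quotient s x)
  ... | ε , g , x↦g = enlarge-normalised s′ g≢0 x∈ x-short x↦g
    where
    s′ = record
      { partialBasis = recoordinatise ε (partialBasis s) ; levels = levels s ; reduced = reduced s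
      ; short↦𝟘 = λ y∈ y-short → trans (cong ⟦ ε ⟧ (short↦𝟘 s y∈ y-short)) (𝟘-homo (⟦⟧-linear ε)) }
    g≢0 : g ≢ 0ℤ
    g≢0 refl = x↦≢0 (⟦⟧≡𝟘⇒≡𝟘 ε x↦g)

  find-short : ∀ {e k t} (s : Stage e k t) →
    (∃[ x ] Mem L x × Short (suc e) x × quotient s x ≢ 𝟘) ⊎
    (∀ {x} → Mem L x → Short (suc e) x → quotient s x ≡ 𝟘)
  find-short {e} s with Any.any? new? (box n (2 ^ suc e))
    where new? = λ x → (Lattice.β L x ≟ᵛ 𝟘) ×-dec VAll.all? (λ a → ∣ a ∣ ℕₚ.<? 2 ^ suc e) x ×-dec ¬? (quotient s x ≟ᵛ 𝟘)
  ... | yes found = let x , _ , new = find found in inj₁ (x , new)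
  ... | no none   = inj₂ λ {x} x∈ x-short → decidable-stable (quotient s x ≟ᵛ 𝟘) λ x↦≢0 →
    none (lose (∈-box⁺ (short⇒bounded (suc e) x-short)) (x∈ , x-short , x↦≢0))

  next-level : ∀ {e k} t → Stage e k t → ∃₂ (Stage (suc e))
  next-level t s with find-short s
  next-level t       s | inj₂ short↦𝟘′                    = _ , t , raise s short↦𝟘′
  next-level zero    s | inj₁ (x , _ , _ , x↦≢0)          = contradiction (dimension-0 refl _) x↦≢0
  next-level (suc t) s | inj₁ (x , x∈ , x-short , x↦≢0)   = next-level t (enlarge s x∈ x-short x↦≢0)

  stage : ∀ e → ∃₂ (Stage e)
  stage zero    = 0 , t₀ , initial
  stage (suc e) = let _ , t , s = stage e in next-level t s

record ReducedBasis {n t} (L : Lattice n t) (h : ℕ) : Set where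
  field
    {size}     : ℕ
    size≤      : size ≤ t
    basis      : Mat size n
    levels     : Vec ℕ size
    reduced    : Reduced h basis levels
    basis∈     : VAll.All (Mem L) basis
    short⇒span : ∀ {x} → Mem L x → Short h x → InSpan basis x
    full⇒span  : size ≡ t → ∀ {x} → Mem L x → InSpan basis x

reducedBasis : ∀ {n t} (L : Lattice n t) h → ReducedBasis L h
reducedBasis {t = t₀} L h with stage L h
... | k , t , s = record
  { size≤ = subst (k ≤_) k+t≡t₀ (ℕₚ.m≤m+n k t)
  ; basis = vectors ; levels = levels ; reduced = reduced ; basis∈ = vectors∈
  ; short⇒span = λ x∈ x-short → kernel⇒span x∈ (short↦𝟘 x∈ x-short)
  ; full⇒span = λ k≡t₀ {x} x∈ → kernel⇒span x∈ (dimension-0 (t≡0 k≡t₀) (quotient x)) }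
  where
  open Stage s
  t≡0 : k ≡ t₀ → t ≡ 0
  t≡0 k≡t₀ = ℕₚ.+-cancelˡ-≡ k t 0 (trans k+t≡t₀ (trans (sym k≡t₀) (sym (ℕₚ.+-identityʳ k))))

-- Counting matrices by means of reduced bases

^-distribʳ-* : ∀ m n k → (m * n) ^ k ≡ m ^ k * n ^ k
^-distribʳ-* m n zero    = refl
^-distribʳ-* m n (suc k) = trans (cong (m * n *_) (^-distribʳ-* m n k)) (ℕₚ.[m*n]*[o*p]≡[m*o]*[n*p] m n (m ^ k) (n ^ k))

basesBound : ∀ {k} → ℕ → Vec ℕ k → ℕ
basesBound         n []       = 1
basesBound {suc k} n (e ∷ es) = suc (2 * 2 ^ (e + suc k)) ^ n * basesBound n es

atmost-reduced-bases : ∀ {n k h} (es : Vec ℕ k) → AtMost (λ (bs : Mat k n) → Reduced h bs es) (basesBound n es)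
atmost-reduced-bases             []       = atmost-subsingleton λ { [] [] → refl }
atmost-reduced-bases {n} {suc k} (e ∷ es) =
  atmost-∷ _≟ᵛ_ (λ { (adjoin _ b≤ _ _) → b≤ }) (atmost-bounded n (2 ^ (e + suc k)))
  λ _ → atmost-⊆ (λ { (adjoin _ _ _ bs-reduced) → bs-reduced }) (atmost-reduced-bases es)

-- For h about log₂ H, the volume of dimension n is O(Hⁿ) and the factor polylog is a power of log H.
volume polylog : ℕ → ℕ → ℕ
volume n h  = (2 ^ (h + (n + 2))) ^ n
polylog n h = suc n * suc h ^ n

volume≢0 : ∀ n h → ℕ.NonZero (volume n h)
volume≢0 n h = ℕₚ.m^n≢0 (2 ^ (h + (n + 2))) n {{ℕₚ.m^n≢0 2 (h + (n + 2))}}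

polylog>0 : ∀ n h → 0 < polylog n h
polylog>0 n h = ℕₚ.*-mono-≤ {1} {suc n} (s≤s z≤n) (ℕₚ.m^n>0 (suc h) n)

suc[2*2^a]≤2^[a+2] : ∀ a → suc (2 * 2 ^ a) ≤ 2 ^ (a + 2)
suc[2*2^a]≤2^[a+2] a = begin
  suc (2 * 2 ^ a)        ≤⟨ ℕₚ.+-monoˡ-≤ (2 * 2 ^ a) (ℕₚ.m^n>0 2 a) ⟩
  2 ^ a + 2 * 2 ^ a      ≤⟨ ℕₚ.m≤n+m _ (2 ^ a) ⟩
  4 * 2 ^ a              ≡⟨ ℕₚ.*-comm 4 (2 ^ a) ⟩
  2 ^ a * 2 ^ 2          ≡⟨ ℕₚ.^-distribˡ-+-* 2 a 2 ⟨
  2 ^ (a + 2)            ∎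
  where open ℕₚ.≤-Reasoning

vectors×modulus≤volume : ∀ {n k e h} → e ≤ h → k ≤ n → suc (2 * 2 ^ (e + k)) ^ n * (2 ^ (h ∸ e)) ^ n ≤ volume n h
vectors×modulus≤volume {n} {k} {e} {h} e≤h k≤n = begin
  suc (2 * 2 ^ (e + k)) ^ n * ι ^ n     ≡⟨ ^-distribʳ-* (suc (2 * 2 ^ (e + k))) ι n ⟨
  (suc (2 * 2 ^ (e + k)) * ι) ^ n       ≤⟨ ℕₚ.^-monoˡ-≤ n (ℕₚ.*-monoˡ-≤ ι (suc[2*2^a]≤2^[a+2] (e + k))) ⟩
  (2 ^ (e + k + 2) * ι) ^ n             ≡⟨ cong (_^ n) (ℕₚ.^-distribˡ-+-* 2 (e + k + 2) (h ∸ e)) ⟨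
  (2 ^ (e + k + 2 + (h ∸ e))) ^ n       ≤⟨ ℕₚ.^-monoˡ-≤ n (ℕₚ.^-monoʳ-≤ 2 exponent) ⟩
  volume n h                            ∎
  where
  open ℕₚ.≤-Reasoning
  ι = 2 ^ (h ∸ e)
  regroup : ∀ e k d → e + k + 2 + d ≡ (d + e) + (k + 2)
  regroup = solve-∀ℕ
  exponent : e + k + 2 + (h ∸ e) ≤ h + (n + 2)
  exponent = begin
    e + k + 2 + (h ∸ e)         ≡⟨ regroup e k (h ∸ e) ⟩
    (h ∸ e + e) + (k + 2)       ≡⟨ cong (_+ (k + 2)) (ℕₚ.m∸n+n≡m e≤h) ⟩
    h + (k + 2)                 ≤⟨ ℕₚ.+-monoʳ-≤ h (ℕₚ.+-monoˡ-≤ 2 k≤n) ⟩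
    h + (n + 2)                 ∎

-- There are about 2^(n e) candidates for a basis vector of level e, and n rows with about 2^(h - e)
-- possible coordinates along it each, so that e cancels.
bases×points≤volume : ∀ {n k h} {es : Vec ℕ k} → VAll.All (_≤ h) es → k ≤ n →
  basesBound n es * ∏ (moduli h es) ^ n ≤ volume n h ^ k
bases×points≤volume {n} [] k≤n = ℕₚ.≤-reflexive (trans (ℕₚ.*-identityˡ (1 ^ n)) (ℕₚ.^-zeroˡ n))
bases×points≤volume {n} {suc k} {h} {e ∷ es} (e≤h ∷ es≤h) k<n = begin
  candidates * basesBound n es * (ι * ∏ (moduli h es)) ^ n
    ≡⟨ cong (candidates * basesBound n es *_) (^-distribʳ-* ι (∏ (moduli h es)) n) ⟩
  candidates * basesBound n es * (ι ^ n * ∏ (moduli h es) ^ n)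
    ≡⟨ ℕₚ.[m*n]*[o*p]≡[m*o]*[n*p] candidates (basesBound n es) (ι ^ n) (∏ (moduli h es) ^ n) ⟩
  candidates * ι ^ n * (basesBound n es * ∏ (moduli h es) ^ n)
    ≤⟨ ℕₚ.*-mono-≤ (vectors×modulus≤volume e≤h k<n) (bases×points≤volume es≤h (ℕₚ.<⇒≤ k<n)) ⟩
  volume n h * volume n h ^ k ∎
  where
  open ℕₚ.≤-Reasoning
  candidates = suc (2 * 2 ^ (e + suc k)) ^ n
  ι          = 2 ^ (h ∸ e)

module _ {X : Set} {P : X → Set} {n h r F : ℕ} (r≤n : r ≤ n) (BasisOf : X → ∀ {k} → Mat k n → Set)
  (basis : ∀ {x} → P x → ∃[ k ] k ≤ r × ∃₂ λ (bs : Mat k n) es → Reduced h bs es × BasisOf x bs)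
  (fibre : ∀ {k} {bs : Mat k n} {es} → Reduced h bs es → AtMost (λ x → P x × BasisOf x bs) (F * ∏ (moduli h es) ^ n))
  where

  private
    V : ℕ
    V = volume n h

    HasLevels : ∀ {k} → X → Vec ℕ k → Set
    HasLevels x es = P x × ∃[ bs ] Reduced h bs es × BasisOf x bs

    HasSize : X → ℕ → Set
    HasSize x k = ∃ λ (es : Vec ℕ k) → HasLevels x es

    atmost-fixed-levels : ∀ {k} {es : Vec ℕ k} → k ≤ r → VAll.All (_≤ h) es → AtMost (λ x → HasLevels x es) (F * V ^ r)
    atmost-fixed-levels {k} {es} k≤r es≤h = atmost-≤ (begin
        basesBound n es * (F * ∏ (moduli h es) ^ n)      ≡⟨ exchange (basesBound n es) F _ ⟩
        F * (basesBound n es * ∏ (moduli h es) ^ n)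
          ≤⟨ ℕₚ.*-monoʳ-≤ F (bases×points≤volume es≤h (ℕₚ.≤-trans k≤r r≤n)) ⟩
        F * V ^ k                                        ≤⟨ ℕₚ.*-monoʳ-≤ F (ℕₚ.^-monoʳ-≤ V {{volume≢0 n h}} k≤r) ⟩
        F * V ^ r                                        ∎)
      (atmost-fibration (λ x bs → P x × BasisOf x bs) _≟ᵐ_
        (λ { (p , bs , reduced , basisOf) → bs , reduced , p , basisOf })
        (atmost-reduced-bases es) fibre)
      where
      open ℕₚ.≤-Reasoning
      exchange : ∀ a b c → a * (b * c) ≡ b * (a * c)
      exchange = solve-∀ℕ

    atmost-fixed-size : ∀ {k} → k ≤ r → AtMost (λ x → HasSize x k) (suc h ^ r * (F * V ^ r))
    atmost-fixed-size {k} k≤r = atmost-≤ (ℕₚ.*-monoˡ-≤ (F * V ^ r) (ℕₚ.^-monoʳ-≤ (suc h) k≤r))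
      (atmost-fibration HasLevels (Vecₚ.≡-dec ℕₚ._≟_)
        (λ { (es , hasLevels@(_ , _ , reduced , _)) → es , VAll.map s≤s (levels≤ reduced) , hasLevels })
        (atmost-all k ℕₚ._≟_ (atmost-< (suc h)))
        (λ es≤h → atmost-fixed-levels k≤r (VAll.map s≤s⁻¹ es≤h)))

  atmost-by-reduced-bases : AtMost P (polylog n h * (F * V ^ r))
  atmost-by-reduced-bases = atmost-≤ (begin
      suc r * (suc h ^ r * (F * V ^ r))      ≡⟨ ℕₚ.*-assoc (suc r) (suc h ^ r) (F * V ^ r) ⟨
      suc r * suc h ^ r * (F * V ^ r)
        ≤⟨ ℕₚ.*-monoˡ-≤ (F * V ^ r) (ℕₚ.*-mono-≤ (s≤s r≤n) (ℕₚ.^-monoʳ-≤ (suc h) r≤n)) ⟩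
      polylog n h * (F * V ^ r)              ∎)
    (atmost-fibration HasSize ℕₚ._≟_
      (λ p → let k , k≤r , bs , es , reduced , basisOf = basis p in k , s≤s k≤r , es , p , bs , reduced , basisOf)
      (atmost-< (suc r)) (λ k≤r → atmost-fixed-size (s≤s⁻¹ k≤r)))
    where open ℕₚ.≤-Reasoning

Invertible : ∀ {n} → ℤ → Matrix n → Set
Invertible d A = ∃[ g ] Linear g × (∀ v → act A (g v) ≡ d ⊙ v) × (∀ v → g (act A v) ≡ d ⊙ v)

invertible⇒act-injective : ∀ {n d} (A : Matrix n) → d ≢ 0ℤ → Invertible d A → ∀ {x y} → act A x ≡ act A y → x ≡ y
invertible⇒act-injective A d≢0 (g , _ , _ , gA) {x} {y} Ax≡Ay =
  ⊙-cancelˡ d≢0 x y (trans (sym (gA x)) (trans (cong g Ax≡Ay) (gA y)))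

record HyperplaneBasis {k n} (bs : Mat k n) : Set where
  field
    normal complement : Vec ℤ n
    isPrimitive       : dot complement normal ≡ 1ℤ
    ⊥⇒span            : ∀ l → dot l normal ≡ 0ℤ → InSpan bs l

  dot-normal∣dot : ∀ {y} → act bs y ≡ 𝟘 → ∀ x → dot x normal ∣ℤ dot x y
  dot-normal∣dot {y} bs⊥y x = divides ∣ dot complement y ∣
    (trans (cong ∣_∣ x·y≡) (trans (ℤₚ.∣i*j∣≡∣i∣*∣j∣ s _) (ℕₚ.*-comm ∣ s ∣ _)))
    where
    open ≡-Reasoning
    s = dot x normal
    r = x ⊖ s ⊙ complement
    cancel : ∀ s → s ℤ.+ - 1ℤ ℤ.* (s ℤ.* 1ℤ) ≡ 0ℤ
    cancel = solve-∀
    r⊥normal : dot r normal ≡ 0ℤ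
    r⊥normal = begin
      dot r normal                                          ≡⟨ dot-⊕ˡ x _ normal ⟩
      s ℤ.+ dot (- 1ℤ ⊙ s ⊙ complement) normal
        ≡⟨ cong (λ t → s ℤ.+ t) (dot-⊙ˡ (- 1ℤ) (s ⊙ complement) normal) ⟩
      s ℤ.+ - 1ℤ ℤ.* dot (s ⊙ complement) normal
        ≡⟨ cong (λ t → s ℤ.+ - 1ℤ ℤ.* t) (dot-⊙ˡ s complement normal) ⟩
      s ℤ.+ - 1ℤ ℤ.* (s ℤ.* dot complement normal)          ≡⟨ cong (λ t → s ℤ.+ - 1ℤ ℤ.* (s ℤ.* t)) isPrimitive ⟩
      s ℤ.+ - 1ℤ ℤ.* (s ℤ.* 1ℤ)                             ≡⟨ cancel s ⟩
      0ℤ                                                    ∎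
    x·y≡ : dot x y ≡ s ℤ.* dot complement y
    x·y≡ = begin
      dot x y                                       ≡⟨ cong (λ t → dot t y) (⊕ₚ.//-rightDividesˡ (s ⊙ complement) x) ⟨
      dot (r ⊕ s ⊙ complement) y                    ≡⟨ dot-⊕ˡ r (s ⊙ complement) y ⟩
      dot r y ℤ.+ dot (s ⊙ complement) y
        ≡⟨ cong₂ ℤ._+_ (InSpan-⊥ y (⊥⇒span r r⊥normal) bs⊥y) (dot-⊙ˡ s complement y) ⟩
      0ℤ ℤ.+ s ℤ.* dot complement y                 ≡⟨ ℤₚ.+-identityˡ _ ⟩
      s ℤ.* dot complement y                        ∎

primitive-direction : ∀ {n} (y : Vec ℤ (suc n)) → ∃[ c ] ∃₂ λ p q → y ≡ c ⊙ p × dot q p ≡ 1ℤ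
primitive-direction {n} y with clear-tail y
... | e , c , ey≡c∷𝟘 = c , p , q , y≡cp , q·p≡1
  where
  open ≡-Reasoning
  e₁ = unit {suc n} zero
  p = ⟦ inverse e ⟧ e₁
  q = ⟦ inverse (contragredient e) ⟧ e₁
  y≡cp : y ≡ c ⊙ p
  y≡cp = begin
    y                                       ≡⟨ inverseˡ e y ⟨
    ⟦ inverse e ⟧ (⟦ e ⟧ y)                 ≡⟨ cong ⟦ inverse e ⟧ ey≡c∷𝟘 ⟩
    ⟦ inverse e ⟧ (c ∷ 𝟘)
      ≡⟨ cong ⟦ inverse e ⟧ (cong₂ _∷_ (sym (ℤₚ.*-identityʳ c)) (sym (⊙-zeroʳ c))) ⟩
    ⟦ inverse e ⟧ (c ⊙ e₁)                  ≡⟨ ⊙-homo (⟦⟧-linear (inverse e)) c e₁ ⟩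
    c ⊙ p                                   ∎
  q·p≡1 : dot q p ≡ 1ℤ
  q·p≡1 = begin
    dot q p                                           ≡⟨ dot-comm q p ⟩
    dot p q                                           ≡⟨ dot-contragredient e p q ⟨
    dot (⟦ e ⟧ p) (⟦ contragredient e ⟧ q)            ≡⟨ cong₂ dot (inverseʳ e e₁) (inverseʳ (contragredient e) e₁) ⟩
    dot e₁ e₁                                         ≡⟨ dot-unitˡ zero e₁ ⟩
    1ℤ                                                ∎

nullity-row : ∀ {n} {y : Vec ℤ (suc n)} → y ≢ 𝟘 → nullity (y ∷ []) ≡ n
nullity-row {n} {y} y≢0 = ℕₚ.suc-injective (trans (cong (_+ nullity (y ∷ [])) (sym rank≡1)) (rank+nullity (y ∷ [])))
  where
  rank≡1 : rank (y ∷ []) ≡ 1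
  rank≡1 = ℕₚ.≤-antisym (rank≤rows (y ∷ [])) (ℕₚ.n≢0⇒n>0 λ r≡0 → y≢0 (VAll.head (rank≡0⇒rows≡𝟘 (y ∷ []) r≡0)))

module Counting (h H : ℕ) (2H<2^h : 2 * H < 2 ^ h) where

  bounded⇒short-h : ∀ {n} {x : Vec ℤ n} → Bounded H x → Short h x
  bounded⇒short-h = bounded⇒short h (ℕₚ.≤-<-trans (ℕₚ.m≤n*m H 2) 2H<2^h)

  difference-short : ∀ {n} {x y : Vec ℤ n} → Bounded H x → Bounded H y → Short h (x ⊖ y)
  difference-short x≤H y≤H = bounded⇒short h 2H<2^h (bounded-⊖-same x≤H y≤H)

  atmost-span : ∀ {n k} {bs : Mat k n} {es} → Reduced h bs es →
    AtMost (λ x → Bounded H x × InSpan bs x) (∏ (moduli h es))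
  atmost-span reduced = atmost-reduced-coset reduced
    λ { (x≤H , x∈) (y≤H , y∈) → difference-short x≤H y≤H , InSpan-⊖ x∈ y∈ }

  atmost-rank : ∀ {n r} → r ≤ n → AtMost (λ (A : Matrix n) → BoundedMat H A × rank A ≡ r) (polylog n h * volume n h ^ r)
  atmost-rank {n} {r} r≤n = subst (λ N → AtMost _ (polylog n h * N)) (ℕₚ.*-identityˡ (volume n h ^ r))
    (atmost-by-reduced-bases {F = 1} r≤n (λ A bs → VAll.All (InSpan bs) A) basisOf points)
    where
    basisOf : ∀ {A : Matrix n} → BoundedMat H A × rank A ≡ r →
      ∃[ k ] k ≤ r × ∃₂ λ (bs : Mat k n) es → Reduced h bs es × VAll.All (InSpan bs) A
    basisOf {A} (A≤H , refl) = size , size≤ , basis , levels , reduced ,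
      all-map₂ (λ a≤H a∈ → short⇒span a∈ (bounded⇒short-h a≤H)) A≤H (rows∈ A)
      where open ReducedBasis (reducedBasis (rowLattice A) h)
    points : ∀ {k} {bs : Mat k n} {es} → Reduced h bs es →
      AtMost (λ A → (BoundedMat H A × rank A ≡ r) × VAll.All (InSpan bs) A) (1 * ∏ (moduli h es) ^ n)
    points reduced = subst (AtMost _) (sym (ℕₚ.*-identityˡ _))
      (atmost-⊆ (λ { ((A≤H , _) , A∈) → VAll.zip (A≤H , A∈) }) (atmost-all n _≟ᵛ_ (atmost-span reduced)))

  module _ {n : ℕ} {d : ℤ} (d≢0 : d ≢ 0ℤ) where

    private
      HyperplaneOf : Matrix (suc n) → ∀ {k} → Mat k (suc n) → Set
      HyperplaneOf A bs =
        HyperplaneBasis bs × (∃[ y ] act bs y ≡ 𝟘 × dot (head A) y ≡ d) × VAll.All (InSpan bs) (tail A)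

      module _ {x : Vec ℤ (suc n)} {A : Mat n (suc n)}
        (A≤H : BoundedMat H A) (xA-invertible : Invertible d (x ∷ A)) where
        private
          g = proj₁ xA-invertible
          y = g (unit zero)

        xA·y≡ : act (x ∷ A) y ≡ d ⊙ unit zero
        xA·y≡ = proj₁ (proj₂ (proj₂ xA-invertible)) (unit zero)

        x·y≡d : dot x y ≡ d
        x·y≡d = trans (cong head xA·y≡) (ℤₚ.*-identityʳ d)

        A⊥y : VAll.All (λ a → dot a y ≡ 0ℤ) A
        A⊥y = act≡𝟘⇒rows⊥ A (trans (cong tail xA·y≡) (⊙-zeroʳ d))

        y≢0 : y ≢ 𝟘
        y≢0 y≡0 = d≢0 (trans (sym x·y≡d) (trans (cong (dot x) y≡0) (dot-𝟘ʳ x)))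

        ⊥y⇒∈ : ∀ l → dot l y ≡ 0ℤ → Mem (kernel (y ∷ [])) l
        ⊥y⇒∈ l l⊥y = kernel⁺ (y ∷ []) (cong (_∷ []) (trans (dot-comm y l) l⊥y))

        open ReducedBasis (reducedBasis (kernel (y ∷ [])) h)

        basis⊥y : act basis y ≡ 𝟘
        basis⊥y = rows⊥⇒act≡𝟘 (VAll.map (λ {b} b∈ → trans (dot-comm b y) (cong head (kernel⁻ (y ∷ []) b∈))) basis∈)

        rows∈span : VAll.All (InSpan basis) A
        rows∈span = all-map₂ (λ a≤H a⊥y → short⇒span (⊥y⇒∈ _ a⊥y) (bounded⇒short-h a≤H)) A≤H A⊥y

        -- Otherwise x and the basis would have a common orthogonal vector, which the invertible matrix kills.
        n≤size : n ≤ size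
        n≤size = ℕₚ.≮⇒≥ λ size<n → let u , u≢0 , ⊥u = kernel-nontrivial (s≤s size<n) (x ∷ basis) in
          u≢0 (invertible⇒act-injective (x ∷ A) d≢0 xA-invertible {u} {𝟘} (trans
            (cong₂ _∷_ (cong head ⊥u) (rows⊥⇒act≡𝟘 (VAll.map (λ a∈ → InSpan-⊥ u a∈ (cong tail ⊥u)) rows∈span)))
            (sym (𝟘-homo (act-linear (x ∷ A))))))

        hyperplaneBasis : HyperplaneBasis basis
        hyperplaneBasis with primitive-direction y
        ... | c , p , q , y≡cp , q·p≡1 = record
          { normal = p ; complement = q ; isPrimitive = q·p≡1
          ; ⊥⇒span = λ l l⊥p → full⇒span size≡ (⊥y⇒∈ l (begin
              dot l y              ≡⟨ cong (dot l) y≡cp ⟩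
              dot l (c ⊙ p)        ≡⟨ dot-⊙ʳ c l p ⟩
              c ℤ.* dot l p        ≡⟨ cong (c ℤ.*_) l⊥p ⟩
              c ℤ.* 0ℤ             ≡⟨ ℤₚ.*-zeroʳ c ⟩
              0ℤ                   ∎)) }
          where
          open ≡-Reasoning
          size≡ : size ≡ nullity (y ∷ [])
          size≡ = ℕₚ.≤-antisym size≤ (subst (_≤ size) (sym (nullity-row y≢0)) n≤size)

        reducedHyperplaneBasis : ∃[ k ] k ≤ n × ∃₂ λ (bs : Mat k (suc n)) es → Reduced h bs es × HyperplaneOf (x ∷ A) bs
        reducedHyperplaneBasis = size , subst (size ≤_) (nullity-row y≢0) size≤ , basis , levels , reduced ,
          hyperplaneBasis , (y , basis⊥y , x·y≡d) , rows∈span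

      module _ {k : ℕ} {bs : Mat k (suc n)} {es : Vec ℕ k} (reduced : Reduced h bs es) (hyperplane : HyperplaneBasis bs)
        {F : ℕ} (divisors : AtMost (_∣ℤ d) F) where
        open HyperplaneBasis hyperplane

        atmost-first-row : AtMost (λ x → Bounded H x × dot x normal ∣ℤ d) (F * ∏ (moduli h es))
        atmost-first-row = atmost-fibres ℤ._≟_ (λ x → dot x normal) proj₂ divisors λ _ → atmost-reduced-coset reduced
          λ { {x} {y} ((x≤H , _) , refl) ((y≤H , _) , y·p≡x·p) → difference-short x≤H y≤H , ⊥⇒span (x ⊖ y) (begin
              dot (x ⊖ y) normal                                  ≡⟨ dot-⊕ˡ x _ normal ⟩
              dot x normal ℤ.+ dot (- 1ℤ ⊙ y) normal
                ≡⟨ cong (λ t → dot x normal ℤ.+ t) (dot-⊙ˡ (- 1ℤ) y normal) ⟩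
              dot x normal ℤ.+ - 1ℤ ℤ.* dot y normal              ≡⟨ cong (λ t → dot x normal ℤ.+ - 1ℤ ℤ.* t) y·p≡x·p ⟩
              dot x normal ℤ.+ - 1ℤ ℤ.* dot x normal              ≡⟨ cancel (dot x normal) ⟩
              0ℤ                                                  ∎) }
          where
          open ≡-Reasoning
          cancel : ∀ a → a ℤ.+ - 1ℤ ℤ.* a ≡ 0ℤ
          cancel = solve-∀

        atmost-with-hyperplane : AtMost (λ A → BoundedMat H A × HyperplaneOf A bs) (F * ∏ (moduli h es) ^ suc n)
        atmost-with-hyperplane = subst (AtMost _) (ℕₚ.*-assoc F (∏ (moduli h es)) (∏ (moduli h es) ^ n))
          (atmost-∷ _≟ᵛ_
            (λ { {x} (x≤H ∷ _ , _ , (y , bs⊥y , x·y≡d) , _) →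
              x≤H , subst (dot x normal ∣ℤ_) x·y≡d (dot-normal∣dot bs⊥y x) })
            atmost-first-row
            λ _ → atmost-⊆ (λ { (_ ∷ A≤H , _ , _ , A∈) → VAll.zip (A≤H , A∈) })
              (atmost-all n _≟ᵛ_ (atmost-span reduced)))

    atmost-invertible : ∀ {F} → AtMost (_∣ℤ d) F →
      AtMost (λ (A : Matrix (suc n)) → BoundedMat H A × Invertible d A) (polylog (suc n) h * (F * volume (suc n) h ^ n))
    atmost-invertible {F} divisors = atmost-by-reduced-bases {F = F} (ℕₚ.n≤1+n n) HyperplaneOf
      (λ { {x ∷ _} (_ ∷ A≤H , xA-invertible) → reducedHyperplaneBasis {x} A≤H xA-invertible })
      λ reduced → atmost-inhabited λ { _ (_ , hyperplane , _) → atmost-⊆ (λ { ((A≤H , _) , hyp) → A≤H , hyp })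
        (atmost-with-hyperplane reduced hyperplane divisors) }

-- Counting factorisations

Factorisation : ∀ {n m} → ℕ → (Vec ℤ n → Vec ℤ n) → Vec (Matrix n) m → Set
Factorisation H C As = VAll.All (BoundedMat H) As × compose As ≗ C

atmost-one-factor : ∀ {n} H (C : Vec ℤ n → Vec ℤ n) → AtMost (Factorisation {m = 1} H C) 1
atmost-one-factor H C = atmost-subsingleton
  λ { {_ ∷ []} {_ ∷ []} (_ , A≗C) (_ , B≗C) → cong (_∷ []) (act-injective λ v → trans (A≗C v) (sym (B≗C v))) }

atmost-cancel-left : ∀ {n m H N} {C : Vec ℤ n → Vec ℤ n} (A : Matrix n) → (∀ {x y} → act A x ≡ act A y → x ≡ y) →
  (∀ {C′} → Linear C′ → act A ∘ C′ ≗ C → AtMost (Factorisation {m = m} H C′) N) →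
  AtMost (λ As → Factorisation {m = suc m} H C (A ∷ As)) N
atmost-cancel-left A A-injective atmost-cofactors = atmost-inhabited λ { As₀ (_ , AAs₀≗C) →
  atmost-⊆ (λ { (_ ∷ As≤H , AAs≗C) → As≤H , λ v → A-injective (trans (AAs≗C v) (sym (AAs₀≗C v))) })
    (atmost-cofactors (compose-linear As₀) AAs₀≗C) }

-- In a factorisation of C every factor A is invertible up to d, since A C′ = C implies A (C′ E) = d.
atmost-nonsingular-products : ∀ {n d H M} → d ≢ 0ℤ → AtMost (λ (A : Matrix n) → BoundedMat H A × Invertible d A) M →
  ∀ m {C E : Vec ℤ n → Vec ℤ n} → Linear E → (∀ v → C (E v) ≡ d ⊙ v) → AtMost (Factorisation {m = suc m} H C) (M ^ m)
atmost-nonsingular-products         d≢0 atmost-invertible zero    {C}     E-linear CE≗d = atmost-one-factor _ C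
atmost-nonsingular-products {n} {d} d≢0 atmost-invertible (suc m) {C} {E} E-linear CE≗d = atmost-∷ _≟ᵐ_
  (λ { {A} {As} (A≤H ∷ _ , AAs≗C) → A≤H , compose As ∘ E , ∘-linear (compose-linear As) E-linear ,
       right-inverse A AAs≗C , left-inverse A (compose-linear As) AAs≗C }) atmost-invertible
  λ { {A} (_ , A-invertible) → atmost-cancel-left A (invertible⇒act-injective A d≢0 A-invertible) λ C′-linear AC′≗C →
      atmost-nonsingular-products d≢0 atmost-invertible m (∘-linear E-linear (act-linear A))
        (left-inverse A C′-linear AC′≗C) }
  where
  right-inverse : ∀ A {C′} → act A ∘ C′ ≗ C → ∀ v → act A (C′ (E v)) ≡ d ⊙ v
  right-inverse A AC′≗C v = trans (AC′≗C (E v)) (CE≗d v)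
  left-inverse : ∀ A {C′} → Linear C′ → act A ∘ C′ ≗ C → ∀ v → C′ (E (act A v)) ≡ d ⊙ v
  left-inverse A C′-linear AC′≗C =
    right⇒left-inverse d≢0 (act-linear A) (∘-linear C′-linear E-linear) (right-inverse A AC′≗C)

atmost-preimages : ∀ {m n} (A : Mat m n) T u → AtMost (λ y → Bounded T y × act A y ≡ u) (suc (2 * T) ^ nullity A)
atmost-preimages A T u = atmost-lattice-coset (kernel A) proj₁ λ { {x} {y} (_ , Ax≡u) (_ , Ay≡u) →
  kernel⁺ A (trans (⊖-homo (act-linear A) x y) (trans (cong₂ _⊖_ Ax≡u Ay≡u) (⊕-inverseʳ u))) }

columns : ∀ {m n} → Mat m n → Mat n m
columns B = tabulate (act B ∘ unit)

columns-injective : ∀ {m n} {B B′ : Mat m n} → columns B ≡ columns B′ → B ≡ B′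
columns-injective {B = B} {B′} e = act-injective λ v → begin
  act B v                ≡⟨ linear≗comb (act-linear B) v ⟩
  comb v (columns B)     ≡⟨ cong (comb v) e ⟩
  comb v (columns B′)    ≡⟨ linear≗comb (act-linear B′) v ⟨
  act B′ v               ∎
  where open ≡-Reasoning

bounded-column : ∀ {m n H} {B : Mat m n} → BoundedMat H B → ∀ j → Bounded H (act B (unit j))
bounded-column B≤H j =
  VAllₚ.map⁺ (VAll.map (λ {b} b≤H → subst (λ t → ∣ t ∣ ≤ _) (sym (dot-unitʳ b j)) (VAllₚ.lookup⁺ b≤H j)) B≤H)

atmost-right-factors : ∀ {n} (A : Matrix n) H (C : Vec ℤ n → Vec ℤ n) →
  AtMost (λ (B : Matrix n) → BoundedMat H B × act A ∘ act B ≗ C) ((suc (2 * H) ^ nullity A) ^ n)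
atmost-right-factors A H C = atmost-injection columns
  (λ { {B} (B≤H , AB≗C) j → subst (λ t → Bounded H t × act A t ≡ C (unit j))
    (sym (Vecₚ.lookup∘tabulate (act B ∘ unit) j)) (bounded-column B≤H j , AB≗C (unit j)) })
  (λ _ _ → columns-injective)
  (atmost-lookup _≟ᵛ_ λ j → atmost-preimages A H (C (unit j)))

total-rank total-nullity : ∀ {n m} → Vec (Matrix n) m → ℕ
total-rank    As = Vec.sum (Vec.map rank As)
total-nullity As = Vec.sum (Vec.map nullity As)

total-rank+total-nullity : ∀ {n m} (As : Vec (Matrix n) m) → total-rank As + total-nullity As ≡ m * n
total-rank+total-nullity []       = refl
total-rank+total-nullity (A ∷ As) = trans (interchange (rank A) (total-rank As) (nullity A) (total-nullity As))
  (cong₂ _+_ (rank+nullity A) (total-rank+total-nullity As))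
  where
  interchange : ∀ a b c d → a + b + (c + d) ≡ a + c + (b + d)
  interchange = solve-∀ℕ

atmost-preimages-compose : ∀ {n m} (As : Vec (Matrix n) m) → ∃[ c ] ∀ T u →
  AtMost (λ y → Bounded T y × compose As y ≡ u) (c * suc (2 * T) ^ total-nullity As)
atmost-preimages-compose []       = 1 , λ T u → atmost-subsingleton λ { (_ , refl) (_ , refl) → refl }
atmost-preimages-compose (A ∷ As) =
  let c , preimages = atmost-preimages-compose As
      S , As≤S = linear⇒bounded (compose-linear As)
  in suc S ^ nullity A * c , λ T u → atmost-≤ (bound c S T)
       (atmost-fibres _≟ᵛ_ (compose As) (λ { (y≤T , AAsy≡u) → As≤S y≤T , AAsy≡u }) (atmost-preimages A (T * S) u)
         λ {w} _ → atmost-⊆ (λ { ((y≤T , _) , Asy≡w) → y≤T , Asy≡w }) (preimages T w))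
  where
  open ℕₚ.≤-Reasoning
  s  = nullity A
  Σs = total-nullity As
  suc[2TS]≤ : ∀ S T → suc (2 * (T * S)) ≤ suc S * suc (2 * T)
  suc[2TS]≤ S T = ℕₚ.≤-trans (ℕₚ.m≤m+n _ (S + 2 * T)) (ℕₚ.≤-reflexive (expand T S))
    where
    expand : ∀ T S → suc (2 * (T * S)) + (S + 2 * T) ≡ suc S * suc (2 * T)
    expand = solve-∀ℕ
  bound : ∀ c S T → suc (2 * (T * S)) ^ s * (c * suc (2 * T) ^ Σs) ≤ suc S ^ s * c * suc (2 * T) ^ (s + Σs)
  bound c S T = begin
    suc (2 * (T * S)) ^ s * (c * Y ^ Σs)         ≤⟨ ℕₚ.*-monoˡ-≤ (c * Y ^ Σs) (ℕₚ.^-monoˡ-≤ s (suc[2TS]≤ S T)) ⟩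
    (suc S * Y) ^ s * (c * Y ^ Σs)               ≡⟨ cong (_* (c * Y ^ Σs)) (^-distribʳ-* (suc S) Y s) ⟩
    suc S ^ s * Y ^ s * (c * Y ^ Σs)             ≡⟨ ℕₚ.[m*n]*[o*p]≡[m*o]*[n*p] (suc S ^ s) (Y ^ s) c (Y ^ Σs) ⟩
    suc S ^ s * c * (Y ^ s * Y ^ Σs)             ≡⟨ cong (suc S ^ s * c *_) (ℕₚ.^-distribˡ-+-* Y s Σs) ⟨
    suc S ^ s * c * Y ^ (s + Σs)                 ∎
    where Y = suc (2 * T)

-- Sylvester's rank inequality, by comparing the number of vectors in a large box with the number of
-- solutions of A₁(⋯(Aₘ y)) = 0 in it.
sylvester : ∀ {n m} (As : Vec (Matrix n) m) → (∀ v → compose As v ≡ 𝟘) → n ≤ total-nullity As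
sylvester {n} As As≗0 = ℕₚ.≮⇒≥ λ Σs<n →
  let c , preimages = atmost-preimages-compose As
      Y = suc (2 * c) ; Σs = total-nullity As
      Yⁿ≤cY^Σs = subst (_≤ c * Y ^ Σs) (length-box n c)
        (preimages c 𝟘 (box n c) (box-unique n c) (All.tabulate λ y∈ → ∈-box⁻ y∈ , As≗0 _))
      Y≤c = ℕₚ.*-cancelʳ-≤ Y c (Y ^ Σs) {{ℕₚ.m^n≢0 Y Σs}} (ℕₚ.≤-trans (ℕₚ.^-monoʳ-≤ Y Σs<n) Yⁿ≤cY^Σs)
  in ℕₚ.<⇒≱ (s≤s (ℕₚ.m≤n*m c 2)) Y≤c

rank≤n : ∀ {n} (A : Matrix n) → rank A ≤ n
rank≤n A = subst (rank A ≤_) (rank+nullity A) (ℕₚ.m≤m+n (rank A) (nullity A))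

nullity≡n∸rank : ∀ {n} (A : Matrix n) → nullity A ≡ n ∸ rank A
nullity≡n∸rank A = trans (sym (ℕₚ.m+n∸m≡n (rank A) (nullity A))) (cong (_∸ rank A) (rank+nullity A))

rank<n : ∀ {n} (A : Matrix n) → nullity A ≢ 0 → rank A < n
rank<n {n} A s≢0 = begin-strict
  rank A                  ≡⟨ ℕₚ.+-identityʳ (rank A) ⟨
  rank A + 0              <⟨ ℕₚ.+-monoʳ-< (rank A) (ℕₚ.n≢0⇒n>0 s≢0) ⟩
  rank A + nullity A      ≡⟨ rank+nullity A ⟩
  n                       ∎
  where open ℕₚ.≤-Reasoning

Nonzero : ∀ {n} → (Vec ℤ n → Vec ℤ n) → Set
Nonzero C = ¬ (∀ v → C v ≡ 𝟘)

nonzero⇒nullity<n : ∀ {n} (A : Matrix (suc n)) {f C : Vec ℤ (suc n) → Vec ℤ (suc n)} → Nonzero C → act A ∘ f ≗ C →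
  nullity A ≤ n
nonzero⇒nullity<n {n} A {f} C≢0 Af≗C = s≤s⁻¹ (subst (nullity A <_) (rank+nullity A) (ℕₚ.+-monoˡ-< (nullity A) rank>0))
  where
  rank>0 : 0 < rank A
  rank>0 = ℕₚ.n≢0⇒n>0 λ r≡0 → C≢0 λ v → trans (sym (Af≗C v))
    (rows⊥⇒act≡𝟘 (VAll.map (λ { refl → dot-𝟘ˡ (f v) }) (rank≡0⇒rows≡𝟘 A r≡0)))

regular+singular-count : ∀ k m V L → let n = suc (suc k) in
  V ^ n * (suc m * (n * L) * V ^ (n * m + k)) + n * (L * V ^ suc k) * ((V ^ n) ^ m * V ^ suc k)
    ≡ suc (suc m) * (n * L) * V ^ (n * suc m + k)
regular+singular-count k m V L = begin
  V ^ n * (suc m * W * V ^ (n * m + k)) + n * (L * V ^ suc k) * ((V ^ n) ^ m * V ^ suc k)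
    ≡⟨ cong (λ t → V ^ n * (suc m * W * V ^ (n * m + k)) + n * (L * V ^ suc k) * (t * V ^ suc k)) (ℕₚ.^-*-assoc V n m) ⟩
  V ^ n * (suc m * W * V ^ (n * m + k)) + n * (L * V ^ suc k) * (V ^ (n * m) * V ^ suc k)
    ≡⟨ regroup m n L (V ^ n) (V ^ (n * m + k)) (V ^ suc k) (V ^ (n * m)) ⟩
  suc m * W * (V ^ n * V ^ (n * m + k)) + W * (V ^ suc k * (V ^ (n * m) * V ^ suc k))
    ≡⟨ cong₂ (λ s t → suc m * W * s + W * t) regular-exponent singular-exponent ⟩
  suc m * W * V ^ (n * suc m + k) + W * V ^ (n * suc m + k)
    ≡⟨ collect m W (V ^ (n * suc m + k)) ⟩
  suc (suc m) * W * V ^ (n * suc m + k) ∎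
  where
  open ≡-Reasoning
  n = suc (suc k)
  W = n * L
  regroup : ∀ m n l a b c d →
    a * (suc m * (n * l) * b) + n * (l * c) * (d * c) ≡ suc m * (n * l) * (a * b) + n * l * (c * (d * c))
  regroup = solve-∀ℕ
  collect : ∀ m w x → suc m * w * x + w * x ≡ suc (suc m) * w * x
  collect = solve-∀ℕ
  regular-exponent : V ^ n * V ^ (n * m + k) ≡ V ^ (n * suc m + k)
  regular-exponent = trans (sym (ℕₚ.^-distribˡ-+-* V n (n * m + k))) (cong (V ^_) (exponent n m k))
    where
    exponent : ∀ n m k → n + (n * m + k) ≡ n * suc m + k
    exponent = solve-∀ℕ
  singular-exponent : V ^ suc k * (V ^ (n * m) * V ^ suc k) ≡ V ^ (n * suc m + k)
  singular-exponent = begin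
    V ^ suc k * (V ^ (n * m) * V ^ suc k)     ≡⟨ cong (V ^ suc k *_) (ℕₚ.^-distribˡ-+-* V (n * m) (suc k)) ⟨
    V ^ suc k * V ^ (n * m + suc k)           ≡⟨ ℕₚ.^-distribˡ-+-* V (suc k) (n * m + suc k) ⟨
    V ^ (suc k + (n * m + suc k))             ≡⟨ cong (V ^_) (exponent k m) ⟩
    V ^ (n * suc m + k)                       ∎
    where
    exponent : ∀ k m → suc k + ((2 + k) * m + suc k) ≡ (2 + k) * suc m + k
    exponent = solve-∀ℕ

module CountingProducts (h H : ℕ) (2H<2^h : 2 * H < 2 ^ h) where

  open Counting h H 2H<2^h public

  box≤volume : ∀ n s → (suc (2 * H) ^ s) ^ n ≤ volume n h ^ s
  box≤volume n s = begin
    (suc (2 * H) ^ s) ^ n               ≡⟨ ℕₚ.^-*-assoc (suc (2 * H)) s n ⟩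
    suc (2 * H) ^ (s * n)
      ≤⟨ ℕₚ.^-monoˡ-≤ (s * n) (ℕₚ.≤-trans 2H<2^h (ℕₚ.^-monoʳ-≤ 2 (ℕₚ.m≤m+n h (n + 2)))) ⟩
    (2 ^ (h + (n + 2))) ^ (s * n)       ≡⟨ cong ((2 ^ (h + (n + 2))) ^_) (ℕₚ.*-comm s n) ⟩
    (2 ^ (h + (n + 2))) ^ (n * s)       ≡⟨ ℕₚ.^-*-assoc (2 ^ (h + (n + 2))) n s ⟨
    volume n h ^ s                      ∎
    where open ℕₚ.≤-Reasoning

  atmost-matrices : ∀ {n} → AtMost (λ (A : Matrix n) → BoundedMat H A) (volume n h ^ n)
  atmost-matrices {n} = atmost-≤ (box≤volume n n) (atmost-all n _≟ᵛ_ (atmost-bounded n H))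

  atmost-last-factor : ∀ {n} (A : Matrix n) (C : Vec ℤ n → Vec ℤ n) →
    AtMost (λ (Bs : Vec (Matrix n) 1) → VAll.All (BoundedMat H) Bs × act A ∘ compose Bs ≗ C) (volume n h ^ nullity A)
  atmost-last-factor {n} A C = atmost-≤ (box≤volume n (nullity A)) (atmost-injection head
    (λ { {_ ∷ []} (B≤H ∷ [] , AB≗C) → B≤H , AB≗C }) (λ { {_ ∷ []} {_ ∷ []} _ _ refl → refl })
    (atmost-right-factors A H C))

  atmost-two-factors : ∀ {n} (C : Vec ℤ n → Vec ℤ n) →
    AtMost (Factorisation {m = 2} H C) (suc n * (polylog n h * volume n h ^ n))
  atmost-two-factors {n} C = atmost-values (rank ∘ head) (λ { {A ∷ _} _ → s≤s (rank≤n A) }) λ { {r} (s≤s r≤n) →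
    atmost-≤ (ℕₚ.≤-reflexive (total r≤n))
      (atmost-∷ _≟ᵐ_ (λ { ((A≤H ∷ _ , _) , r≡) → A≤H , r≡ }) (atmost-rank r≤n)
        λ { {A} (_ , refl) → atmost-≤ (ℕₚ.≤-reflexive (cong (V ^_) (nullity≡n∸rank A)))
          (atmost-⊆ (λ { ((_ ∷ Bs≤H , ABs≗C) , _) → Bs≤H , ABs≗C }) (atmost-last-factor A C)) }) }
    where
    open ≡-Reasoning
    V = volume n h
    total : ∀ {r} → r ≤ n → polylog n h * V ^ r * V ^ (n ∸ r) ≡ polylog n h * V ^ n
    total {r} r≤n = begin
      polylog n h * V ^ r * V ^ (n ∸ r)       ≡⟨ ℕₚ.*-assoc (polylog n h) (V ^ r) (V ^ (n ∸ r)) ⟩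
      polylog n h * (V ^ r * V ^ (n ∸ r))     ≡⟨ cong (polylog n h *_) (ℕₚ.^-distribˡ-+-* V r (n ∸ r)) ⟨
      polylog n h * V ^ (r + (n ∸ r))         ≡⟨ cong (λ t → polylog n h * V ^ t) (ℕₚ.m+[n∸m]≡n r≤n) ⟩
      polylog n h * V ^ n                     ∎

  atmost-ranks : ∀ {n m} {ρ : Vec ℕ m} → VAll.All (_≤ n) ρ →
    AtMost (λ (As : Vec (Matrix n) m) → VAll.All (BoundedMat H) As × Vec.map rank As ≡ ρ)
      (polylog n h ^ m * volume n h ^ Vec.sum ρ)
  atmost-ranks [] = atmost-subsingleton λ { {[]} {[]} _ _ → refl }
  atmost-ranks {n} {suc m} {r ∷ ρ} (r≤n ∷ ρ≤n) = subst (AtMost _) (begin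
      W * V ^ r * (W ^ m * V ^ Vec.sum ρ)         ≡⟨ ℕₚ.[m*n]*[o*p]≡[m*o]*[n*p] W (V ^ r) (W ^ m) (V ^ Vec.sum ρ) ⟩
      W * W ^ m * (V ^ r * V ^ Vec.sum ρ)         ≡⟨ cong (W * W ^ m *_) (ℕₚ.^-distribˡ-+-* V r (Vec.sum ρ)) ⟨
      W * W ^ m * V ^ (r + Vec.sum ρ)             ∎)
    (atmost-∷ _≟ᵐ_ (λ { (A≤H ∷ _ , ranks≡) → A≤H , cong head ranks≡ }) (atmost-rank r≤n)
      λ _ → atmost-⊆ (λ { (_ ∷ As≤H , ranks≡) → As≤H , cong tail ranks≡ }) (atmost-ranks ρ≤n))
    where
    open ≡-Reasoning
    V = volume n h
    W = polylog n h

  atmost-zero-products : ∀ {n} m →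
    AtMost (Factorisation {n} {suc m} H (λ _ → 𝟘)) (suc n ^ suc m * (polylog n h ^ suc m * volume n h ^ (m * n)))
  atmost-zero-products {n} m = atmost-fibration
    (λ As ρ → VAll.All (BoundedMat H) As × Vec.map rank As ≡ ρ)
    {Q = λ ρ → VAll.All (_< suc n) ρ × Vec.sum ρ ≤ m * n} (Vecₚ.≡-dec ℕₚ._≟_)
    (λ { {As} (As≤H , As≗0) → Vec.map rank As ,
      (VAllₚ.map⁺ (VAll.universal (λ A → s≤s (rank≤n A)) As) , total-rank≤ As As≗0) , As≤H , refl })
    (atmost-⊆ proj₁ (atmost-all (suc m) ℕₚ._≟_ (atmost-< (suc n))))
    (λ { (ρ≤n , sum≤) → atmost-≤ (ℕₚ.*-monoʳ-≤ (polylog n h ^ suc m) (ℕₚ.^-monoʳ-≤ (volume n h) {{volume≢0 n h}} sum≤))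
      (atmost-ranks (VAll.map s≤s⁻¹ ρ≤n)) })
    where
    open ℕₚ.≤-Reasoning
    total-rank≤ : (As : Vec (Matrix n) (suc m)) → (∀ v → compose As v ≡ 𝟘) → total-rank As ≤ m * n
    total-rank≤ As As≗0 = ℕₚ.+-cancelˡ-≤ n _ _ (begin
      n + total-rank As                       ≡⟨ ℕₚ.+-comm n _ ⟩
      total-rank As + n                       ≤⟨ ℕₚ.+-monoʳ-≤ (total-rank As) (sylvester As As≗0) ⟩
      total-rank As + total-nullity As        ≡⟨ total-rank+total-nullity As ⟩
      suc m * n                               ∎)

  atmost-singular : ∀ {n} → AtMost (λ (A : Matrix (suc n)) → BoundedMat H A × nullity A ≢ 0)
    (suc n * (polylog (suc n) h * volume (suc n) h ^ n))
  atmost-singular {n} = atmost-values rank (λ { {A} (_ , s≢0) → rank<n A s≢0 }) λ { {r} r<n →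
    atmost-≤ (ℕₚ.*-monoʳ-≤ (polylog (suc n) h) (ℕₚ.^-monoʳ-≤ (volume (suc n) h) {{volume≢0 (suc n) h}} (s≤s⁻¹ r<n)))
      (atmost-⊆ (λ { ((A≤H , _) , r≡) → A≤H , r≡ }) (atmost-rank (ℕₚ.<⇒≤ r<n))) }

  -- The last factor B is restricted by L B = C with L ≠ 0.
  atmost-nonzero-products-after : ∀ {n} m (L : Matrix (suc n)) {C} → Nonzero C → let V = volume (suc n) h in
    AtMost (λ (As : Vec (Matrix (suc n)) (suc m)) → VAll.All (BoundedMat H) As × act L ∘ compose As ≗ C)
      ((V ^ suc n) ^ m * V ^ n)
  atmost-nonzero-products-after {n} zero L {C} C≢0 = atmost-inhabited λ { _ (_ , LAs≗C) →
    atmost-≤ (ℕₚ.≤-trans (ℕₚ.^-monoʳ-≤ (volume (suc n) h) {{volume≢0 (suc n) h}} (nonzero⇒nullity<n L C≢0 LAs≗C))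
        (ℕₚ.≤-reflexive (sym (ℕₚ.*-identityˡ _))))
      (atmost-last-factor L C) }
  atmost-nonzero-products-after {n} (suc m) L {C} C≢0 =
    subst (AtMost _) (sym (ℕₚ.*-assoc (V ^ suc n) ((V ^ suc n) ^ m) (V ^ n)))
    (atmost-∷ _≟ᵐ_ (λ { (A≤H ∷ _ , _) → A≤H }) atmost-matrices λ { {A} _ →
      atmost-⊆ (λ { {As} (_ ∷ As≤H , LAAs≗C) → As≤H , λ v → trans (act-⊗ L A (compose As v)) (LAAs≗C v) })
        (atmost-nonzero-products-after m (L ⊗ A) C≢0) })
    where V = volume (suc n) h

  atmost-nonzero-products : ∀ {k} m {C} → Nonzero C → let n = suc (suc k) in
    AtMost (Factorisation {n} {suc m} H C) (suc m * (n * polylog n h) * volume n h ^ (n * m + k))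
  atmost-nonzero-products {k} zero {C} C≢0 =
    atmost-≤ (ℕₚ.*-mono-≤ coefficient>0 (ℕₚ.m^n>0 (volume n h) {{volume≢0 n h}} (n * 0 + k)))
    (atmost-one-factor H C)
    where
    n = suc (suc k)
    coefficient>0 : 0 < 1 * (n * polylog n h)
    coefficient>0 = ℕₚ.*-mono-≤ {1} {1} ℕₚ.≤-refl (ℕₚ.*-mono-≤ {1} {n} (s≤s z≤n) (polylog>0 n h))
  atmost-nonzero-products {k} (suc m) {C} C≢0 = subst (AtMost _) (regular+singular-count k m V (polylog n h))
    (atmost-⊆ (λ { {A ∷ _} fact → split A fact }) (atmost-⊎ regular singular))
    where
    n = suc (suc k)
    V = volume n h
    Regular Singular : Vec (Matrix n) (suc (suc m)) → Set
    Regular  As = Factorisation H C As × nullity (head As) ≡ 0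
    Singular As = Factorisation H C As × nullity (head As) ≢ 0
    split : ∀ A {As} → Factorisation H C (A ∷ As) → Regular (A ∷ As) ⊎ Singular (A ∷ As)
    split A fact with nullity A ℕₚ.≟ 0
    ... | yes s≡0 = inj₁ (fact , s≡0)
    ... | no s≢0  = inj₂ (fact , s≢0)
    regular : AtMost Regular (V ^ n * (suc m * (n * polylog n h) * V ^ (n * m + k)))
    regular = atmost-∷ {P = λ A → BoundedMat H A × nullity A ≡ 0} _≟ᵐ_
      (λ { ((A≤H ∷ _ , _) , s≡0) → A≤H , s≡0 }) (atmost-⊆ proj₁ atmost-matrices)
      λ { {A} (_ , s≡0) → atmost-⊆ proj₁ (atmost-cancel-left A (nullity≡0⇒act-injective A s≡0) λ _ AC′≗C →
        atmost-nonzero-products m λ C′≗0 → C≢0 λ v →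
          trans (sym (AC′≗C v)) (trans (cong (act A) (C′≗0 v)) (𝟘-homo (act-linear A)))) }
    singular : AtMost Singular (n * (polylog n h * V ^ suc k) * ((V ^ n) ^ m * V ^ suc k))
    singular = atmost-∷ _≟ᵐ_ (λ { ((A≤H ∷ _ , _) , s≢0) → A≤H , s≢0 }) atmost-singular
      λ { {A} _ → atmost-⊆ (λ { ((_ ∷ As≤H , AAs≗C) , _) → As≤H , AAs≗C }) (atmost-nonzero-products-after m A C≢0) }

-- Determinants

sumFin≡sum : ∀ n (f : Vector ℤ n) → sumFin n f ≡ sum f
sumFin≡sum zero    f = refl
sumFin≡sum (suc n) f = cong (λ t → f zero ℤ.+ t) (sumFin≡sum n (f ∘ suc))

sum-zero : ∀ {n} {f : Vector ℤ n} → (∀ i → f i ≡ 0ℤ) → sum f ≡ 0ℤ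
sum-zero {n} f≗0 = trans (sum-cong-≗ f≗0) (sum-replicate-zero n)

alt : ∀ {k} → Fin k → ℤ
alt zero    = 1ℤ
alt (suc j) = - alt j

alt-unique : (s : ∀ k → Fin k → ℤ) → (∀ k → s (suc k) zero ≡ 1ℤ) → (∀ k j → s (suc k) (suc j) ≡ - s k j) →
  ∀ k j → s k j ≡ alt j
alt-unique s s₀ s₊ (suc k) zero    = s₀ k
alt-unique s s₀ s₊ (suc k) (suc j) = trans (s₊ k j) (cong -_ (alt-unique s s₀ s₊ k j))

deleteColumn : ∀ {m n} → Fin (suc n) → Vector (Vector ℤ (suc n)) m → Vector (Vector ℤ n) m
deleteColumn j R i k = R i (punchIn j k)

laplace-term : ∀ {n} → Vector ℤ (suc n) → Vector (Vector ℤ (suc n)) n → Fin (suc n) → ℤ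
laplace-term {n} a R j = alt j ℤ.* (a j ℤ.* detF n (deleteColumn j R))

laplace : ∀ {n} → Vector ℤ (suc n) → Vector (Vector ℤ (suc n)) n → ℤ
laplace a R = sum (laplace-term a R)

-- The sign function of detF is local to its definition, so it cannot be named here; unification recovers
-- it. `tail-terms` reads off the summands of detF, and in `tail-terms≗laplace-terms` abstracting the
-- dimension and the function ∣_∣ leaves the local sign as a solvable meta-variable, which becomes `detF-sign`.
tail-terms : ∀ n A → Σ[ f ∈ Vector ℤ n ]
  detF (suc n) A ≡ 1ℤ ℤ.* (A zero zero ℤ.* detF n (deleteColumn zero (A ∘ suc))) ℤ.+ sumFin n f
tail-terms n A = _ , refl

sign-product-cong : (s : ∀ k → Fin k → ℤ) → (∀ k → s (suc k) zero ≡ 1ℤ) → (∀ k j → s (suc k) (suc j) ≡ - s k j) →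
  ∀ k j (f : ℤ → ℕ) y {t} → t ≡ alt j →
  (ℤ.sign (s k j) Sign.* ℤ.sign y) ℤ.◃ f (s k j) * f y ≡ (ℤ.sign t Sign.* ℤ.sign y) ℤ.◃ f t * f y
sign-product-cong s s₀ s₊ k j f y t≡alt =
  cong (λ t → (ℤ.sign t Sign.* ℤ.sign y) ℤ.◃ f t * f y) (trans (alt-unique s s₀ s₊ k j) (sym t≡alt))

mutual
  detF-sign : ∀ w → Vector (Vector ℤ (suc w)) (suc w) → ∀ k → Fin k → ℤ
  detF-sign = _

  tail-terms≗laplace-terms : ∀ n A → proj₁ (tail-terms n A) ≗ laplace-term (A zero) (A ∘ suc) ∘ suc
  tail-terms≗laplace-terms (suc n) A zero    = refl
  tail-terms≗laplace-terms (suc n) A (suc k)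
    with A zero (suc (suc k)) | detF (suc n) (deleteColumn (suc (suc k)) (A ∘ suc))
  ... | a | d with suc n | ∣_∣
  ... | w | f = sign-product-cong (detF-sign w A) (λ _ → refl) (λ _ _ → refl) _ k f _ (ℤₚ.neg-involutive (alt k))

det-laplace : ∀ n A → detF (suc n) A ≡ laplace (A zero) (A ∘ suc)
det-laplace n A = begin
  detF (suc n) A                                         ≡⟨ proj₂ (tail-terms n A) ⟩
  term₀ ℤ.+ sumFin n (proj₁ (tail-terms n A))
    ≡⟨ cong (λ t → term₀ ℤ.+ t) (sumFin≡sum n (proj₁ (tail-terms n A))) ⟩
  term₀ ℤ.+ sum (proj₁ (tail-terms n A))
    ≡⟨ cong (λ t → term₀ ℤ.+ t) (sum-cong-≗ (tail-terms≗laplace-terms n A)) ⟩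
  laplace (A zero) (A ∘ suc)                             ∎
  where
  open ≡-Reasoning
  term₀ = laplace-term (A zero) (A ∘ suc) zero

det-cong : ∀ n {A B : Vector (Vector ℤ n) n} → (∀ i j → A i j ≡ B i j) → detF n A ≡ detF n B
det-cong zero    A≗B = refl
det-cong (suc n) {A} {B} A≗B = begin
  detF (suc n) A                  ≡⟨ det-laplace n A ⟩
  laplace (A zero) (A ∘ suc)
    ≡⟨ sum-cong-≗ (λ j → cong₂ (λ a d → alt j ℤ.* (a ℤ.* d)) (A≗B zero j) (minor≡ j)) ⟩
  laplace (B zero) (B ∘ suc)      ≡⟨ det-laplace n B ⟨
  detF (suc n) B                  ∎
  where
  open ≡-Reasoning
  minor≡ : ∀ j → detF n (deleteColumn j (A ∘ suc)) ≡ detF n (deleteColumn j (B ∘ suc))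
  minor≡ j = det-cong n λ i k → A≗B (suc i) (punchIn j k)

laplace-cong : ∀ {n} a {R S : Vector (Vector ℤ (suc n)) n} → (∀ i j → R i j ≡ S i j) → laplace a R ≡ laplace a S
laplace-cong {n} a R≗S = sum-cong-≗ λ j → cong (λ d → alt j ℤ.* (a j ℤ.* d)) (det-cong n λ i k → R≗S i (punchIn j k))

-- (j′ , k′) names the same ordered pair of distinct columns as (j , k), in the opposite order.
Swapped : ∀ {m} → Fin (suc m) → Fin m → Fin (suc m) → Fin m → Set
Swapped j k j′ k′ = punchIn j k ≡ j′ × punchIn j′ k′ ≡ j

swapped-alt : ∀ {m} {j : Fin (suc m)} {k j′ k′} → Swapped j k j′ k′ → alt j ℤ.* alt k ℤ.+ alt j′ ℤ.* alt k′ ≡ 0ℤ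
swapped-alt {j = zero}  {k}     {_} {zero}   (refl , _)    = cancel (alt k)
  where
  cancel : ∀ a → 1ℤ ℤ.* a ℤ.+ (- a) ℤ.* 1ℤ ≡ 0ℤ
  cancel = solve-∀
swapped-alt {j = suc j} {zero}  {_} {k′}     (refl , refl) = cancel (alt k′)
  where
  cancel : ∀ a → (- a) ℤ.* 1ℤ ℤ.+ 1ℤ ℤ.* a ≡ 0ℤ
  cancel = solve-∀
swapped-alt {j = suc j} {suc k} {_} {suc k′} (refl , q)    =
  trans (signs-cancel (alt j) (alt k) (alt (punchIn j k)) (alt k′)) (swapped-alt (refl , Finₚ.suc-injective q))
  where
  signs-cancel : ∀ a b c d → (- a) ℤ.* (- b) ℤ.+ (- c) ℤ.* (- d) ≡ a ℤ.* b ℤ.+ c ℤ.* d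
  signs-cancel = solve-∀

swapped-punchIn : ∀ {m} {j : Fin (suc (suc m))} {k j′ k′} → Swapped j k j′ k′ →
  ∀ l → punchIn j (punchIn k l) ≡ punchIn j′ (punchIn k′ l)
swapped-punchIn {j = zero}  {k}     {_} {zero}   (refl , _)    l       = refl
swapped-punchIn {j = suc j} {zero}  {_} {k′}     (refl , refl) l       = refl
swapped-punchIn {j = suc j} {suc k} {_} {suc k′} (refl , q)    zero    = refl
swapped-punchIn {j = suc j} {suc k} {_} {suc k′} (refl , q)    (suc l) =
  cong suc (swapped-punchIn (refl , Finₚ.suc-injective q) l)

sum-swapped : ∀ m (f g : Vector (Vector ℤ m) (suc m)) → (∀ {j k j′ k′} → Swapped j k j′ k′ → f j k ℤ.+ g j′ k′ ≡ 0ℤ) →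
  sum (sum ∘ f) ℤ.+ sum (sum ∘ g) ≡ 0ℤ
sum-swapped zero    f g cancel = refl
sum-swapped (suc m) f g cancel = begin
  row f ℤ.+ sum (λ j → f (suc j) zero ℤ.+ sum (rest f j)) ℤ.+ (row g ℤ.+ sum (λ j → g (suc j) zero ℤ.+ sum (rest g j)))
    ≡⟨ cong₂ (λ s t → row f ℤ.+ s ℤ.+ (row g ℤ.+ t)) (split f) (split g) ⟩
  row f ℤ.+ (column f ℤ.+ sum (sum ∘ rest f)) ℤ.+ (row g ℤ.+ (column g ℤ.+ sum (sum ∘ rest g)))
    ≡⟨ regroup (row f) (column f) (sum (sum ∘ rest f)) (row g) (column g) (sum (sum ∘ rest g)) ⟩
  (row f ℤ.+ column g) ℤ.+ (column f ℤ.+ row g) ℤ.+ (sum (sum ∘ rest f) ℤ.+ sum (sum ∘ rest g))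
    ≡⟨ cong₂ ℤ._+_ (cong₂ ℤ._+_
        (sum-cancel (f zero) (λ j → g (suc j) zero) λ k → cancel (refl , refl))
        (sum-cancel (λ j → f (suc j) zero) (g zero) λ k → cancel (refl , refl)))
        (sum-swapped m (rest f) (rest g) λ { (p , q) → cancel (cong suc p , cong suc q) }) ⟩
  0ℤ ∎
  where
  open ≡-Reasoning
  row column : Vector (Vector ℤ (suc m)) (suc (suc m)) → ℤ
  row f    = sum (f zero)
  column f = sum (λ j → f (suc j) zero)
  rest : Vector (Vector ℤ (suc m)) (suc (suc m)) → Vector (Vector ℤ m) (suc m)
  rest f j k = f (suc j) (suc k)
  split : ∀ f → sum (λ j → f (suc j) zero ℤ.+ sum (rest f j)) ≡ column f ℤ.+ sum (sum ∘ rest f)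
  split f = ∑-distrib-+ (λ j → f (suc j) zero) (sum ∘ rest f)
  sum-cancel : (u v : Vector ℤ (suc m)) → (∀ k → u k ℤ.+ v k ≡ 0ℤ) → sum u ℤ.+ sum v ≡ 0ℤ
  sum-cancel u v u+v≗0 = trans (sym (∑-distrib-+ u v)) (sum-zero u+v≗0)
  regroup : ∀ a b c d e f → a ℤ.+ (b ℤ.+ c) ℤ.+ (d ℤ.+ (e ℤ.+ f)) ≡ (a ℤ.+ e) ℤ.+ (b ℤ.+ d) ℤ.+ (c ℤ.+ f)
  regroup = solve-∀

double-term : ∀ {n} (a b : Vector ℤ (suc (suc n))) → Vector (Vector ℤ (suc (suc n))) n →
  Vector (Vector ℤ (suc n)) (suc (suc n))
double-term {n} a b S j k = alt j ℤ.* alt k ℤ.* (a j ℤ.* b (punchIn j k) ℤ.* detF n (deleteColumn k (deleteColumn j S)))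

laplace-double : ∀ {n} (a b : Vector ℤ (suc (suc n))) (S : Vector (Vector ℤ (suc (suc n))) n) →
  laplace a (b ▹ S) ≡ sum (sum ∘ double-term a b S)
laplace-double {n} a b S = sum-cong-≗ λ j → let b′ = b ∘ punchIn j ; S′ = deleteColumn j S in begin
  alt j ℤ.* (a j ℤ.* detF (suc n) (deleteColumn j (b ▹ S)))
    ≡⟨ cong (λ t → alt j ℤ.* (a j ℤ.* t)) (det-laplace n (deleteColumn j (b ▹ S))) ⟩
  alt j ℤ.* (a j ℤ.* laplace b′ S′)                               ≡⟨ ℤₚ.*-assoc (alt j) (a j) (laplace b′ S′) ⟨
  alt j ℤ.* a j ℤ.* laplace b′ S′
    ≡⟨ *-distribˡ-sum (alt j ℤ.* a j) (laplace-term b′ S′) ⟩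
  sum (λ k → alt j ℤ.* a j ℤ.* laplace-term b′ S′ k)
    ≡⟨ sum-cong-≗ (λ k → regroup (alt j) (a j) (alt k) (b′ k) (detF n (deleteColumn k S′))) ⟩
  sum (double-term a b S j)                                       ∎
  where
  open ≡-Reasoning
  regroup : ∀ p q r s t → p ℤ.* q ℤ.* (r ℤ.* (s ℤ.* t)) ≡ p ℤ.* r ℤ.* (q ℤ.* s ℤ.* t)
  regroup = solve-∀

laplace-swap : ∀ {n} (a b : Vector ℤ (suc (suc n))) (S : Vector (Vector ℤ (suc (suc n))) n) →
  laplace a (b ▹ S) ℤ.+ laplace b (a ▹ S) ≡ 0ℤ
laplace-swap {n} a b S = trans (cong₂ ℤ._+_ (laplace-double a b S) (laplace-double b a S))
  (sum-swapped (suc n) (double-term a b S) (double-term b a S) cancel)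
  where
  open ≡-Reasoning
  factor : ∀ s t p q r → s ℤ.* (p ℤ.* q ℤ.* r) ℤ.+ t ℤ.* (q ℤ.* p ℤ.* r) ≡ (s ℤ.+ t) ℤ.* (p ℤ.* q ℤ.* r)
  factor = solve-∀
  cancel : ∀ {j k j′ k′} → Swapped j k j′ k′ → double-term a b S j k ℤ.+ double-term b a S j′ k′ ≡ 0ℤ
  cancel {j} {k} {j′} {k′} swapped@(refl , q) = begin
    double-term a b S j k ℤ.+ s′ ℤ.* (b j′ ℤ.* a (punchIn j′ k′) ℤ.* detF n (deleteColumn k′ (deleteColumn j′ S)))
      ≡⟨ cong₂ (λ u v → double-term a b S j k ℤ.+ s′ ℤ.* (b j′ ℤ.* a u ℤ.* v)) q minor≡ ⟩
    s ℤ.* (a j ℤ.* b j′ ℤ.* M) ℤ.+ s′ ℤ.* (b j′ ℤ.* a j ℤ.* M)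
      ≡⟨ factor s s′ (a j) (b j′) M ⟩
    (s ℤ.+ s′) ℤ.* (a j ℤ.* b j′ ℤ.* M)
      ≡⟨ cong (ℤ._* (a j ℤ.* b j′ ℤ.* M)) (swapped-alt swapped) ⟩
    0ℤ ∎
    where
    s = alt j ℤ.* alt k
    s′ = alt j′ ℤ.* alt k′
    M = detF n (deleteColumn k (deleteColumn j S))
    minor≡ : detF n (deleteColumn k′ (deleteColumn j′ S)) ≡ M
    minor≡ = det-cong n λ i l → cong (S i) (sym (swapped-punchIn swapped l))

▹-η : ∀ {n m} (R : Vector (Vector ℤ m) (suc n)) i j → R i j ≡ (R zero ▹ R ∘ suc) i j
▹-η R zero    j = refl
▹-η R (suc i) j = refl

laplace-transpose : ∀ {n} a (R : Vector (Vector ℤ (suc (suc n))) (suc n)) →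
  laplace a R ≡ - laplace (R zero) (a ▹ R ∘ suc)
laplace-transpose a R = trans (laplace-cong a (▹-η R)) (begin
  laplace a (R zero ▹ R ∘ suc)           ≡⟨ ℤₚ.neg-involutive _ ⟨
  - - laplace a (R zero ▹ R ∘ suc)
    ≡⟨ cong -_ (inverseʳ-unique _ (laplace (R zero) (a ▹ R ∘ suc)) (laplace-swap a (R zero) (R ∘ suc))) ⟨
  - laplace (R zero) (a ▹ R ∘ suc)       ∎)
  where
  open ≡-Reasoning
  open AbelianGroupₚ ℤₚ.+-0-abelianGroup using (inverseʳ-unique)

laplace-repeated : ∀ n (R : Vector (Vector ℤ (suc n)) n) i → laplace (R i) R ≡ 0ℤ
laplace-repeated (suc n) R zero = x+x≡0⇒x≡0 (laplace (R zero) R)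
  (trans (cong (λ t → t ℤ.+ t) (laplace-cong (R zero) (▹-η R))) (laplace-swap (R zero) (R zero) (R ∘ suc)))
  where
  x+x≡0⇒x≡0 : ∀ x → x ℤ.+ x ≡ 0ℤ → x ≡ 0ℤ
  x+x≡0⇒x≡0 (+ zero) _ = refl
laplace-repeated (suc n) R (suc i) = trans (laplace-transpose (R (suc i)) R) (cong -_ (sum-zero term≡0))
  where
  open ≡-Reasoning
  S : Vector (Vector ℤ (suc (suc n))) n
  S = R ∘ suc
  minor≡0 : ∀ j → detF (suc n) (deleteColumn j (S i ▹ S)) ≡ 0ℤ
  minor≡0 j = trans (det-laplace n (deleteColumn j (S i ▹ S))) (laplace-repeated n (deleteColumn j S) i)
  term≡0 : ∀ j → laplace-term (R zero) (S i ▹ S) j ≡ 0ℤ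
  term≡0 j = begin
    alt j ℤ.* (R zero j ℤ.* detF (suc n) (deleteColumn j (S i ▹ S)))
      ≡⟨ cong (λ t → alt j ℤ.* (R zero j ℤ.* t)) (minor≡0 j) ⟩
    alt j ℤ.* (R zero j ℤ.* 0ℤ)                                          ≡⟨ cong (alt j ℤ.*_) (ℤₚ.*-zeroʳ (R zero j)) ⟩
    alt j ℤ.* 0ℤ                                                         ≡⟨ ℤₚ.*-zeroʳ (alt j) ⟩
    0ℤ                                                                   ∎

laplace-row : ∀ n A (k : Fin (suc n)) → alt k ℤ.* laplace (A k) (A ∘ punchIn k) ≡ detF (suc n) A
laplace-row n       A zero    = trans (ℤₚ.*-identityˡ _) (sym (det-laplace n A))
laplace-row (suc n) A (suc k) = begin
  - alt k ℤ.* laplace (A (suc k)) (A ∘ punchIn (suc k))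
    ≡⟨ cong (- alt k ℤ.*_) (laplace-transpose (A (suc k)) (A ∘ punchIn (suc k))) ⟩
  - alt k ℤ.* - laplace (A zero) B
    ≡⟨ signs-cancel (alt k) (laplace (A zero) B) ⟩
  alt k ℤ.* laplace (A zero) B
    ≡⟨ *-distribˡ-sum (alt k) (laplace-term (A zero) B) ⟩
  sum (λ j → alt k ℤ.* laplace-term (A zero) B j)
    ≡⟨ sum-cong-≗ term≡ ⟩
  laplace (A zero) (A ∘ suc)
    ≡⟨ det-laplace (suc n) A ⟨
  detF (suc (suc n)) A ∎
  where
  open ≡-Reasoning
  B : Vector (Vector ℤ (suc (suc n))) (suc n)
  B = A (suc k) ▹ A ∘ suc ∘ punchIn k
  signs-cancel : ∀ a b → (- a) ℤ.* (- b) ≡ a ℤ.* b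
  signs-cancel = solve-∀
  exchange : ∀ a b c d → a ℤ.* (b ℤ.* (c ℤ.* d)) ≡ b ℤ.* (c ℤ.* (a ℤ.* d))
  exchange = solve-∀
  minor : ∀ j → alt k ℤ.* detF (suc n) (deleteColumn j B) ≡ detF (suc n) (deleteColumn j (A ∘ suc))
  minor j = trans (cong (alt k ℤ.*_) (det-laplace n (deleteColumn j B))) (laplace-row n (deleteColumn j (A ∘ suc)) k)
  term≡ : ∀ j → alt k ℤ.* laplace-term (A zero) B j ≡ laplace-term (A zero) (A ∘ suc) j
  term≡ j = trans (exchange (alt k) (alt j) (A zero j) (detF (suc n) (deleteColumn j B)))
    (cong (λ t → alt j ℤ.* (A zero j ℤ.* t)) (minor j))

dot≡sum : ∀ {n} (x y : Vec ℤ n) → dot x y ≡ sum (λ j → lookup x j ℤ.* lookup y j)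
dot≡sum []      []      = refl
dot≡sum (a ∷ x) (b ∷ y) = cong (λ t → a ℤ.* b ℤ.+ t) (dot≡sum x y)

cofactor : ∀ {n} → Matrix (suc n) → Fin (suc n) → Fin (suc n) → ℤ
cofactor {n} C k j = alt k ℤ.* (alt j ℤ.* detF n (deleteColumn j (entry C ∘ punchIn k)))

-- The transpose of the usual adjugate: its rows are the rows of cofactors.
cofactorMatrix : ∀ {n} → Matrix n → Matrix n
cofactorMatrix {zero}  C = []
cofactorMatrix {suc n} C = tabulate λ k → tabulate (cofactor C k)

entry-cofactorMatrix : ∀ {n} (C : Matrix (suc n)) k j → entry (cofactorMatrix C) k j ≡ cofactor C k j
entry-cofactorMatrix C k j = trans (cong (λ r → lookup r j) (Vecₚ.lookup∘tabulate (λ k → tabulate (cofactor C k)) k))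
  (Vecₚ.lookup∘tabulate (cofactor C k) j)

dot-cofactors : ∀ {n} (C : Matrix (suc n)) k i →
  dot (lookup (cofactorMatrix C) k) (lookup C i) ≡ alt k ℤ.* laplace (entry C i) (entry C ∘ punchIn k)
dot-cofactors {n} C k i = begin
  dot (lookup (cofactorMatrix C) k) (lookup C i)              ≡⟨ dot≡sum (lookup (cofactorMatrix C) k) (lookup C i) ⟩
  sum (λ j → entry (cofactorMatrix C) k j ℤ.* entry C i j)    ≡⟨ sum-cong-≗ term≡ ⟩
  sum (λ j → alt k ℤ.* laplace-term (entry C i) R j)          ≡⟨ *-distribˡ-sum (alt k) (laplace-term (entry C i) R) ⟨
  alt k ℤ.* laplace (entry C i) R                             ∎
  where
  open ≡-Reasoning
  R = entry C ∘ punchIn k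
  exchange : ∀ a b c d → a ℤ.* (b ℤ.* c) ℤ.* d ≡ a ℤ.* (b ℤ.* (d ℤ.* c))
  exchange = solve-∀
  term≡ : ∀ j → entry (cofactorMatrix C) k j ℤ.* entry C i j ≡ alt k ℤ.* laplace-term (entry C i) R j
  term≡ j = trans (cong (ℤ._* entry C i j) (entry-cofactorMatrix C k j))
    (exchange (alt k) (alt j) (detF n (deleteColumn j R)) (entry C i j))

cofactors-orthogonality : ∀ {n} (C : Matrix n) k i →
  dot (lookup (cofactorMatrix C) k) (lookup C i) ≡ det C ℤ.* lookup (unit i) k
cofactors-orthogonality {suc n} C k i with k Fin.≟ i
... | yes refl = begin
  dot (lookup (cofactorMatrix C) k) (lookup C k)           ≡⟨ dot-cofactors C k k ⟩
  alt k ℤ.* laplace (entry C k) (entry C ∘ punchIn k)      ≡⟨ laplace-row n (entry C) k ⟩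
  det C                                                    ≡⟨ ℤₚ.*-identityʳ (det C) ⟨
  det C ℤ.* 1ℤ                                             ≡⟨ cong (det C ℤ.*_) (lookup-unit-≡ k) ⟨
  det C ℤ.* lookup (unit k) k                              ∎
  where open ≡-Reasoning
... | no k≢i = begin
  dot (lookup (cofactorMatrix C) k) (lookup C i)           ≡⟨ dot-cofactors C k i ⟩
  alt k ℤ.* laplace (entry C i) R
    ≡⟨ cong (λ t → alt k ℤ.* laplace (entry C t) R) (Finₚ.punchIn-punchOut k≢i) ⟨
  alt k ℤ.* laplace (R (punchOut k≢i)) R                   ≡⟨ cong (alt k ℤ.*_) (laplace-repeated n R (punchOut k≢i)) ⟩
  alt k ℤ.* 0ℤ                                             ≡⟨ ℤₚ.*-zeroʳ (alt k) ⟩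
  0ℤ                                                       ≡⟨ ℤₚ.*-zeroʳ (det C) ⟨
  det C ℤ.* 0ℤ                                             ≡⟨ cong (det C ℤ.*_) (lookup-unit-≢ k≢i) ⟨
  det C ℤ.* lookup (unit i) k                              ∎
  where
  open ≡-Reasoning
  R = entry C ∘ punchIn k

act-cofactors : ∀ {n} (C : Matrix n) v → act C (comb v (cofactorMatrix C)) ≡ det C ⊙ v
act-cofactors C v = lookup-ext _ _ λ i → begin
  lookup (act C (comb v G)) i           ≡⟨ lookup-act C (comb v G) i ⟩
  dot (lookup C i) (comb v G)           ≡⟨ dot-comm (lookup C i) (comb v G) ⟩
  dot (comb v G) (lookup C i)           ≡⟨ dot-comb v G (lookup C i) ⟩
  dot v (act G (lookup C i))            ≡⟨ cong (dot v) (act-G-row i) ⟩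
  dot v (det C ⊙ unit i)                ≡⟨ dot-⊙ʳ (det C) v (unit i) ⟩
  det C ℤ.* dot v (unit i)              ≡⟨ cong (det C ℤ.*_) (dot-unitʳ v i) ⟩
  det C ℤ.* lookup v i                  ≡⟨ Vecₚ.lookup-map i (det C ℤ.*_) v ⟨
  lookup (det C ⊙ v) i                  ∎
  where
  open ≡-Reasoning
  G = cofactorMatrix C
  act-G-row : ∀ i → act G (lookup C i) ≡ det C ⊙ unit i
  act-G-row i = lookup-ext _ _ λ k → begin
    lookup (act G (lookup C i)) k      ≡⟨ lookup-act G (lookup C i) k ⟩
    dot (lookup G k) (lookup C i)      ≡⟨ cofactors-orthogonality C k i ⟩
    det C ℤ.* lookup (unit i) k        ≡⟨ Vecₚ.lookup-map k (det C ℤ.*_) (unit i) ⟨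
    lookup (det C ⊙ unit i) k          ∎

∣alt∣≡1 : ∀ {k} (j : Fin k) → ∣ alt j ∣ ≡ 1
∣alt∣≡1 zero    = refl
∣alt∣≡1 (suc j) = trans (ℤₚ.∣-i∣≡∣i∣ (alt j)) (∣alt∣≡1 j)

∣sum∣≤ : ∀ {n M} (f : Vector ℤ n) → (∀ i → ∣ f i ∣ ≤ M) → ∣ sum f ∣ ≤ n * M
∣sum∣≤ {zero}  f f≤M = z≤n
∣sum∣≤ {suc n} f f≤M =
  ℕₚ.≤-trans (ℤₚ.∣i+j∣≤∣i∣+∣j∣ (f zero) (sum (f ∘ suc))) (ℕₚ.+-mono-≤ (f≤M zero) (∣sum∣≤ (f ∘ suc) (f≤M ∘ suc)))

∣detF∣≤ : ∀ n {M} (A : Vector (Vector ℤ n) n) → (∀ i j → ∣ A i j ∣ ≤ M) → ∣ detF n A ∣ ≤ n ! * M ^ n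
∣detF∣≤ zero    A A≤M = ℕₚ.≤-refl
∣detF∣≤ (suc n) {M} A A≤M = begin
  ∣ detF (suc n) A ∣                    ≡⟨ cong ∣_∣ (det-laplace n A) ⟩
  ∣ laplace (A zero) (A ∘ suc) ∣        ≤⟨ ∣sum∣≤ (laplace-term (A zero) (A ∘ suc)) term≤ ⟩
  suc n * (M * (n ! * M ^ n))           ≡⟨ regroup (suc n) M (n !) (M ^ n) ⟩
  suc n ! * M ^ suc n                   ∎
  where
  open ℕₚ.≤-Reasoning
  regroup : ∀ s m f p → s * (m * (f * p)) ≡ s * f * (m * p)
  regroup = solve-∀ℕ
  term≤ : ∀ j → ∣ laplace-term (A zero) (A ∘ suc) j ∣ ≤ M * (n ! * M ^ n)
  term≤ j = begin
    ∣ alt j ℤ.* (A zero j ℤ.* d) ∣      ≡⟨ ℤₚ.∣i*j∣≡∣i∣*∣j∣ (alt j) (A zero j ℤ.* d) ⟩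
    ∣ alt j ∣ * ∣ A zero j ℤ.* d ∣      ≡⟨ cong₂ _*_ (∣alt∣≡1 j) (ℤₚ.∣i*j∣≡∣i∣*∣j∣ (A zero j) d) ⟩
    1 * (∣ A zero j ∣ * ∣ d ∣)          ≡⟨ ℕₚ.*-identityˡ (∣ A zero j ∣ * ∣ d ∣) ⟩
    ∣ A zero j ∣ * ∣ d ∣
      ≤⟨ ℕₚ.*-mono-≤ (A≤M zero j) (∣detF∣≤ n (deleteColumn j (A ∘ suc)) λ i k → A≤M (suc i) (punchIn j k)) ⟩
    M * (n ! * M ^ n)                   ∎
    where d = detF n (deleteColumn j (A ∘ suc))

-- The divisor bound

1+n≤2^n : ∀ n → suc n ≤ 2 ^ n
1+n≤2^n zero    = ℕₚ.≤-refl
1+n≤2^n (suc n) = ℕₚ.+-mono-≤ (ℕₚ.m^n>0 2 n) (ℕₚ.≤-trans (1+n≤2^n n) (ℕₚ.≤-reflexive (sym (ℕₚ.+-identityʳ (2 ^ n)))))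

-- With b = ⌊a / q⌋ one has 1 + a ≤ q (1 + b) ≤ q 2ᵇ.
power≤exponential : ∀ q a → suc a ^ q ≤ q ^ q * 2 ^ a
power≤exponential zero      a = ℕₚ.≤-trans (ℕₚ.m^n>0 2 a) (ℕₚ.≤-reflexive (sym (ℕₚ.+-identityʳ (2 ^ a))))
power≤exponential q@(suc _) a = begin
  suc a ^ q                     ≤⟨ ℕₚ.^-monoˡ-≤ q 1+a≤q*2^b ⟩
  (q * 2 ^ b) ^ q               ≡⟨ ^-distribʳ-* q (2 ^ b) q ⟩
  q ^ q * (2 ^ b) ^ q           ≡⟨ cong (q ^ q *_) (ℕₚ.^-*-assoc 2 b q) ⟩
  q ^ q * 2 ^ (b * q)           ≤⟨ ℕₚ.*-monoʳ-≤ (q ^ q) (ℕₚ.^-monoʳ-≤ 2 (m/n*n≤m a q)) ⟩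
  q ^ q * 2 ^ a                 ∎
  where
  open ℕₚ.≤-Reasoning
  b = a / q
  1+a≤q*2^b : suc a ≤ q * 2 ^ b
  1+a≤q*2^b = begin
    suc a                     ≡⟨ cong suc (m≡m%n+[m/n]*n a q) ⟩
    suc (a % q + b * q)       ≤⟨ ℕₚ.+-monoˡ-≤ (b * q) (m%n<n a q) ⟩
    suc b * q                 ≤⟨ ℕₚ.*-monoˡ-≤ q (1+n≤2^n b) ⟩
    2 ^ b * q                 ≡⟨ ℕₚ.*-comm (2 ^ b) q ⟩
    q * 2 ^ b                 ∎

q^q>0 : ∀ q → 0 < q ^ q
q^q>0 zero    = s≤s z≤n
q^q>0 (suc q) = ℕₚ.m^n>0 (suc q) (suc q)

prime-divisor-split : ∀ {p t D} → Prime p → t ∣ℕ p * D → t ∣ℕ D ⊎ ∃[ t₁ ] t ≡ p * t₁ × t₁ ∣ℕ D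
prime-divisor-split {p} {t} {D} p-prime (divides u pD≡ut)
  with euclidsLemma u t p-prime (divides D (trans (sym pD≡ut) (ℕₚ.*-comm p D)))
... | inj₁ (divides v refl) = inj₁ (divides v (ℕₚ.*-cancelˡ-≡ D (v * t) p (trans pD≡ut (regroup v p t))))
  where
  instance _ = prime⇒nonZero p-prime
  regroup : ∀ v p t → v * p * t ≡ p * (v * t)
  regroup = solve-∀ℕ
... | inj₂ (divides v refl) = inj₂ (v , ℕₚ.*-comm v p ,
  divides u (ℕₚ.*-cancelˡ-≡ D (u * v) p (trans pD≡ut (regroup u v p))))
  where
  instance _ = prime⇒nonZero p-prime
  regroup : ∀ u v p → u * (v * p) ≡ p * (u * v)
  regroup = solve-∀ℕ

prime-power-divisor : ∀ {p t e} → Prime p → ∀ a → t ∣ℕ p ^ a * e → ∃[ i ] i ≤ a × ∃[ s ] s ∣ℕ e × t ≡ p ^ i * s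
prime-power-divisor {t = t} {e} p-prime zero t∣ =
  0 , z≤n , t , subst (t ∣ℕ_) (ℕₚ.*-identityˡ e) t∣ , sym (ℕₚ.*-identityˡ t)
prime-power-divisor {p} {t} {e} p-prime (suc a) t∣
  with prime-divisor-split p-prime (subst (t ∣ℕ_) (ℕₚ.*-assoc p (p ^ a) e) t∣)
... | inj₁ t∣′ = let i , i≤a , s , s∣e , t≡ = prime-power-divisor p-prime a t∣′ in i , ℕₚ.m≤n⇒m≤1+n i≤a , s , s∣e , t≡
... | inj₂ (t₁ , refl , t₁∣) = let i , i≤a , s , s∣e , t₁≡ = prime-power-divisor p-prime a t₁∣ in
  suc i , s≤s i≤a , s , s∣e , trans (cong (p *_) t₁≡) (sym (ℕₚ.*-assoc p (p ^ i) s))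

atmost-divisors-prime-power : ∀ {p e N} → Prime p → ∀ a → AtMost (_∣ℕ e) N → AtMost (_∣ℕ p ^ a * e) (suc a * N)
atmost-divisors-prime-power {p} {e} p-prime a atmost-∣e =
  atmost-fibration (λ t i → ∃[ s ] s ∣ℕ e × t ≡ p ^ i * s) ℕₚ._≟_
  (λ t∣ → let i , i≤a , s∣e = prime-power-divisor p-prime a t∣ in i , s≤s i≤a , s∣e)
  (atmost-< (suc a))
  λ {i} _ → atmost-encoding (λ t s → t ≡ p ^ i * s) id (λ t≡ t′≡ → trans t≡ (sym t′≡)) atmost-∣e

strip-factor : ∀ p {D} → .{{ℕ.NonTrivial p}} → 0 < D → Acc _<_ D → ∃[ a ] ∃[ e ] D ≡ p ^ a * e × ¬ (p ∣ℕ e)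
strip-factor p {D} D>0 (acc rs) with p ∣ℕ? D
... | no p∤D = 0 , D , sym (ℕₚ.*-identityˡ D) , p∤D
... | yes (divides zero refl) = contradiction D>0 λ ()
... | yes (divides E@(suc _) refl) =
  let a , e , E≡ , p∤e = strip-factor p (s≤s z≤n) (rs (ℕₚ.m<m*n E p (ℕ.nonTrivial⇒n>1 p)))
  in suc a , e , trans (ℕₚ.*-comm E p) (trans (cong (p *_) E≡) (sym (ℕₚ.*-assoc p (p ^ a) e))) , p∤e

atmost-divisors-large-primes : ∀ q {ps} → All Prime ps → All (2 ^ q ≤_) ps →
  ∃[ N ] AtMost (_∣ℕ product ps) N × N ^ q ≤ product ps
atmost-divisors-large-primes q []             []             =
  1 , atmost-subsingleton (λ t∣1 u∣1 → trans (∣1⇒≡1 t∣1) (sym (∣1⇒≡1 u∣1))) , ℕₚ.≤-reflexive (ℕₚ.^-zeroˡ q)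
atmost-divisors-large-primes q {p ∷ ps} (p-prime ∷ primes) (2^q≤p ∷ large) =
  let N , divisors , N^q≤ = atmost-divisors-large-primes q primes large
  in 2 * N , subst (λ s → AtMost (_∣ℕ s * product ps) (2 * N)) (ℕₚ.*-identityʳ p)
       (atmost-divisors-prime-power p-prime 1 divisors) , (begin
    (2 * N) ^ q            ≡⟨ ^-distribʳ-* 2 N q ⟩
    2 ^ q * N ^ q          ≤⟨ ℕₚ.*-mono-≤ 2^q≤p N^q≤ ⟩
    p * product ps         ∎)
  where open ℕₚ.≤-Reasoning

atmost-divisors-very-rough : ∀ q {D} → 0 < D → (2 ^ q) Rough D → ∃[ N ] AtMost (_∣ℕ D) N × N ^ q ≤ D
atmost-divisors-very-rough q {D} D>0 rough = subst (λ E → ∃[ N ] AtMost (_∣ℕ E) N × N ^ q ≤ E) (sym isFactorisation)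
  (atmost-divisors-large-primes q factorsPrime (All.tabulate λ {p} p∈ →
    rough⇒≤ {{prime⇒nonTrivial (All.lookup factorsPrime p∈)}}
      (rough∧∣⇒rough rough (subst (p ∣ℕ_) (sym isFactorisation) (∈⇒∣product p∈)))))
  where open PrimeFactorisation (factorise D {{>-nonZero D>0}})

-- Each of the at most 2^q primes below 2^q costs a factor q^q.
atmost-divisors-rough : ∀ q k B {D} → suc (suc B) + k ≡ 2 ^ q → 0 < D → suc (suc B) Rough D →
  ∃[ N ] AtMost (_∣ℕ D) N × N ^ q ≤ (q ^ q) ^ k * D
atmost-divisors-rough q zero B {D} 2+B≡2^q D>0 rough =
  let N , divisors , N^q≤D = atmost-divisors-very-rough q D>0
        (subst (_Rough D) (trans (sym (ℕₚ.+-identityʳ _)) 2+B≡2^q) rough)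
  in N , divisors , ℕₚ.≤-trans N^q≤D (ℕₚ.≤-reflexive (sym (ℕₚ.*-identityˡ D)))
atmost-divisors-rough q (suc k) B {D} 2+B+1+k≡2^q D>0 rough with suc (suc B) ∣ℕ? D
... | no B∤D =
  let N , divisors , N^q≤ = atmost-divisors-rough q k (suc B) (trans (sym (ℕₚ.+-suc _ k)) 2+B+1+k≡2^q) D>0
        (∤⇒rough-suc B∤D rough)
  in N , divisors , ℕₚ.≤-trans N^q≤ (ℕₚ.*-monoˡ-≤ D (ℕₚ.m≤n*m ((q ^ q) ^ k) (q ^ q) {{>-nonZero (q^q>0 q)}}))
... | yes B∣D with strip-factor (suc (suc B)) D>0 (<-wellFounded D)
... | a , zero , refl , _ = contradiction (subst (0 <_) (ℕₚ.*-zeroʳ (suc (suc B) ^ a)) D>0) λ ()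
... | a , e@(suc _) , refl , p∤e =
  let N , divisors , N^q≤ = atmost-divisors-rough q k (suc B) (trans (sym (ℕₚ.+-suc _ k)) 2+B+1+k≡2^q) (s≤s z≤n)
        (∤⇒rough-suc p∤e (rough∧∣⇒rough rough (n∣m*n (p ^ a))))
  in suc a * N , atmost-divisors-prime-power (rough∧∣⇒prime rough B∣D) a divisors , (begin
    (suc a * N) ^ q                           ≡⟨ ^-distribʳ-* (suc a) N q ⟩
    suc a ^ q * N ^ q                         ≤⟨ ℕₚ.*-mono-≤ (power≤exponential q a) N^q≤ ⟩
    q ^ q * 2 ^ a * ((q ^ q) ^ k * e)
      ≤⟨ ℕₚ.*-monoˡ-≤ _ (ℕₚ.*-monoʳ-≤ (q ^ q) (ℕₚ.^-monoˡ-≤ a (s≤s (s≤s z≤n)))) ⟩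
    q ^ q * p ^ a * ((q ^ q) ^ k * e)         ≡⟨ ℕₚ.[m*n]*[o*p]≡[m*o]*[n*p] (q ^ q) (p ^ a) ((q ^ q) ^ k) e ⟩
    (q ^ q) ^ suc k * (p ^ a * e)             ∎)
  where
  open ℕₚ.≤-Reasoning
  p = suc (suc B)

divisors : ℕ → List ℕ
divisors D = List.filter (_∣ℕ? D) (List.upTo (suc D))

atmost-divisors : ∀ {D} → 0 < D → AtMost (_∣ℕ D) (length (divisors D))
atmost-divisors {D} D>0 = atmost-list (divisors D)
  λ t∣D → ∈ₚ.∈-filter⁺ (_∣ℕ? D) (∈ₚ.∈-upTo⁺ (s≤s (∣⇒≤ {{>-nonZero D>0}} t∣D))) t∣D

divisor-bound : ∀ q → ∃[ c ] ∀ D → 0 < D → length (divisors D) ^ suc q ≤ c * D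
divisor-bound q = (suc q ^ suc q) ^ k , λ D D>0 →
  let N , atmost , N^q≤ = atmost-divisors-rough (suc q) k 0 (ℕₚ.m+[n∸m]≡n 2≤2^[1+q]) D>0 2-rough
  in ℕₚ.≤-trans (ℕₚ.^-monoˡ-≤ (suc q) (atmost (divisors D) (Uniqueₚ.filter⁺ (_∣ℕ? D) (Uniqueₚ.upTo⁺ (suc D)))
       (Allₚ.all-filter (_∣ℕ? D) (List.upTo (suc D))))) N^q≤
  where
  k = 2 ^ suc q ∸ 2
  2≤2^[1+q] : 2 ≤ 2 ^ suc q
  2≤2^[1+q] = ℕₚ.^-monoʳ-≤ 2 (s≤s (z≤n {q}))

maxDivisors : ℕ → ℕ
maxDivisors zero    = 0
maxDivisors (suc X) = maxDivisors X ⊔ length (divisors (suc X))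

divisors≤maxDivisors : ∀ {D X} → 0 < D → D ≤ X → length (divisors D) ≤ maxDivisors X
divisors≤maxDivisors {suc D} {suc X} D>0 (s≤s D≤X) with ℕₚ.m≤n⇒m<n∨m≡n D≤X
... | inj₁ D<X  = ℕₚ.≤-trans (divisors≤maxDivisors D>0 D<X) (ℕₚ.m≤m⊔n (maxDivisors X) _)
... | inj₂ refl = ℕₚ.m≤n⊔m (maxDivisors X) _

maxDivisors-bound : ∀ q → ∃[ c ] ∀ X → maxDivisors X ^ suc q ≤ c * X
maxDivisors-bound q = let c , τ^q≤ = divisor-bound q in c , bound c τ^q≤
  where
  bound : ∀ c → (∀ D → 0 < D → length (divisors D) ^ suc q ≤ c * D) → ∀ X → maxDivisors X ^ suc q ≤ c * X
  bound c τ^q≤ zero    = z≤n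
  bound c τ^q≤ (suc X) with ℕₚ.⊔-sel (maxDivisors X) (length (divisors (suc X)))
  ... | inj₁ max≡ = subst (λ t → t ^ suc q ≤ c * suc X) (sym max≡)
    (ℕₚ.≤-trans (bound c τ^q≤ X) (ℕₚ.*-monoʳ-≤ c (ℕₚ.n≤1+n X)))
  ... | inj₂ max≡ = subst (λ t → t ^ suc q ≤ c * suc X) (sym max≡) (τ^q≤ (suc X) (s≤s z≤n))

atmost-integer-divisors : ∀ {d X} → d ≢ 0ℤ → ∣ d ∣ ≤ X → AtMost (_∣ℤ d) (2 * maxDivisors X)
atmost-integer-divisors {d} {X} d≢0 ∣d∣≤X = subst (AtMost _) (ℕₚ.*-comm (maxDivisors X) 2)
  (atmost-fibres ℕₚ._≟_ ∣_∣ id (atmost-≤ (divisors≤maxDivisors ∣d∣>0 ∣d∣≤X) (atmost-divisors ∣d∣>0))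
    λ {t} _ → atmost-list (+ t ∷ - + t ∷ []) λ { {u} (_ , refl) → ±∣u∣ u })
  where
  ∣d∣>0 : 0 < ∣ d ∣
  ∣d∣>0 = ℕₚ.n≢0⇒n>0 (d≢0 ∘ ℤₚ.∣i∣≡0⇒i≡0)
  ±∣u∣ : ∀ u → u ∈ + ∣ u ∣ ∷ - + ∣ u ∣ ∷ []
  ±∣u∣ (+ u)      = here refl
  ±∣u∣ ℤ.-[1+ u ] = there (here refl)

-- Asymptotics

Eventually : (ℕ → Set) → Set
Eventually P = ∃[ H₀ ] ∀ H → H ≥ H₀ → P H

eventually-map : ∀ {P Q : ℕ → Set} → (∀ {H} → P H → Q H) → Eventually P → Eventually Q
eventually-map P⇒Q (H₀ , p) = H₀ , λ H H≥ → P⇒Q (p H H≥)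

eventually-× : ∀ {P Q : ℕ → Set} → Eventually P → Eventually Q → Eventually (λ H → P H × Q H)
eventually-× (H₁ , p) (H₂ , q) = H₁ ⊔ H₂ , λ H H≥ →
  p H (ℕₚ.≤-trans (ℕₚ.m≤m⊔n H₁ H₂) H≥) , q H (ℕₚ.≤-trans (ℕₚ.m≤n⊔m H₁ H₂) H≥)

eventually-≥ : ∀ k → Eventually (k ≤_)
eventually-≥ k = k , λ _ H≥k → H≥k

Subpolynomial : (ℕ → ℕ) → Set
Subpolynomial f = ∀ q → Eventually λ H → f H ^ q ≤ H

subpolynomial-const : ∀ c → Subpolynomial (λ _ → c)
subpolynomial-const c q = eventually-≥ (c ^ q)

subpolynomial-* : ∀ {f g} → Subpolynomial f → Subpolynomial g → Subpolynomial (λ H → f H * g H)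
subpolynomial-* {f} {g} F G q = eventually-map (λ {H} (f²q≤H , g²q≤H) →
    subst (_≤ H) (sym (^-distribʳ-* (f H) (g H) q)) (product≤ (f H) (g H) f²q≤H g²q≤H))
  (eventually-× (F (q + q)) (G (q + q)))
  where
  product≤ : ∀ {H} a b → a ^ (q + q) ≤ H → b ^ (q + q) ≤ H → a ^ q * b ^ q ≤ H
  product≤ {H} a b a²q≤H b²q≤H with ℕₚ.≤-total a b
  ... | inj₁ a≤b = ℕₚ.≤-trans (ℕₚ.*-monoˡ-≤ (b ^ q) (ℕₚ.^-monoˡ-≤ q a≤b)) (subst (_≤ H) (ℕₚ.^-distribˡ-+-* b q q) b²q≤H)
  ... | inj₂ b≤a = ℕₚ.≤-trans (ℕₚ.*-monoʳ-≤ (a ^ q) (ℕₚ.^-monoˡ-≤ q b≤a)) (subst (_≤ H) (ℕₚ.^-distribˡ-+-* a q q) a²q≤H)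

subpolynomial-^ : ∀ {f} → Subpolynomial f → ∀ k → Subpolynomial (λ H → f H ^ k)
subpolynomial-^ {f} F k q = eventually-map (λ {H} → subst (_≤ H) (sym (ℕₚ.^-*-assoc (f H) k q))) (F (k * q))

^-cancelˡ-≤ : ∀ k {x y} → x ^ suc k ≤ y ^ suc k → x ≤ y
^-cancelˡ-≤ k x^k≤y^k = ℕₚ.≮⇒≥ λ y<x → ℕₚ.<⇒≱ (ℕₚ.^-monoˡ-< (suc k) y<x) x^k≤y^k

subpolynomial-maxDivisors : ∀ b k → Subpolynomial (λ H → maxDivisors (b * H ^ k))
subpolynomial-maxDivisors b k zero    = eventually-≥ 1
subpolynomial-maxDivisors b k (suc q) =
  let c , τ^≤ = maxDivisors-bound (k + q * suc k) in
  c * b , λ H H≥ → ^-cancelˡ-≤ k (begin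
    (maxDivisors (b * H ^ k) ^ suc q) ^ suc k     ≡⟨ ℕₚ.^-*-assoc (maxDivisors (b * H ^ k)) (suc q) (suc k) ⟩
    maxDivisors (b * H ^ k) ^ (suc q * suc k)     ≤⟨ τ^≤ (b * H ^ k) ⟩
    c * (b * H ^ k)                               ≡⟨ ℕₚ.*-assoc c b (H ^ k) ⟨
    c * b * H ^ k                                 ≤⟨ ℕₚ.*-monoˡ-≤ (H ^ k) H≥ ⟩
    H ^ suc k                                     ∎)
  where open ℕₚ.≤-Reasoning

binary-length : ∀ H → ∃[ l ] H < 2 ^ l × 2 ^ l ≤ suc (2 * H)
binary-length zero    = 0 , s≤s z≤n , s≤s z≤n
binary-length (suc H) with binary-length H
... | l , H<2^l , 2^l≤ with suc H ℕₚ.<? 2 ^ l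
... | yes 1+H<2^l = l , 1+H<2^l , ℕₚ.≤-trans 2^l≤ (s≤s (ℕₚ.*-monoʳ-≤ 2 (ℕₚ.n≤1+n H)))
... | no 1+H≮2^l  = suc l , ℕₚ.≤-<-trans H<2^l (ℕₚ.^-monoʳ-< 2 (s≤s (s≤s z≤n)) (ℕₚ.n<1+n l)) ,
                    ℕₚ.m≤n⇒m≤1+n (ℕₚ.*-monoʳ-≤ 2 (ℕₚ.≮⇒≥ 1+H≮2^l))

level : ℕ → ℕ
level H = suc (proj₁ (binary-length H))

2H<2^level : ∀ H → 2 * H < 2 ^ level H
2H<2^level H = ℕₚ.*-monoʳ-< 2 (proj₁ (proj₂ (binary-length H)))

2^level≤6H : ∀ {H} → 1 ≤ H → 2 ^ level H ≤ 6 * H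
2^level≤6H {H} 1≤H = begin
  2 ^ level H              ≤⟨ ℕₚ.*-monoʳ-≤ 2 (proj₂ (proj₂ (binary-length H))) ⟩
  2 * (1 + 2 * H)          ≤⟨ ℕₚ.*-monoʳ-≤ 2 (ℕₚ.+-monoˡ-≤ (2 * H) 1≤H) ⟩
  2 * (3 * H)              ≡⟨ ℕₚ.*-assoc 2 3 H ⟨
  6 * H                    ∎
  where open ℕₚ.≤-Reasoning

level-unbounded : ∀ k {H} → 2 ^ k ≤ H → k ≤ level H
level-unbounded k {H} 2^k≤H = ℕₚ.≮⇒≥ λ level<k → ℕₚ.<-irrefl refl (begin-strict
  2 ^ level H     ≤⟨ ℕₚ.^-monoʳ-≤ 2 (ℕₚ.<⇒≤ level<k) ⟩
  2 ^ k           ≤⟨ 2^k≤H ⟩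
  H               ≤⟨ ℕₚ.m≤n*m H 2 ⟩
  2 * H           <⟨ 2H<2^level H ⟩
  2 ^ level H     ∎)
  where open ℕₚ.≤-Reasoning

subpolynomial-level : Subpolynomial (λ H → suc (level H))
subpolynomial-level q = 2 ^ (c * 6) , λ H H≥ → ℕₚ.*-cancelʳ-≤ (suc (level H) ^ q) H (c * 6) {{c*6≢0}} (begin
    suc (level H) ^ q * (c * 6)
      ≤⟨ ℕₚ.*-monoʳ-≤ (suc (level H) ^ q) (ℕₚ.m≤n⇒m≤1+n (level-unbounded (c * 6) H≥)) ⟩
    suc (level H) ^ q * suc (level H)      ≡⟨ ℕₚ.*-comm (suc (level H) ^ q) (suc (level H)) ⟩
    suc (level H) ^ suc q                  ≤⟨ power≤exponential (suc q) (level H) ⟩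
    c * 2 ^ level H                        ≤⟨ ℕₚ.*-monoʳ-≤ c (2^level≤6H (ℕₚ.≤-trans (ℕₚ.m^n>0 2 (c * 6)) H≥)) ⟩
    c * (6 * H)                            ≡⟨ ℕₚ.*-assoc c 6 H ⟨
    c * 6 * H                              ≡⟨ ℕₚ.*-comm (c * 6) H ⟩
    H * (c * 6)                            ∎)
  where
  open ℕₚ.≤-Reasoning
  c = suc q ^ suc q
  c*6≢0 : ℕ.NonZero (c * 6)
  c*6≢0 = >-nonZero (ℕₚ.*-mono-≤ {1} {c} {1} (q^q>0 (suc q)) (s≤s z≤n))

subpolynomial-polylog : ∀ n → Subpolynomial (λ H → polylog n (level H))
subpolynomial-polylog n = subpolynomial-* (subpolynomial-const (suc n)) (subpolynomial-^ subpolynomial-level n)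

volume-scale : ℕ → ℕ
volume-scale n = 6 * 2 ^ (n + 2)

volume≤ : ∀ n k {H} → 1 ≤ H → volume n (level H) ^ k ≤ volume-scale n ^ (n * k) * H ^ (n * k)
volume≤ n k {H} 1≤H = begin
  ((2 ^ (level H + (n + 2))) ^ n) ^ k                ≡⟨ ℕₚ.^-*-assoc (2 ^ (level H + (n + 2))) n k ⟩
  (2 ^ (level H + (n + 2))) ^ (n * k)                ≤⟨ ℕₚ.^-monoˡ-≤ (n * k) side≤ ⟩
  (volume-scale n * H) ^ (n * k)                     ≡⟨ ^-distribʳ-* (volume-scale n) H (n * k) ⟩
  volume-scale n ^ (n * k) * H ^ (n * k)             ∎
  where
  open ℕₚ.≤-Reasoning
  exchange : ∀ H x → 6 * H * x ≡ 6 * x * H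
  exchange = solve-∀ℕ
  side≤ : 2 ^ (level H + (n + 2)) ≤ volume-scale n * H
  side≤ = begin
    2 ^ (level H + (n + 2))          ≡⟨ ℕₚ.^-distribˡ-+-* 2 (level H) (n + 2) ⟩
    2 ^ level H * 2 ^ (n + 2)        ≤⟨ ℕₚ.*-monoˡ-≤ (2 ^ (n + 2)) (2^level≤6H 1≤H) ⟩
    6 * H * 2 ^ (n + 2)              ≡⟨ exchange H (2 ^ (n + 2)) ⟩
    volume-scale n * H               ∎

-- Uniformly in a; the quotients (p + 1) / (q + 1) are the positive rational values of ε.
_≤H^_+o[1] : {A : Set} → (ℕ → A → ℕ) → ℕ → Set
N ≤H^ e +o[1] = ∀ p q → Eventually λ H → ∀ a → N H a ^ suc q ≤ H ^ (e * suc q + suc p)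

subpolynomial⇒+o[1] : ∀ {A : Set} {N : ℕ → A → ℕ} {f} e → Subpolynomial f →
  (∀ {H} → 1 ≤ H → ∀ a → N H a ≤ f H * H ^ e) → N ≤H^ e +o[1]
subpolynomial⇒+o[1] {N = N} {f} e F N≤ p q = eventually-map (λ {H} (f^≤H , 1≤H) a → begin
    N H a ^ suc q                        ≤⟨ ℕₚ.^-monoˡ-≤ (suc q) (N≤ 1≤H a) ⟩
    (f H * H ^ e) ^ suc q                ≡⟨ ^-distribʳ-* (f H) (H ^ e) (suc q) ⟩
    f H ^ suc q * (H ^ e) ^ suc q        ≤⟨ ℕₚ.*-mono-≤ f^≤H (ℕₚ.≤-reflexive (ℕₚ.^-*-assoc H e (suc q))) ⟩
    H * H ^ (e * suc q)
      ≤⟨ ℕₚ.*-monoˡ-≤ (H ^ (e * suc q)) (ℕₚ.m≤m*n H (H ^ p) {{ℕₚ.m^n≢0 H p {{>-nonZero 1≤H}}}}) ⟩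
    H ^ suc p * H ^ (e * suc q)          ≡⟨ ℕₚ.^-distribˡ-+-* H (suc p) (e * suc q) ⟨
    H ^ (suc p + e * suc q)              ≡⟨ cong (H ^_) (ℕₚ.+-comm (suc p) (e * suc q)) ⟩
    H ^ (e * suc q + suc p)              ∎)
  (eventually-× (F (suc q)) (eventually-≥ 1))
  where open ℕₚ.≤-Reasoning

volume⇒+o[1] : ∀ {A : Set} {N : ℕ → A → ℕ} {f} n k {e} → n * k ≡ e → Subpolynomial f →
  (∀ {H} → 1 ≤ H → ∀ a → N H a ≤ f H * volume n (level H) ^ k) → N ≤H^ e +o[1]
volume⇒+o[1] {N = N} {f} n k refl F N≤ =
  subpolynomial⇒+o[1] (n * k) (subpolynomial-* F (subpolynomial-const (volume-scale n ^ (n * k)))) λ {H} 1≤H a → begin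
    N H a                                                    ≤⟨ N≤ 1≤H a ⟩
    f H * volume n (level H) ^ k                             ≤⟨ ℕₚ.*-monoʳ-≤ (f H) (volume≤ n k 1≤H) ⟩
    f H * (volume-scale n ^ (n * k) * H ^ (n * k))           ≡⟨ ℕₚ.*-assoc (f H) _ (H ^ (n * k)) ⟨
    f H * volume-scale n ^ (n * k) * H ^ (n * k)             ∎
  where open ℕₚ.≤-Reasoning

module CountingAtLevel (H : ℕ) = CountingProducts (level H) H (2H<2^level H)

tuples-unique : ∀ m n H → Unique (vecsOf m (boundedMats n H))
tuples-unique m n H = vecsOf-unique m (vecsOf-unique n (box-unique n H))

prodMats≡⇔compose≗ : ∀ {n m} {As : Vec (Matrix n) m} {C} → prodMats As ≡ C ⇔ compose As ≗ act C
prodMats≡⇔compose≗ {As = As} = mk⇔ (λ { refl v → sym (act-prodMats As v) })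
  (λ As≗C → act-injective λ v → trans (act-prodMats As v) (As≗C v))

countT≤ : ∀ m n H C {N} → AtMost (Factorisation H (act C)) N → countT m n H C ≤ N
countT≤ m n H C atmost-factorisations =
  atmost-factorisations _ (Uniqueₚ.filter⁺ _ (tuples-unique m n H)) (All.tabulate factorisation)
  where
  product≡C? = λ (As : Vec (Matrix n) m) → prodMats As ≟M C
  factorisation : ∀ {As} → As ∈ List.filter product≡C? (vecsOf m (boundedMats n H)) → Factorisation H (act C) As
  factorisation {As} As∈ = let As∈′ , product≡C = ∈ₚ.∈-filter⁻ product≡C? {xs = vecsOf m (boundedMats n H)} As∈ in
    VAll.map ∈-boundedMats⁻ (∈-vecsOf⁻ As∈′) , Equivalence.to (prodMats≡⇔compose≗ {As = As}) product≡C

countT-two-factors : ∀ n → (λ H C → countT 2 n H C) ≤H^ n * n +o[1]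
countT-two-factors n = volume⇒+o[1] n n refl
  (subpolynomial-* (subpolynomial-const (suc n)) (subpolynomial-polylog n)) λ {H} _ C →
  ℕₚ.≤-trans (countT≤ 2 n H C (CountingAtLevel.atmost-two-factors H (act C)))
    (ℕₚ.≤-reflexive (sym (ℕₚ.*-assoc (suc n) (polylog n (level H)) (volume n (level H) ^ n))))

countT-zero : ∀ m n → (λ H (_ : ⊤) → countT (suc m) n H (zeroMat n)) ≤H^ m * (n * n) +o[1]
countT-zero m n = volume⇒+o[1] n (m * n) (exponent n m)
  (subpolynomial-* (subpolynomial-const (suc n ^ suc m)) (subpolynomial-^ (subpolynomial-polylog n) (suc m)))
  λ {H} _ _ → ℕₚ.≤-trans
    (countT≤ (suc m) n H (zeroMat n) (atmost-⊆ (λ { (As≤H , As≗0) → As≤H , λ v → trans (As≗0 v) (act-zeroMat v) })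
      (CountingAtLevel.atmost-zero-products H m)))
    (ℕₚ.≤-reflexive (sym (ℕₚ.*-assoc (suc n ^ suc m) _ _)))
  where
  exponent : ∀ n m → n * (m * n) ≡ m * (n * n)
  exponent = solve-∀ℕ

countT-nonzero : ∀ m k → let n = suc (suc k) in
  Eventually λ H → ∀ C → C ≢ zeroMat n → countT (suc m) n H C ≤ H ^ (suc m * (n * n) ∸ n)
countT-nonzero m k = eventually-map (λ {H} (f^1≤H , 1≤H) C C≢0 → begin
    countT (suc m) n H C
      ≤⟨ countT≤ (suc m) n H C (CountingAtLevel.atmost-nonzero-products H m (act≢0 C≢0)) ⟩
    W H * volume n (level H) ^ (n * m + k)             ≤⟨ ℕₚ.*-monoʳ-≤ (W H) (volume≤ n (n * m + k) 1≤H) ⟩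
    W H * (volume-scale n ^ e * H ^ e)                 ≡⟨ ℕₚ.*-assoc (W H) (volume-scale n ^ e) (H ^ e) ⟨
    f H * H ^ e
      ≤⟨ ℕₚ.*-monoˡ-≤ (H ^ e) (subst (_≤ H) (ℕₚ.^-identityʳ (f H)) f^1≤H) ⟩
    H ^ suc e                                          ≤⟨ ℕₚ.^-monoʳ-≤ H {{>-nonZero 1≤H}} exponent ⟩
    H ^ (suc m * (n * n) ∸ n)                          ∎)
  (eventually-× (f-subpolynomial 1) (eventually-≥ 1))
  where
  open ℕₚ.≤-Reasoning
  n = suc (suc k)
  e = n * (n * m + k)
  W f : ℕ → ℕ
  W H = suc m * (n * polylog n (level H))
  f H = W H * volume-scale n ^ e
  f-subpolynomial : Subpolynomial f
  f-subpolynomial = subpolynomial-* (subpolynomial-* (subpolynomial-const (suc m))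
    (subpolynomial-* (subpolynomial-const n) (subpolynomial-polylog n))) (subpolynomial-const (volume-scale n ^ e))
  act≢0 : ∀ {C} → C ≢ zeroMat n → Nonzero (act C)
  act≢0 C≢0 C≗0 = C≢0 (act-injective λ v → trans (C≗0 v) (sym (act-zeroMat v)))
  exponent : suc e ≤ suc m * (n * n) ∸ n
  exponent = begin
    suc e                          ≤⟨ ℕₚ.m≤m+n (suc e) (suc k) ⟩
    suc e + suc k                  ≡⟨ ℕₚ.m+n∸n≡m (suc e + suc k) n ⟨
    suc e + suc k + n ∸ n          ≡⟨ cong (_∸ n) (expand m k) ⟩
    suc m * (n * n) ∸ n            ∎
    where
    expand : ∀ m k → suc ((2 + k) * ((2 + k) * m + k)) + suc k + (2 + k) ≡ suc m * ((2 + k) * (2 + k))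
    expand = solve-∀ℕ

bounded-prodMats : ∀ {n m H} {As : Vec (Matrix n) m} → VAll.All (BoundedMat H) As →
  BoundedMat ((H * n) ^ m) (prodMats As)
bounded-prodMats {n} [] = VAllₚ.lookup⁻ λ i → VAllₚ.lookup⁻ λ j →
  subst (λ t → ∣ t ∣ ≤ 1) (sym (entry-identity i j)) (VAllₚ.lookup⁺ (bounded-unit i) j)
  where
  bounded-unit : ∀ {n} (i : Fin n) → Bounded 1 (unit i)
  bounded-unit zero    = ℕₚ.≤-refl ∷ bounded-𝟘
  bounded-unit (suc i) = z≤n ∷ bounded-unit i
bounded-prodMats {n} {suc m} {H} {A ∷ As} (A≤H ∷ As≤H) = VAllₚ.lookup⁻ λ i →
  subst (Bounded (H * n * (H * n) ^ m)) (sym (lookup-⊗ A (prodMats As) i))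
    (bounded-≤ (ℕₚ.≤-reflexive (sym (ℕₚ.*-assoc H n ((H * n) ^ m))))
      (bounded⇒combBounded (bounded-prodMats As≤H) (VAllₚ.lookup⁺ A≤H i)))

∣det-prodMats∣≤ : ∀ {n m H} {As : Vec (Matrix n) m} → VAll.All (BoundedMat H) As →
  ∣ det (prodMats As) ∣ ≤ n ! * n ^ (m * n) * H ^ (m * n)
∣det-prodMats∣≤ {n} {m} {H} {As} As≤H = begin
  ∣ det (prodMats As) ∣
    ≤⟨ ∣detF∣≤ n (entry (prodMats As)) (λ i j → VAllₚ.lookup⁺ (VAllₚ.lookup⁺ (bounded-prodMats As≤H) i) j) ⟩
  n ! * ((H * n) ^ m) ^ n                  ≡⟨ cong (n ! *_) (ℕₚ.^-*-assoc (H * n) m n) ⟩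
  n ! * (H * n) ^ (m * n)
    ≡⟨ cong (n ! *_) (trans (cong (_^ (m * n)) (ℕₚ.*-comm H n)) (^-distribʳ-* n H (m * n))) ⟩
  n ! * (n ^ (m * n) * H ^ (m * n))        ≡⟨ ℕₚ.*-assoc (n !) (n ^ (m * n)) (H ^ (m * n)) ⟨
  n ! * n ^ (m * n) * H ^ (m * n)          ∎
  where open ℕₚ.≤-Reasoning

countT-nonsingular : ∀ m k → let n = suc k in
  (λ H ((C , _) : ∃ λ (C : Matrix n) → det C ≢ 0ℤ) → countT (suc m) n H C) ≤H^ m * (n * n ∸ n) +o[1]
countT-nonsingular m k = volume⇒+o[1] n (k * m) exponent (subpolynomial-^ f-subpolynomial m)
  λ {H} _ (C , det≢0) → countT≤ (suc m) n H C (atmost-factorisations H C det≢0)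
  where
  open ≡-Reasoning
  n = suc k
  b = n ! * n ^ (suc m * n)
  f : ℕ → ℕ
  f H = polylog n (level H) * (2 * maxDivisors (b * H ^ (suc m * n)))
  f-subpolynomial : Subpolynomial f
  f-subpolynomial = subpolynomial-* (subpolynomial-polylog n)
    (subpolynomial-* (subpolynomial-const 2) (subpolynomial-maxDivisors b (suc m * n)))
  exponent : n * (k * m) ≡ m * (n * n ∸ n)
  exponent = trans (regroup n k m) (cong (m *_) (sym (ℕₚ.m+n∸m≡n n (k * n))))
    where
    regroup : ∀ n k m → n * (k * m) ≡ m * (k * n)
    regroup = solve-∀ℕ
  atmost-factorisations : ∀ H C → det C ≢ 0ℤ → AtMost (Factorisation H (act C)) (f H ^ m * volume n (level H) ^ (k * m))
  atmost-factorisations H C det≢0 = atmost-inhabited λ { As (As≤H , As≗C) →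
    let ∣det∣≤ = subst (λ A → ∣ det A ∣ ≤ b * H ^ (suc m * n))
          (Equivalence.from (prodMats≡⇔compose≗ {As = As}) As≗C) (∣det-prodMats∣≤ As≤H)
    in subst (AtMost _) bound (atmost-nonsingular-products det≢0
         (CountingAtLevel.atmost-invertible H det≢0 (atmost-integer-divisors det≢0 ∣det∣≤))
         m (comb-linear (cofactorMatrix C)) (act-cofactors C)) }
    where
    W = polylog n (level H)
    V = volume n (level H)
    T = 2 * maxDivisors (b * H ^ (suc m * n))
    bound : (W * (T * V ^ k)) ^ m ≡ (W * T) ^ m * V ^ (k * m)
    bound = begin
      (W * (T * V ^ k)) ^ m           ≡⟨ cong (_^ m) (ℕₚ.*-assoc W T (V ^ k)) ⟨
      (W * T * V ^ k) ^ m             ≡⟨ ^-distribʳ-* (W * T) (V ^ k) m ⟩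
      (W * T) ^ m * (V ^ k) ^ m       ≡⟨ cong ((W * T) ^ m *_) (ℕₚ.^-*-assoc V k m) ⟩
      (W * T) ^ m * V ^ (k * m)       ∎

zeroMat∈boundedMats : ∀ n H → zeroMat n ∈ boundedMats n H
zeroMat∈boundedMats n H =
  subst (_∈ boundedMats n H) (sym (zeroMat≡replicate n)) (∈-boundedMats⁺ {H = H} (all-replicate n bounded-𝟘))

length-boundedMats : ∀ n H → length (boundedMats n H) ≡ suc (2 * H) ^ (n * n)
length-boundedMats n H = begin
  length (boundedMats n H)      ≡⟨ length-vecsOf n (box n H) ⟩
  length (box n H) ^ n          ≡⟨ cong (_^ n) (length-box n H) ⟩
  (suc (2 * H) ^ n) ^ n         ≡⟨ ℕₚ.^-*-assoc (suc (2 * H)) n n ⟩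
  suc (2 * H) ^ (n * n)         ∎
  where open ≡-Reasoning

countT-zero-≥ : ∀ m n H → H ^ (m * (n * n)) ≤ countT (suc m) n H (zeroMat n)
countT-zero-≥ m n H = begin
  H ^ (m * (n * n))                            ≤⟨ ℕₚ.^-monoˡ-≤ (m * (n * n)) (ℕₚ.m≤n⇒m≤1+n (ℕₚ.m≤n*m H 2)) ⟩
  suc (2 * H) ^ (m * (n * n))                  ≡⟨ cong (suc (2 * H) ^_) (ℕₚ.*-comm m (n * n)) ⟩
  suc (2 * H) ^ (n * n * m)                    ≡⟨ ℕₚ.^-*-assoc (suc (2 * H)) (n * n) m ⟨
  (suc (2 * H) ^ (n * n)) ^ m                  ≡⟨ cong (_^ m) (length-boundedMats n H) ⟨
  length (boundedMats n H) ^ m                 ≡⟨ length-vecsOf m (boundedMats n H) ⟨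
  length tuples                                ≡⟨ Listₚ.length-map (zeroMat n ∷_) tuples ⟨
  length (List.map (zeroMat n ∷_) tuples)
    ≤⟨ atmost-list solutions id _ (Uniqueₚ.map⁺ Vecₚ.∷-injectiveʳ (tuples-unique m n H))
         (Allₚ.map⁺ (All.tabulate zero∷As∈)) ⟩
  countT (suc m) n H (zeroMat n)               ∎
  where
  open ℕₚ.≤-Reasoning
  tuples = vecsOf m (boundedMats n H)
  solutions = List.filter (λ As → prodMats As ≟M zeroMat n) (vecsOf (suc m) (boundedMats n H))
  zero∷As∈ : ∀ {As} → As ∈ tuples → zeroMat n ∷ As ∈ solutions
  zero∷As∈ {As} As∈ =
    ∈ₚ.∈-filter⁺ (λ As → prodMats As ≟M zeroMat n) (∈-vecsOf⁺ (zeroMat∈boundedMats n H ∷ ∈-vecsOf⁻ As∈))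
    (Equivalence.from (prodMats≡⇔compose≗ {As = zeroMat n ∷ As}) λ v →
      trans (act-zeroMat (compose As v)) (sym (act-zeroMat v)))

singular-1×1 : ∀ (C : Matrix 1) → det C ≡ 0ℤ → C ≡ zeroMat 1
singular-1×1 ((c ∷ []) ∷ []) det≡0 = cong (λ t → (t ∷ []) ∷ []) (trans (det≡ c) det≡0)
  where
  det≡ : ∀ c → c ≡ 1ℤ ℤ.* (c ℤ.* 1ℤ) ℤ.+ 0ℤ
  det≡ = solve-∀

countT-singular : ∀ m k → let n = suc k in
  Eventually λ H → ∀ C → C ≢ zeroMat n → det C ≡ 0ℤ → countT (suc m) n H C ≤ H ^ (suc m * (n * n) ∸ n)
countT-singular m zero    = 0 , λ _ _ C C≢0 det≡0 → contradiction (singular-1×1 C det≡0) C≢0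
countT-singular m (suc k) = eventually-map (λ bound C C≢0 _ → bound C C≢0) (countT-nonzero m k)

theorem2p1 : (m n : ℕ) → 1 ≤ m → 1 ≤ n →
    -- C nonsingular: # ≤ H^((m-1)(n²-n) + ε), ε = (suc p)/(suc q), uniformly in C
    ((p q : ℕ) → ∃[ H₀ ] ((H : ℕ) → H ≥ H₀ → (C : Matrix n) → det C ≢ + 0 →
      countT m n H C ^ suc q ≤ H ^ (((m ∸ 1) * (n * n ∸ n)) * suc q + suc p)))
  × -- C ≠ O singular, m = 2: # ≤ H^(n² + ε), uniformly in C
    (m ≡ 2 → (p q : ℕ) → ∃[ H₀ ] ((H : ℕ) → H ≥ H₀ → (C : Matrix n) → C ≢ zeroMat n → det C ≡ + 0 →
      countT m n H C ^ suc q ≤ H ^ ((n * n) * suc q + suc p)))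
  × -- C ≠ O singular, m ≥ 3: # ≤ H^(mn² - n) for H large, uniformly in C
    (m ≥ 3 → ∃[ H₀ ] ((H : ℕ) → H ≥ H₀ → (C : Matrix n) → C ≢ zeroMat n → det C ≡ + 0 →
      countT m n H C ≤ H ^ (m * (n * n) ∸ n)))
  × -- C = O: H^((m-1)n²) ≪ #
    (∃[ c ] ((H : ℕ) → H ≥ 1 → H ^ ((m ∸ 1) * (n * n)) ≤ c * countT m n H (zeroMat n)))
  × -- C = O: # ≤ H^((m-1)n² + ε)
    ((p q : ℕ) → ∃[ H₀ ] ((H : ℕ) → H ≥ H₀ →
      countT m n H (zeroMat n) ^ suc q ≤ H ^ (((m ∸ 1) * (n * n)) * suc q + suc p)))
theorem2p1 (suc m) (suc k) _ _ =
    (λ p q → eventually-map (λ bound C det≢0 → bound (C , det≢0)) (countT-nonsingular m k p q))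
  , (λ { refl p q → eventually-map (λ bound C _ _ → bound C) (countT-two-factors (suc k) p q) })
  , (λ _ → countT-singular m k)
  , (1 , λ H _ → ℕₚ.≤-trans (countT-zero-≥ m (suc k) H) (ℕₚ.≤-reflexive (sym (ℕₚ.*-identityˡ _))))
  , (λ p q → eventually-map (λ bound → bound tt) (countT-zero m (suc k) p q))
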